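{- Let $1\le n<m$, $q\in\mathbb C\setminus\{0\}$, and let $A=(a_{ij})_{m\times m}$ be a $q$-Cartier-Foata matrix, i.e. $$a_{jl}a_{ik}=a_{ik}a_{jl}\ (i<j,\ k<l),\quad a_{jl}a_{ik}=q^2a_{ik}a_{jl}\ (i<j,\ k>l),\quad a_{jk}a_{ik}=q\,a_{ik}a_{jk}\ (i<j).$$ For $n<i,j\le m$ let $$c^q_{ij}=-{\det}_q^{ -1}(I-A_0)\cdot{\det}_q\begin{pmatrix} I-A_0 & -a_{*j}\\ -a_{i*} & -a_{ij}\end{pmatrix},\qquad C^q=(c^q_{ij})_{n+1\le i,j\le m}.$$ Then ${\det}_q^{ -1}(I-A_0)\cdot{\det}_q(I-A)={\det}_q(I-C^q)$.
   Context: $\mathcal A$ is the $\mathbb C$-algebra of formal power series in non-commuting variables $a_{ij}$, $1\le i,j\le m$; identities are in the quotient by the closed two-sided ideal generated by the stated relations. $A_0=(a_{ij})_{1\le i,j\le n}$, $a_{i*}=(a_{i1},\dots,a_{in})$, $a_{*j}=(a_{1j},\dots,a_{nj})^T$. For words $\lambda,\mu$ over $\{1,\dots,m\}$ of equal length, $a_{\lambda,\mu}=a_{\lambda_1\mu_1}\cdots a_{\lambda_\ell\mu_\ell}$ and $\operatorname{inv}$ denotes number of inversions; the weight is $w(\lambda,\mu)=q^{\operatorname{inv}\mu-\operatorname{inv}\lambda}$. For a square matrix $B=(b_{rs})_{N\times N}$ with row labels $\rho_1<\dots<\rho_N$ and column labels $\kappa_1<\dots<\kappa_N$ in $\{1,\dots,m\}$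 and entries linear combinations of $1$ and $a_{\rho_r\kappa_s}$, ${\det}_qB$ is obtained by expanding $\sum_{\sigma\in S_N}(-1)^{\operatorname{inv}\sigma}b_{\sigma(1)1}\cdots b_{\sigma(N)N}$ into words $a_{\lambda,\mu}$ ($\lambda$ row labels, $\mu$ column labels) and multiplying each by $w(\lambda,\mu)$; this applies to $I-A$, $I-A_0$ and to the bordered matrix with rows labelled $1,\dots,n,i$ and columns $1,\dots,n,j$. Thus ${\det}_q(I-A)=\sum_{J\subseteq[m]}(-1)^{|J|}\sum_{\sigma\in S_J}(-q)^{ -\operatorname{inv}\sigma}a_{\sigma(j_1)j_1}\cdots a_{\sigma(j_k)j_k}$ for $J=\{j_1<\dots<j_k\}$. ${\det}_q^{ -1}(I-A_0)$ is the inverse of ${\det}_q(I-A_0)$. ${\det}_q(I-C^q)=\sum_{J\subseteq\{n+1,\dots,m\}}(-1)^{|J|}\sum_{\sigma\in S_J}(-q)^{ -\operatorname{inv}\sigma}c^q_{\sigma(j_1)j_1}\cdots c^q_{\sigma(j_k)j_k}$, treating the $c^q_{ij}$ as letters. -}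

module Defs where

open import Level using (Level)
open import Algebra.Bundles using (CommutativeRing)
open import Data.Bool using (Bool; true; false; if_then_else_)
open import Data.Nat as ℕ using (ℕ; zero; suc)
open import Data.Integer as ℤ using (ℤ; +_; -[1+_])
open import Data.Fin as Fin using (Fin; _↑ˡ_; _↑ʳ_; splitAt; _<_)
import Data.Fin.Properties as FinP
open import Data.List as List using (List; []; _∷_; [_]; map; concatMap; filter; length; allFin)
import Data.List.Properties as ListP
open import Data.Vec as Vec using (Vec; lookup; toList)
open import Data.Product using (_×_; _,_; Σ; ∃; ∃-syntax; proj₁; proj₂)
import Data.Product.Properties as ProdP
open import Data.Sum using (inj₁; inj₂)
open import Relation.Nullary using (¬_; does)
open import Relation.Binary.PropositionalEquality using (_≡_)
import Data.List.Relation.Unary.Unique.DecPropositional as UniqueDec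

allVecsOf : ∀ {a} {A : Set a} → List A → (l : ℕ) → List (Vec A l)
allVecsOf xs zero    = [ Vec.[] ]
allVecsOf xs (suc l) = concatMap (λ x → map (x Vec.∷_) (allVecsOf xs l)) xs

perms : (N : ℕ) → List (Vec (Fin N) N)
perms N = filter (λ σ → UniqueDec.unique? FinP._≟_ (toList σ)) (allVecsOf (allFin N) N)

subsets : (N : ℕ) → List (Vec Bool N)
subsets N = allVecsOf (true ∷ false ∷ []) N

inv : ∀ {m} → List (Fin m) → ℕ
inv []       = 0
inv (x ∷ xs) = length (filter (λ y → y Fin.<? x) xs) ℕ.+ inv xs

IsField : ∀ {c ℓ} → CommutativeRing c ℓ → Set (c Level.⊔ ℓ)
IsField K = (¬ (1# ≈ 0#)) × (∀ x → ¬ (x ≈ 0#) → ∃[ y ] (x * y ≈ 1#))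
  where open CommutativeRing K

-- The setting: coefficient field K, parameter q with inverse qinv,
-- n, and m = n + k.  Letters are a_{ij}, (i , j) : Fin m × Fin m
-- (0-based indices: paper index i corresponds to Fin index i-1).

module Setup {c ℓ} (K : CommutativeRing c ℓ) (q qinv : CommutativeRing.Carrier K)
             (n k : ℕ) where
  open CommutativeRing K

  m : ℕ
  m = n ℕ.+ k

  Letter : Set
  Letter = Fin m × Fin m

  Word : Set
  Word = List Letter

  -- formal power series in the non-commuting letters a_{ij}
  Series : Set c
  Series = Word → Carrier

  _≟L_ : (x y : Letter) → Relation.Nullary.Dec (x ≡ y)
  _≟L_ = ProdP.≡-dec FinP._≟_ FinP._≟_

  _≟W_ : (u v : Word) → Relation.Nullary.Dec (u ≡ v)
  _≟W_ = ListP.≡-dec _≟L_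

  _≐_ : Series → Series → Set ℓ
  f ≐ g = ∀ w → f w ≈ g w

  sumK : List Carrier → Carrier
  sumK = List.foldr _+_ 0#

  prodK : List Carrier → Carrier
  prodK = List.foldr _*_ 1#

  powK : Carrier → ℕ → Carrier
  powK x zero    = 1#
  powK x (suc e) = x * powK x e

  qpow : ℤ → Carrier
  qpow (+ e)     = powK q e
  qpow -[1+ e ]  = powK qinv (suc e)

  zeroS : Series
  zeroS w = 0#

  oneS : Series
  oneS []      = 1#
  oneS (_ ∷ _) = 0#

  letter : Letter → Series
  letter x w = if does (w ≟W [ x ]) then 1# else 0#

  _+S_ : Series → Series → Series
  (f +S g) w = f w + g w

  _-S_ : Series → Series → Series
  (f -S g) w = f w - g w

  -S_ : Series → Series
  (-S f) w = - f w

  _·S_ : Carrier → Series → Series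
  (a ·S f) w = a * f w

  splits : Word → List (Word × Word)
  splits []       = [ ([] , []) ]
  splits (x ∷ w)  = ([] , x ∷ w) ∷ map (λ p → (x ∷ proj₁ p , proj₂ p)) (splits w)

  _*S_ : Series → Series → Series
  (f *S g) w = sumK (map (λ p → f (proj₁ p) * g (proj₂ p)) (splits w))

  sumS : List Series → Series
  sumS = List.foldr _+S_ zeroS

  prodS : List Series → Series
  prodS = List.foldr _*S_ oneS

  data Gen : Set where
    gen₁ : (i j k' l : Fin m) → i < j → k' < l → Gen
    gen₂ : (i j k' l : Fin m) → i < j → l < k' → Gen
    gen₃ : (i j k' : Fin m) → i < j → Gen

  a : Fin m → Fin m → Series
  a i j = letter (i , j)

  genS : Gen → Series
  genS (gen₁ i j k' l _ _) = (a j l *S a i k') -S (a i k' *S a j l)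
  genS (gen₂ i j k' l _ _) = (a j l *S a i k') -S ((q * q) ·S (a i k' *S a j l))
  genS (gen₃ i j k' _)     = (a j k' *S a i k') -S (q ·S (a i k' *S a j k'))

  -- f ∼ g : f - g lies in the closed two-sided ideal generated by the relations,
  -- i.e. for every d there is an element Σ F·r·G of the two-sided ideal
  -- (F, G power series, r a relation) agreeing with f - g in all degrees < d.
  _∼_ : Series → Series → Set (c Level.⊔ ℓ)
  f ∼ g = ∀ (d : ℕ) → Σ (List (Series × Gen × Series)) λ hs → (∀ (w : Word) → length w ℕ.< d →
            (f w - g w) ≈ sumS (map (λ t → (proj₁ t *S genS (proj₁ (proj₂ t))) *S proj₂ (proj₂ t)) hs) w)

  -- q-determinant of an N × N matrix B with row labels ρ, column labels κ,
  -- entries b_rs = cst r s + coef r s · L r s, where L r s is the "letter"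
  -- in position (r, s) (labelled (ρ r, κ s)).  Expansion of
  --   Σ_σ (-1)^{inv σ} b_{σ(1)1} ⋯ b_{σ(N)N}
  -- into words, each word a_{λ,μ} multiplied by q^{inv μ - inv λ}.
  qdet : (N : ℕ) (ρ κ : Fin N → Fin m) (cst coef : Fin N → Fin N → Carrier)
         (L : Fin N → Fin N → Series) → Series
  qdet N ρ κ cst coef L =
    sumS (concatMap (λ σ → map (λ T → term σ T) (subsets N)) (perms N))
    where
      term : Vec (Fin N) N → Vec Bool N → Series
      term σ T = scalar ·S prodS (map (λ s → L (lookup σ s) s) chosen)
        where
          chosen : List (Fin N)
          chosen = filter (λ s → Data.Bool._≟_ (lookup T s) true) (allFin N)
          unchosen : List (Fin N)
          unchosen = filter (λ s → Data.Bool._≟_ (lookup T s) false) (allFin N)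
          λw : List (Fin m)
          λw = map (λ s → ρ (lookup σ s)) chosen
          μw : List (Fin m)
          μw = map κ chosen
          scalar : Carrier
          scalar = powK (- 1#) (inv (toList σ))
                   * prodK (map (λ s → cst (lookup σ s) s) unchosen)
                   * prodK (map (λ s → coef (lookup σ s) s) chosen)
                   * qpow ((+ inv μw) ℤ.- (+ inv λw))

  δ : ∀ {N} → Fin N → Fin N → Carrier
  δ r s = if does (r FinP.≟ s) then 1# else 0#

  detIA : Series
  detIA = qdet m (λ x → x) (λ x → x) δ (λ _ _ → - 1#) (λ r s → a r s)

  inl : Fin n → Fin m
  inl r = r ↑ˡ k

  inr : Fin k → Fin m
  inr i = n ↑ʳ i

  detIA₀ : Series
  detIA₀ = qdet n inl inl δ (λ _ _ → - 1#) (λ r s → a (inl r) (inl s))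

  -- the bordered matrix ( I - A₀  -a_{*j} ; -a_{i*}  -a_{ij} ),
  -- rows labelled 1..n, i and columns 1..n, j (here i, j : Fin k stand for n+i, n+j)
  border : Fin k → Fin (n ℕ.+ 1) → Fin m
  border i x with splitAt n x
  ... | inj₁ r = inl r
  ... | inj₂ _ = inr i

  cstB : Fin (n ℕ.+ 1) → Fin (n ℕ.+ 1) → Carrier
  cstB x y with splitAt n x | splitAt n y
  ... | inj₁ r | inj₁ s = δ r s
  ... | _      | _      = 0#

  detBordered : Fin k → Fin k → Series
  detBordered i j = qdet (n ℕ.+ 1) (border i) (border j) cstB (λ _ _ → - 1#)
                         (λ x y → a (border i x) (border j y))

  -- c^q_ij = - det_q^{-1}(I - A₀) · det_q(bordered), given the inverse d
  cq : Series → Fin k → Fin k → Series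
  cq d i j = -S (d *S detBordered i j)

  -- det_q (I - C^q), the c^q_ij treated as letters with labels n+1..m
  detIC : Series → Series
  detIC d = qdet k inr inr δ (λ _ _ → - 1#) (cq d)

{-# OPTIONS --safe #-}
module Submission where

-- Weighting every word a_{λ,μ} by q^{inv μ - inv λ} (the map Φ) turns the relations of a
-- q-Cartier-Foata matrix into "letters in different rows commute", and it is multiplicative on
-- the graded pieces occurring here: the cross inversions between a factor all of whose other
-- labels are ≤ n and the remaining factors depend only on the end labels of the factors.
-- So it suffices to treat q = 1.
--
-- There, let Z_{xj} be the sum of all words x → s₁ → ⋯ → s_p → j with s_i ≤ n, so that
-- Z_{xj} = a_{xj} + Σ_{s ≤ n} a_{xs} Z_{sj}.  Adding the columns s ≤ n of I - A, multiplied on the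
-- right by Z_{sj}, to column j > n, from the last column to the first, does not change the
-- column-ordered determinant: a repeated column, all columns to its left being those of I - A,
-- gives 0 because entries in different rows commute.  The result is block triangular with blocks
-- I - A₀ and I - (Z_{ij})_{i,j > n}, whence det (I - A) = det (I - A₀) · det (I - Z).  The same
-- argument for the bordered matrix shows c_{ij} = Z_{ij}.

open import Defs
open import Level using (_⊔_)
open import Algebra.Bundles using (Ring; CommutativeRing)
open import Data.Bool as Bool using (Bool; true; false; if_then_else_; _∧_; not)
open import Data.Empty using (⊥)
open import Data.Fin as Fin using (Fin; zero; suc; toℕ; _↑ˡ_; _↑ʳ_; splitAt; punchIn; punchOut)
import Data.Fin.Properties as FinP
open import Data.Integer as ℤ using (+_)
import Data.Integer.Properties as ℤP
open import Data.List as List using (List; []; _∷_; [_]; map; concatMap; filter; length; allFin; _++_)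
import Data.List.Properties as ListP
open import Data.List.Relation.Unary.All as All using (All; []; _∷_)
import Data.List.Relation.Unary.All.Properties as AllP
import Data.List.Relation.Unary.Unique.DecPropositional as UniqueDec
open import Data.Nat as ℕ using (ℕ; zero; suc; _≤_)
import Data.Nat.Properties as ℕP
open import Data.Nat.Solver using (module +-*-Solver)
open import Data.Product using (_×_; _,_; Σ; ∃-syntax; proj₁; proj₂)
open import Data.Sum using (_⊎_; inj₁; inj₂)
open import Data.Unit using (⊤; tt)
open import Data.Vec as Vec using (Vec; lookup; toList)
open import Function using (_∘_; id)
open import Relation.Binary.Definitions using (tri<; tri≈; tri>)
open import Relation.Binary.PropositionalEquality as ≡ using (_≡_; _≢_)
open import Relation.Nullary using (¬_; does; yes; no; Dec; contradiction)
open import Relation.Nullary.Decidable using (dec-true; dec-false)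
open import Relation.Unary using (Decidable)
open import Algebra.Properties.CommutativeMonoid.Sum ℕP.+-0-commutativeMonoid
  using () renaming (sum to sumℕ; sum-remove to sumℕ-remove; sum-cong-≗ to sumℕ-cong)

-- The weight is attached to words, hence to representatives, so the passage to `q = 1` is made
-- between series and not between quotients: `detIA₀`, `detIA`, the bordered determinants and
-- `detIC d` are each shown to be exactly `Φ` of a `q = 1` series, and congruence modulo the
-- q-relations enters only at the very end. The obstacle is the cross factor in `wt-++`; controlling
-- it requires knowing which words occur in each series. About `d` only the two inverse equations
-- are available. They hold between series and determine the coefficients of `d` recursively, so `d`
-- inherits the kind of support that `detIA₀` has. The `q = 1` ideal is presented by commutators at
-- the front of a word, followed by prefixing single letters. Along such a derivation the weight
-- changes only by scalars, which two counting functions record; a product F·r·G with an infinite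
-- series F on the left would not offer this. Left multiplication by a series is recovered by
-- induction on the truncation degree.

-- Deleting two rows; indices of a block decomposition

-- The choices `(r , r′)` and `(s , s′)` delete the same two rows in opposite orders, and `r < s`,
-- so every pair of rows is listed once. As numbers, `r′` is `s - 1` and `s′` is `r`: the exponents
-- `r + r′` and `s + s′` differ by one, so partners have opposite signs.
data Partner : ∀ {n} → Fin (suc n) → Fin n → Fin (suc n) → Fin n → Set where
  base : ∀ {n} (x : Fin (suc n)) → Partner {suc n} zero x (suc x) zero
  step : ∀ {n} {r s : Fin (suc n)} {r′ s′ : Fin n} →
         Partner r r′ s s′ → Partner (suc r) (suc r′) (suc s) (suc s′)

partner-fst : ∀ {n} {r s : Fin (suc n)} {r′ s′} → Partner r r′ s s′ → punchIn r r′ ≡ s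
partner-fst (base x) = ≡.refl
partner-fst (step p) = ≡.cong suc (partner-fst p)

partner-snd : ∀ {n} {r s : Fin (suc n)} {r′ s′} → Partner r r′ s s′ → punchIn s s′ ≡ r
partner-snd (base x) = ≡.refl
partner-snd (step p) = ≡.cong suc (partner-snd p)

partner-≢ : ∀ {n} {r s : Fin (suc n)} {r′ s′} → Partner r r′ s s′ → r ≢ s
partner-≢ (base x) ()
partner-≢ (step p) e = partner-≢ p (FinP.suc-injective e)

partner-punchIn : ∀ {n} {r s : Fin (suc (suc n))} {r′ s′} → Partner r r′ s s′ →
  ∀ z → punchIn r (punchIn r′ z) ≡ punchIn s (punchIn s′ z)
partner-punchIn (base x) z = ≡.refl
partner-punchIn (step p) zero = ≡.refl
partner-punchIn (step {suc n} p) (suc z) = ≡.cong suc (partner-punchIn p z)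

swap₀₁ : ∀ {n} → Fin (suc (suc n)) → Fin (suc (suc n))
swap₀₁ zero          = suc zero
swap₀₁ (suc zero)    = zero
swap₀₁ (suc (suc j)) = suc (suc j)

punchIn-↑ˡ : ∀ {n} k (r : Fin (suc n)) (i : Fin n) → punchIn (r ↑ˡ k) (i ↑ˡ k) ≡ punchIn r i ↑ˡ k
punchIn-↑ˡ k zero    i       = ≡.refl
punchIn-↑ˡ k (suc r) zero    = ≡.refl
punchIn-↑ˡ k (suc r) (suc i) = ≡.cong suc (punchIn-↑ˡ k r i)

punchIn-↑ʳ : ∀ {n} k (r : Fin (suc n)) (i : Fin k) → punchIn (r ↑ˡ k) (n ↑ʳ i) ≡ suc n ↑ʳ i
punchIn-↑ʳ         k zero    i = ≡.refl
punchIn-↑ʳ {suc n} k (suc r) i = ≡.cong suc (punchIn-↑ʳ k r i)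

↑ˡ≢↑ʳ : ∀ {n k} (s : Fin n) (i : Fin k) → s ↑ˡ k ≢ n ↑ʳ i
↑ˡ≢↑ʳ (suc s) i e = ↑ˡ≢↑ʳ s i (FinP.suc-injective e)

data Split (n k : ℕ) : Fin (n ℕ.+ k) → Set where
  left  : ∀ s → Split n k (s ↑ˡ k)
  right : ∀ j → Split n k (n ↑ʳ j)

split : ∀ n k c → Split n k c
split n k c with splitAt n c in e
... | inj₁ s = ≡.subst (Split n k) (FinP.splitAt⁻¹-↑ˡ e) (left s)
... | inj₂ j = ≡.subst (Split n k) (FinP.splitAt⁻¹-↑ʳ e) (right j)

-- Column-ordered determinants over a noncommutative ring

module Determinant {c ℓ} (R : Ring c ℓ) where
  open Ring R hiding (zero)
  open import Algebra.Properties.Ring R using (-0#≈0#; -‿+-comm; -‿distribˡ-*; -‿distribʳ-*; -‿involutive)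
  open import Algebra.Properties.Semiring.Sum semiring using (sum)
  open import Algebra.Solver.CommutativeMonoid +-commutativeMonoid using (solve; _⊕_; _⊜_)
  open import Relation.Binary.Reasoning.Setoid setoid

  alt : ∀ {n} → (Fin n → Carrier) → Carrier
  alt {zero}  f = 0#
  alt {suc n} f = f zero - alt (f ∘ suc)

  alt-cong : ∀ {n} {f g : Fin n → Carrier} → (∀ i → f i ≈ g i) → alt f ≈ alt g
  alt-cong {zero}  e = refl
  alt-cong {suc n} e = +-cong (e zero) (-‿cong (alt-cong (e ∘ suc)))

  alt-0 : ∀ {n} {f : Fin n → Carrier} → (∀ i → f i ≈ 0#) → alt f ≈ 0#
  alt-0 {zero}  e = refl
  alt-0 {suc n} {f} e = begin
    f zero - alt (f ∘ suc) ≈⟨ +-cong (e zero) (-‿cong (alt-0 (e ∘ suc))) ⟩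
    0# - 0#                ≈⟨ -‿inverseʳ 0# ⟩
    0#                     ∎

  alt-+ : ∀ {n} (f g : Fin n → Carrier) → alt (λ i → f i + g i) ≈ alt f + alt g
  alt-+ {zero}  f g = sym (+-identityˡ 0#)
  alt-+ {suc n} f g = begin
    (f zero + g zero) - alt (λ i → f (suc i) + g (suc i))
      ≈⟨ +-congˡ (-‿cong (alt-+ (f ∘ suc) (g ∘ suc))) ⟩
    (f zero + g zero) - (alt (f ∘ suc) + alt (g ∘ suc))
      ≈⟨ +-congˡ (-‿+-comm _ _) ⟨
    (f zero + g zero) + (- alt (f ∘ suc) + - alt (g ∘ suc))
      ≈⟨ solve 4 (λ a b c d → (a ⊕ b) ⊕ (c ⊕ d) ⊜ (a ⊕ c) ⊕ (b ⊕ d)) refl _ _ _ _ ⟩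
    (f zero - alt (f ∘ suc)) + (g zero - alt (g ∘ suc)) ∎

  alt-- : ∀ {n} (f : Fin n → Carrier) → alt (λ i → - f i) ≈ - alt f
  alt-- {zero}  f = sym -0#≈0#
  alt-- {suc n} f = trans (+-congˡ (-‿cong (alt-- (f ∘ suc)))) (-‿+-comm _ _)

  alt-*ˡ : ∀ {n} x (f : Fin n → Carrier) → x * alt f ≈ alt (λ i → x * f i)
  alt-*ˡ {zero}  x f = zeroʳ x
  alt-*ˡ {suc n} x f = begin
    x * (f zero - alt (f ∘ suc))       ≈⟨ distribˡ _ _ _ ⟩
    x * f zero + x * - alt (f ∘ suc)   ≈⟨ +-congˡ (-‿distribʳ-* _ _) ⟨
    x * f zero - x * alt (f ∘ suc)     ≈⟨ +-congˡ (-‿cong (alt-*ˡ x (f ∘ suc))) ⟩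
    x * f zero - alt (λ i → x * f (suc i)) ∎

  alt-*ʳ : ∀ {n} x (f : Fin n → Carrier) → alt f * x ≈ alt (λ i → f i * x)
  alt-*ʳ {zero}  x f = zeroˡ x
  alt-*ʳ {suc n} x f = begin
    (f zero - alt (f ∘ suc)) * x       ≈⟨ distribʳ _ _ _ ⟩
    f zero * x + - alt (f ∘ suc) * x   ≈⟨ +-congˡ (-‿distribˡ-* _ _) ⟨
    f zero * x - alt (f ∘ suc) * x     ≈⟨ +-congˡ (-‿cong (alt-*ʳ x (f ∘ suc))) ⟩
    f zero * x - alt (λ i → f (suc i) * x) ∎

  alt-↑ˡ : ∀ n k (f : Fin (n ℕ.+ k) → Carrier) → (∀ i → f (n ↑ʳ i) ≈ 0#) →
           alt f ≈ alt (λ r → f (r ↑ˡ k))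
  alt-↑ˡ zero    k f z = alt-0 z
  alt-↑ˡ (suc n) k f z = +-congˡ (-‿cong (alt-↑ˡ n k (f ∘ suc) z))

  -- Partners carry opposite signs. The terms `h zero x` meet the terms `h (suc x) zero`, which is
  -- the cancellation `A - (A - B)`; what is left is the same kind of sum, one size smaller.
  alt-alt-cancel : ∀ {n} (h : Fin (suc n) → Fin n → Carrier) →
    (∀ {r r′ s s′} → Partner r r′ s s′ → h r r′ ≈ h s s′) → alt (λ r → alt (h r)) ≈ 0#
  alt-alt-cancel {zero}  h e = trans (+-identityˡ _) (trans (-‿cong refl) -0#≈0#)
  alt-alt-cancel {suc n} h e = begin
    alt (h zero) - alt (λ x → h (suc x) zero - alt (λ y → h (suc x) (suc y)))
      ≈⟨ +-cong (alt-cong (e ∘ base)) (-‿cong (trans (alt-+ (λ x → h (suc x) zero) (λ x → - alt (λ y → h (suc x) (suc y)))) (+-congˡ (alt-- (λ x → alt (λ y → h (suc x) (suc y))))))) ⟩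
    A - (A - B)     ≈⟨ +-congˡ (-‿+-comm _ _) ⟨
    A + (- A - - B) ≈⟨ +-assoc _ _ _ ⟨
    A - A - - B     ≈⟨ +-cong (-‿inverseʳ _) (-‿involutive _) ⟩
    0# + B          ≈⟨ +-identityˡ _ ⟩
    B               ≈⟨ alt-alt-cancel (λ x y → h (suc x) (suc y)) (e ∘ step) ⟩
    0#              ∎
    where
    A = alt (λ x → h (suc x) zero)
    B = alt (λ x → alt (λ y → h (suc x) (suc y)))

  Matrix : ℕ → Set c
  Matrix N = Fin N → Fin N → Carrier

  minor : ∀ {N} → Matrix (suc N) → Fin (suc N) → Matrix N
  minor M r i j = M (punchIn r i) (suc j)

  -- Noncommutative: the factors are multiplied in the order of their columns.
  det : ∀ {N} → Matrix N → Carrier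
  det {zero}  M = 1#
  det {suc N} M = alt (λ r → M r zero * det (minor M r))

  det-cong : ∀ {N} {M M′ : Matrix N} → (∀ i j → M i j ≈ M′ i j) → det M ≈ det M′
  det-cong {zero}  e = refl
  det-cong {suc N} e = alt-cong (λ r → *-cong (e r zero) (det-cong (λ i j → e (punchIn r i) (suc j))))

  det-col-+ : ∀ {N} (p : Fin N) (H H₁ H₂ : Matrix N) →
    (∀ r j → j ≢ p → H r j ≈ H₁ r j) → (∀ r j → j ≢ p → H r j ≈ H₂ r j) →
    (∀ r → H r p ≈ H₁ r p + H₂ r p) → det H ≈ det H₁ + det H₂
  det-col-+ zero H H₁ H₂ e₁ e₂ e = begin
    alt (λ r → H r zero * det (minor H r))
      ≈⟨ alt-cong (λ r → trans (*-congʳ (e r)) (trans (distribʳ _ _ _)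
           (+-cong (*-congˡ (det-cong (λ i j → e₁ (punchIn r i) (suc j) λ ())))
                   (*-congˡ (det-cong (λ i j → e₂ (punchIn r i) (suc j) λ ())))))) ⟩
    alt (λ r → H₁ r zero * det (minor H₁ r) + H₂ r zero * det (minor H₂ r))
      ≈⟨ alt-+ (λ r → H₁ r zero * det (minor H₁ r)) (λ r → H₂ r zero * det (minor H₂ r)) ⟩
    det H₁ + det H₂ ∎
  det-col-+ (suc p) H H₁ H₂ e₁ e₂ e = begin
    alt (λ r → H r zero * det (minor H r))
      ≈⟨ alt-cong (λ r → trans (*-congˡ (det-col-+ p (minor H r) (minor H₁ r) (minor H₂ r)
           (λ i j ≢p → e₁ _ _ (≢p ∘ FinP.suc-injective))
           (λ i j ≢p → e₂ _ _ (≢p ∘ FinP.suc-injective))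
           (λ i → e _))) (trans (distribˡ _ _ _)
           (+-cong (*-congʳ (e₁ r zero λ ())) (*-congʳ (e₂ r zero λ ()))))) ⟩
    alt (λ r → H₁ r zero * det (minor H₁ r) + H₂ r zero * det (minor H₂ r))
      ≈⟨ alt-+ (λ r → H₁ r zero * det (minor H₁ r)) (λ r → H₂ r zero * det (minor H₂ r)) ⟩
    det H₁ + det H₂ ∎

  det-expand₂ : ∀ {N} (H : Matrix (suc (suc N))) →
    det H ≈ alt (λ r → alt (λ r′ → H r zero * (H (punchIn r r′) (suc zero) * det (minor (minor H r) r′))))
  det-expand₂ H = alt-cong (λ r → alt-*ˡ (H r zero) (λ r′ → H (punchIn r r′) (suc zero) * det (minor (minor H r) r′)))

  minor₂-partner : ∀ {N} (H : Matrix (suc (suc N))) {r r′ s s′} → Partner r r′ s s′ →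
    det (minor (minor H r) r′) ≈ det (minor (minor H s) s′)
  minor₂-partner H p = det-cong (λ i j → reflexive (≡.cong (λ x → H x (suc (suc j))) (partner-punchIn p i)))

  -- A term of one expansion cancels the partner term of the other. The two exchanged entries stand
  -- at the very left of the product, so commutation of columns 0 and 1 suffices. Written as a sum
  -- equal to 0 to match `alt-alt-cancel`.
  det-swap₀₁ : ∀ {N} (H : Matrix (suc (suc N))) →
    (∀ {r s} → r ≢ s → H r zero * H s (suc zero) ≈ H s (suc zero) * H r zero) →
    det H + det (λ r j → H r (swap₀₁ j)) ≈ 0#
  det-swap₀₁ H comm = begin
    det H + det H′
      ≈⟨ +-cong (det-expand₂ H) (det-expand₂ H′) ⟩
    alt (λ r → alt (h r)) + alt (λ r → alt (h′ r))
      ≈⟨ trans (alt-cong (λ r → alt-+ (h r) (h′ r))) (alt-+ (λ r → alt (h r)) (λ r → alt (h′ r))) ⟨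
    alt (λ r → alt (λ r′ → h r r′ + h′ r r′))
      ≈⟨ alt-alt-cancel (λ r r′ → h r r′ + h′ r r′) (λ p → trans (+-cong (h≈h′ p) (h′≈h p)) (+-comm _ _)) ⟩
    0# ∎
    where
    H′ : Matrix _
    H′ r j = H r (swap₀₁ j)
    h h′ : Fin _ → Fin _ → Carrier
    h r r′ = H r zero * (H (punchIn r r′) (suc zero) * det (minor (minor H r) r′))
    h′ r r′ = H r (suc zero) * (H (punchIn r r′) zero * det (minor (minor H r) r′))
    h≈h′ : ∀ {r r′ s s′} → Partner r r′ s s′ → h r r′ ≈ h′ s s′
    h≈h′ {r} {r′} {s} {s′} p = begin
      H r zero * (H (punchIn r r′) (suc zero) * det (minor (minor H r) r′))
        ≈⟨ *-congˡ (*-cong (reflexive (≡.cong (λ x → H x (suc zero)) (partner-fst p))) (minor₂-partner H p)) ⟩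
      H r zero * (H s (suc zero) * m)   ≈⟨ *-assoc _ _ _ ⟨
      (H r zero * H s (suc zero)) * m   ≈⟨ *-congʳ (comm (partner-≢ p)) ⟩
      (H s (suc zero) * H r zero) * m   ≈⟨ *-assoc _ _ _ ⟩
      H s (suc zero) * (H r zero * m)
        ≈⟨ *-congˡ (*-congʳ (reflexive (≡.cong (λ x → H x zero) (partner-snd p)))) ⟨
      h′ s s′ ∎
      where m = det (minor (minor H s) s′)
    h′≈h : ∀ {r r′ s s′} → Partner r r′ s s′ → h′ r r′ ≈ h s s′
    h′≈h {r} {r′} {s} {s′} p = begin
      H r (suc zero) * (H (punchIn r r′) zero * det (minor (minor H r) r′))
        ≈⟨ *-congˡ (*-cong (reflexive (≡.cong (λ x → H x zero) (partner-fst p))) (minor₂-partner H p)) ⟩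
      H r (suc zero) * (H s zero * m)   ≈⟨ *-assoc _ _ _ ⟨
      (H r (suc zero) * H s zero) * m   ≈⟨ *-congʳ (comm (partner-≢ p ∘ ≡.sym)) ⟨
      (H s zero * H r (suc zero)) * m   ≈⟨ *-assoc _ _ _ ⟩
      H s zero * (H r (suc zero) * m)
        ≈⟨ *-congˡ (*-congʳ (reflexive (≡.cong (λ x → H x (suc zero)) (partner-snd p)))) ⟨
      h s s′ ∎
      where m = det (minor (minor H s) s′)

  -- If the copy is in column 1, partner terms differ by exchanging `H r zero` and `H s zero`, while
  -- `X` stays behind them. Otherwise swapping the first two columns brings the source one column
  -- closer to its copy, and the minors of the swapped matrix vanish by induction.
  det-repeat₀ : ∀ {N} (p : Fin N) (H : Matrix (suc N)) X →
    (∀ r → H r (suc p) ≈ H r zero * X) →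
    (∀ {r s} → r ≢ s → ∀ t → t Fin.< suc p → H r zero * H s t ≈ H s t * H r zero) →
    det H ≈ 0#
  det-repeat₀ {suc N} zero H X e comm = trans (det-expand₂ H) (alt-alt-cancel (λ r r′ → H r zero * (H (punchIn r r′) (suc zero) * det (minor (minor H r) r′))) lem)
    where
    lem : ∀ {r r′ s s′} → Partner r r′ s s′ →
      H r zero * (H (punchIn r r′) (suc zero) * det (minor (minor H r) r′)) ≈
      H s zero * (H (punchIn s s′) (suc zero) * det (minor (minor H s) s′))
    lem {r} {r′} {s} {s′} p = begin
      H r zero * (H (punchIn r r′) (suc zero) * det (minor (minor H r) r′))
        ≈⟨ *-congˡ (*-cong (trans (reflexive (≡.cong (λ x → H x (suc zero)) (partner-fst p))) (e s)) (minor₂-partner H p)) ⟩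
      H r zero * ((H s zero * X) * m)   ≈⟨ *-congˡ (*-assoc _ _ _) ⟩
      H r zero * (H s zero * (X * m))   ≈⟨ *-assoc _ _ _ ⟨
      (H r zero * H s zero) * (X * m)   ≈⟨ *-congʳ (comm (partner-≢ p) zero (ℕ.s≤s ℕ.z≤n)) ⟩
      (H s zero * H r zero) * (X * m)   ≈⟨ *-assoc _ _ _ ⟩
      H s zero * (H r zero * (X * m))   ≈⟨ *-congˡ (*-assoc _ _ _) ⟨
      H s zero * ((H r zero * X) * m)
        ≈⟨ *-congˡ (*-congʳ (trans (reflexive (≡.cong (λ x → H x (suc zero)) (partner-snd p))) (e r))) ⟨
      H s zero * (H (punchIn s s′) (suc zero) * m) ∎
      where m = det (minor (minor H s) s′)
  det-repeat₀ {suc N} (suc p) H X e comm = begin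
    det H             ≈⟨ +-identityʳ _ ⟨
    det H + 0#        ≈⟨ +-congˡ detH′≈0 ⟨
    det H + det H′    ≈⟨ det-swap₀₁ H (λ r≢s → comm r≢s (suc zero) (ℕ.s≤s (ℕ.s≤s ℕ.z≤n))) ⟩
    0#                ∎
    where
    H′ : Matrix _
    H′ r j = H r (swap₀₁ j)
    detH′≈0 : det H′ ≈ 0#
    -- Column 0 of this minor is the old column 0, and its column `suc t` is the old column
    -- `suc (suc t)`; hence the shift in the commutation bound.
    detH′≈0 = alt-0 λ r → trans (*-congˡ {H′ r zero} (det-repeat₀ p (minor H′ r) X (λ i → e _)
      (λ { i≢j zero    _ → comm (i≢j ∘ FinP.punchIn-injective r _ _) zero (ℕ.s≤s ℕ.z≤n)
         ; i≢j (suc t) (ℕ.s≤s t<p) → comm (i≢j ∘ FinP.punchIn-injective r _ _) (suc (suc t)) (ℕ.s≤s (ℕ.s≤s t<p))}))) (zeroʳ (H′ r zero))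

  det-repeat : ∀ {N} (s p : Fin N) → s Fin.< p → (H : Matrix N) → ∀ X →
    (∀ r → H r p ≈ H r s * X) →
    (∀ {r r′} → r ≢ r′ → ∀ t → t Fin.< p → H r s * H r′ t ≈ H r′ t * H r s) →
    det H ≈ 0#
  det-repeat zero    (suc p) _            H X e comm = det-repeat₀ p H X e comm
  det-repeat (suc s) (suc p) (ℕ.s≤s s<p) H X e comm = alt-0 λ r → trans (*-congˡ {H r zero}
    (det-repeat s p s<p (minor H r) X (λ i → e _)
      (λ i≢j t t<p → comm (i≢j ∘ FinP.punchIn-injective r _ _) (suc t) (ℕ.s≤s t<p)))) (zeroʳ _)

  setCol : ∀ {N} → Matrix N → Fin N → (Fin N → Carrier) → Matrix N
  setCol M p col r j with j FinP.≟ p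
  ... | yes _ = col r
  ... | no  _ = M r j

  setCol-≡ : ∀ {N} (M : Matrix N) p col r → setCol M p col r p ≡ col r
  setCol-≡ M p col r with p FinP.≟ p
  ... | yes _ = ≡.refl
  ... | no p≢p = contradiction ≡.refl p≢p

  setCol-≢ : ∀ {N} (M : Matrix N) p col r j → j ≢ p → setCol M p col r j ≡ M r j
  setCol-≢ M p col r j j≢p with j FinP.≟ p
  ... | yes j≡p = contradiction j≡p j≢p
  ... | no _ = ≡.refl

  -- Additivity in column `p` peels off one summand at a time, and each leaves a repeated column.
  -- Commutation is asked of `M` to the left of `p` alone, so the columns to the right may already
  -- have been altered.
  det-add-columns : ∀ {N t} (M H : Matrix N) (p : Fin N) (s : Fin t → Fin N) (X : Fin t → Carrier) →
    (∀ i → s i Fin.< p) →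
    (∀ {r r′} → r ≢ r′ → ∀ u v → u Fin.< p → v Fin.< p → M r u * M r′ v ≈ M r′ v * M r u) →
    (∀ r j → j ≢ p → H r j ≈ M r j) →
    (∀ r → H r p ≈ M r p + sum (λ i → M r (s i) * X i)) →
    det H ≈ det M
  det-add-columns {t = zero} M H p s X s<p comm e₁ e₂ = det-cong λ r j → lem r j (j FinP.≟ p)
    where
    lem : ∀ r j → Dec (j ≡ p) → H r j ≈ M r j
    lem r j (yes ≡.refl) = trans (e₂ r) (+-identityʳ _)
    lem r j (no j≢p) = e₁ r j j≢p
  det-add-columns {t = suc t} M H p s X s<p comm e₁ e₂ = begin
    det H             ≈⟨ det-col-+ p H H₁ H₂
                           (λ r j ≢p → trans (e₁ r j ≢p) (sym (H₁-≢ r j ≢p)))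
                           (λ r j ≢p → trans (e₁ r j ≢p) (reflexive (≡.sym (setCol-≢ M p _ r j ≢p))))
                           (λ r → trans (e₂ r) (trans (solve 3 (λ a b c → a ⊕ (b ⊕ c) ⊜ b ⊕ (a ⊕ c)) refl _ _ _)
                             (sym (+-cong (H₁-≡ r) (reflexive (setCol-≡ M p _ r)))))) ⟩
    det H₁ + det H₂   ≈⟨ +-cong detH₁ detH₂ ⟩
    0# + det M        ≈⟨ +-identityˡ _ ⟩
    det M             ∎
    where
    H₁ H₂ : Matrix _
    H₁ = setCol M p (λ r → M r (s zero) * X zero)
    H₂ = setCol M p (λ r → M r p + sum (λ i → M r (s (suc i)) * X (suc i)))
    H₁-≡ : ∀ r → H₁ r p ≈ M r (s zero) * X zero
    H₁-≡ r = reflexive (setCol-≡ M p _ r)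
    H₁-≢ : ∀ r j → j ≢ p → H₁ r j ≈ M r j
    H₁-≢ r j ≢p = reflexive (setCol-≢ M p _ r j ≢p)
    H₁-< : ∀ r j → j Fin.< p → H₁ r j ≈ M r j
    H₁-< r j j<p = H₁-≢ r j (FinP.<⇒≢ j<p)
    detH₁ : det H₁ ≈ 0#
    detH₁ = det-repeat (s zero) p (s<p zero) H₁ (X zero)
      (λ r → trans (H₁-≡ r) (*-congʳ (sym (H₁-< r _ (s<p zero)))))
      (λ {r} {r′} r≢r′ t t<p → trans (*-cong (H₁-< r _ (s<p zero)) (H₁-< r′ t t<p))
        (trans (comm r≢r′ _ _ (s<p zero) t<p) (sym (*-cong (H₁-< r′ t t<p) (H₁-< r _ (s<p zero))))))
    detH₂ : det H₂ ≈ det M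
    detH₂ = det-add-columns M H₂ p (s ∘ suc) (X ∘ suc) (s<p ∘ suc) comm
      (λ r j ≢p → reflexive (setCol-≢ M p _ r j ≢p)) (λ r → reflexive (setCol-≡ M p _ r))

  -- Pigeonhole: `b + 1` rows live in the first `b` columns. Expanding along column 0 uses up one of
  -- these columns and at most one of these rows.
  det-zero-block : ∀ {N} b (H : Matrix N) (τ : Fin (suc b) → Fin N) →
    (∀ {t t′} → τ t ≡ τ t′ → t ≡ t′) →
    (∀ t s → b ℕ.≤ toℕ s → H (τ t) s ≈ 0#) → det H ≈ 0#
  det-zero-block {zero}  b H τ inj z with τ zero
  ... | ()
  det-zero-block {suc N} zero H τ inj z = alt-0 term
    where
    term : ∀ r → H r zero * det (minor H r) ≈ 0#
    term r with r FinP.≟ τ zero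
    ... | yes ≡.refl = trans (*-congʳ (z zero zero ℕ.z≤n)) (zeroˡ _)
    ... | no r≢τ = trans (*-congˡ (det-zero-block zero (minor H r) (λ _ → punchOut r≢τ)
          (λ { {zero} {zero} _ → ≡.refl })
          (λ _ s _ → trans (reflexive (≡.cong (λ x → H x (suc s)) (FinP.punchIn-punchOut r≢τ))) (z zero (suc s) ℕ.z≤n))))
        (zeroʳ _)
  det-zero-block {suc N} (suc b) H τ inj z = alt-0 term
    where
    -- If the deleted row is some `τ t₀`, that one is dropped from the family; otherwise one must
    -- still be dropped to reach the smaller size, and `zero` is as good as any.
    avoiding : ∀ r → ∃[ t₀ ] ∀ t → r ≢ τ (punchIn t₀ t)
    avoiding r with FinP.any? (λ t → r FinP.≟ τ t)
    ... | yes (t₀ , e) = t₀ , λ t e′ → FinP.punchInᵢ≢i t₀ t (inj (≡.trans (≡.sym e′) e))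
    ... | no ¬∃ = zero , λ t e′ → ¬∃ (suc t , e′)
    term : ∀ r → H r zero * det (minor H r) ≈ 0#
    term r with avoiding r
    ... | t₀ , r≢ = trans (*-congˡ (det-zero-block b (minor H r) (λ t → punchOut (r≢ t))
          (λ e → FinP.punchIn-injective t₀ _ _ (inj (FinP.punchOut-injective (r≢ _) (r≢ _) e)))
          (λ t s b≤s → trans (reflexive (≡.cong (λ x → H x (suc s)) (FinP.punchIn-punchOut (r≢ t))))
            (z (punchIn t₀ t) (suc s) (ℕ.s≤s b≤s)))))
        (zeroʳ _)

  -- In the expansion along column 0, deleting a row of the lower block leaves `n + 1` upper rows
  -- supported in `n` columns, so `det-zero-block` kills the term. The left block comes first in the
  -- product because its columns do.
  det-block-triangular : ∀ n k (H : Matrix (n ℕ.+ k)) → (∀ r j → H (r ↑ˡ k) (n ↑ʳ j) ≈ 0#) →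
    det H ≈ det (λ r s → H (r ↑ˡ k) (s ↑ˡ k)) * det (λ i j → H (n ↑ʳ i) (n ↑ʳ j))
  det-block-triangular zero    k H z = sym (*-identityˡ _)
  det-block-triangular (suc n) k H z = begin
    alt (λ r → H r zero * det (minor H r))
      ≈⟨ alt-↑ˡ (suc n) k (λ r → H r zero * det (minor H r)) (λ i → trans (*-congˡ (bottom i)) (zeroʳ _)) ⟩
    alt (λ r → H (r ↑ˡ k) zero * det (minor H (r ↑ˡ k)))
      ≈⟨ alt-cong (λ r → trans (*-congˡ {H (r ↑ˡ k) zero} (top r)) (sym (*-assoc _ _ _))) ⟩
    alt (λ r → (H (r ↑ˡ k) zero * det (minor H₁ r)) * det H₂)
      ≈⟨ alt-*ʳ (det H₂) (λ r → H₁ r zero * det (minor H₁ r)) ⟨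
    det H₁ * det H₂ ∎
    where
    H₁ : Matrix (suc n)
    H₁ r s = H (r ↑ˡ k) (s ↑ˡ k)
    H₂ : Matrix k
    H₂ i j = H (suc n ↑ʳ i) (suc n ↑ʳ j)
    top : ∀ r → det (minor H (r ↑ˡ k)) ≈ det (minor H₁ r) * det H₂
    top r = begin
      det (minor H (r ↑ˡ k))
        ≈⟨ det-block-triangular n k (minor H (r ↑ˡ k)) (λ i j →
             trans (reflexive (≡.cong (λ x → H x (suc (n ↑ʳ j))) (punchIn-↑ˡ k r i))) (z _ j)) ⟩
      det (λ i j → minor H (r ↑ˡ k) (i ↑ˡ k) (j ↑ˡ k)) * det (λ i j → minor H (r ↑ˡ k) (n ↑ʳ i) (n ↑ʳ j))
        ≈⟨ *-cong (det-cong (λ i j → reflexive (≡.cong (λ x → H x (suc (j ↑ˡ k))) (punchIn-↑ˡ k r i))))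
                  (det-cong (λ i j → reflexive (≡.cong (λ x → H x (suc (n ↑ʳ j))) (punchIn-↑ʳ k r i)))) ⟩
      det (minor H₁ r) * det H₂ ∎
    bottom : ∀ i → det (minor H (suc n ↑ʳ i)) ≈ 0#
    bottom i = det-zero-block n (minor H (suc n ↑ʳ i)) (λ t → punchOut (avoid t))
      (λ e → FinP.↑ˡ-injective k _ _ (FinP.punchOut-injective (avoid _) (avoid _) e))
      (λ t s n≤s → trans (reflexive (≡.cong (λ x → H x (suc s)) (FinP.punchIn-punchOut (avoid t)))) (vanish t s n≤s))
      where
      avoid : ∀ (t : Fin (suc n)) → suc n ↑ʳ i ≢ t ↑ˡ k
      avoid t = ↑ˡ≢↑ʳ t i ∘ ≡.sym
      vanish : ∀ t s → n ℕ.≤ toℕ s → H (t ↑ˡ k) (suc s) ≈ 0#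
      vanish t s n≤s with split n k s
      ... | left s′ = contradiction (FinP.toℕ<n s′) (ℕP.≤⇒≯ (≡.subst (n ℕ.≤_) (FinP.toℕ-↑ˡ s′ k) n≤s))
      ... | right j = z t j

  -- In block form `X` solves `M₁₁ X = - M₁₂`. Being given this solution, one gets the Schur
  -- complement formula `det-schur` without inverting `M₁₁` as a matrix.
  module Elimination (n k : ℕ) (M : Matrix (n ℕ.+ k))
    (comm : ∀ {r r′} → r ≢ r′ → ∀ s s′ → M r s * M r′ s′ ≈ M r′ s′ * M r s)
    (X : Fin n → Fin k → Carrier)
    (clear : ∀ r j → M (r ↑ˡ k) (n ↑ʳ j) + sum (λ s → M (r ↑ˡ k) (s ↑ˡ k) * X s j) ≈ 0#)
    where

    -- In `partial t` the columns `n + j` with `j ≥ t` are already corrected, so `partial k` is `M`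
    -- and `partial 0` is block triangular. Lowering `t` by one changes a column whose left
    -- neighbours are all still columns of `M`.
    column : ℕ → Fin (n ℕ.+ k) → Fin n ⊎ Fin k → Carrier
    column t r (inj₁ s) = M r (s ↑ˡ k)
    column t r (inj₂ j) with toℕ j ℕ.<? t
    ... | yes _ = M r (n ↑ʳ j)
    ... | no  _ = M r (n ↑ʳ j) + sum (λ s → M r (s ↑ˡ k) * X s j)

    partial : ℕ → Matrix (n ℕ.+ k)
    partial t r c = column t r (splitAt n c)

    partial-left : ∀ t r s → partial t r (s ↑ˡ k) ≡ M r (s ↑ˡ k)
    partial-left t r s rewrite FinP.splitAt-↑ˡ n s k = ≡.refl

    partial-< : ∀ t r j → toℕ j ℕ.< t → partial t r (n ↑ʳ j) ≡ M r (n ↑ʳ j)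
    partial-< t r j j<t rewrite FinP.splitAt-↑ʳ n k j with toℕ j ℕ.<? t
    ... | yes _ = ≡.refl
    ... | no j≮t = contradiction j<t j≮t

    partial-≥ : ∀ t r j → ¬ (toℕ j ℕ.< t) →
      partial t r (n ↑ʳ j) ≡ M r (n ↑ʳ j) + sum (λ s → M r (s ↑ˡ k) * X s j)
    partial-≥ t r j j≮t rewrite FinP.splitAt-↑ʳ n k j with toℕ j ℕ.<? t
    ... | yes j<t = contradiction j<t j≮t
    ... | no _ = ≡.refl

    partial-step : ∀ t → t ℕ.< k → det (partial t) ≈ det (partial (suc t))
    partial-step t t<k = det-add-columns (partial (suc t)) (partial t) p (_↑ˡ k) (λ s → X s j)
      s<p comm′ off on
      where
      j = Fin.fromℕ< t<k
      p = n ↑ʳ j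
      tj : toℕ j ≡ t
      tj = FinP.toℕ-fromℕ< t<k
      s<p : ∀ s → (s ↑ˡ k) Fin.< p
      s<p s = ≡.subst₂ ℕ._<_ (≡.sym (FinP.toℕ-↑ˡ s k)) (≡.sym (FinP.toℕ-↑ʳ n j))
        (ℕP.<-≤-trans (FinP.toℕ<n s) (ℕP.m≤m+n n _))
      before : ∀ r c → c Fin.< p → partial (suc t) r c ≡ M r c
      before r c c<p with split n k c
      ... | left s = partial-left (suc t) r s
      ... | right i = partial-< (suc t) r i (ℕP.m<n⇒m<1+n (≡.subst (toℕ i ℕ.<_) tj
            (ℕP.+-cancelˡ-< n _ _ (≡.subst₂ ℕ._<_ (FinP.toℕ-↑ʳ n i) (FinP.toℕ-↑ʳ n j) c<p))))
      comm′ : ∀ {r r′} → r ≢ r′ → ∀ u v → u Fin.< p → v Fin.< p →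
        partial (suc t) r u * partial (suc t) r′ v ≈ partial (suc t) r′ v * partial (suc t) r u
      comm′ {r} {r′} r≢r′ u v u<p v<p rewrite before r u u<p | before r′ v v<p = comm r≢r′ u v
      off : ∀ r c → c ≢ p → partial t r c ≈ partial (suc t) r c
      off r c c≢p with split n k c
      ... | left s = reflexive (≡.trans (partial-left t r s) (≡.sym (partial-left (suc t) r s)))
      ... | right i with toℕ i ℕ.<? t
      ... | yes i<t = reflexive (≡.trans (partial-< t r i i<t) (≡.sym (partial-< (suc t) r i (ℕP.m<n⇒m<1+n i<t))))
      ... | no i≮t = reflexive (≡.trans (partial-≥ t r i i≮t) (≡.sym (partial-≥ (suc t) r i i≮1+t)))
        where
        i≮1+t : ¬ (toℕ i ℕ.< suc t)
        i≮1+t i<1+t = c≢p (≡.cong (n ↑ʳ_) (FinP.toℕ-injective (≡.trans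
          (ℕP.≤-antisym (ℕP.≤-pred i<1+t) (ℕP.≮⇒≥ i≮t)) (≡.sym tj))))
      on : ∀ r → partial t r p ≈ partial (suc t) r p + sum (λ s → partial (suc t) r (s ↑ˡ k) * X s j)
      on r = begin
        partial t r p ≡⟨ partial-≥ t r j (λ j<t → ℕP.<-irrefl tj j<t) ⟩
        M r p + sum (λ s → M r (s ↑ˡ k) * X s j)
          ≈⟨ +-cong (reflexive (≡.sym (partial-< (suc t) r j (ℕP.≤-reflexive (≡.cong suc tj)))))
               (sum-cong-≋ (λ s → *-congʳ (reflexive (≡.sym (partial-left (suc t) r s))))) ⟩
        partial (suc t) r p + sum (λ s → partial (suc t) r (s ↑ˡ k) * X s j) ∎
        where open import Algebra.Properties.Semiring.Sum semiring using (sum-cong-≋)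

    partial-all : ∀ t → t ℕ.≤ k → det (partial 0) ≈ det (partial t)
    partial-all zero    _   = refl
    partial-all (suc t) t<k = trans (partial-all t (ℕP.<⇒≤ t<k)) (partial-step t t<k)

    partial-end : ∀ r c → partial k r c ≈ M r c
    partial-end r c with split n k c
    ... | left s = reflexive (partial-left k r s)
    ... | right j = reflexive (partial-< k r j (FinP.toℕ<n j))

    det-schur : det M ≈ det (λ r s → M (r ↑ˡ k) (s ↑ˡ k)) *
      det (λ i j → M (n ↑ʳ i) (n ↑ʳ j) + sum (λ s → M (n ↑ʳ i) (s ↑ˡ k) * X s j))
    det-schur = begin
      det M            ≈⟨ det-cong partial-end ⟨
      det (partial k)  ≈⟨ partial-all k ℕP.≤-refl ⟨
      det (partial 0)  ≈⟨ det-block-triangular n k (partial 0)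
                            (λ r j → trans (reflexive (partial-≥ 0 (r ↑ˡ k) j λ ())) (clear r j)) ⟩
      det (λ r s → partial 0 (r ↑ˡ k) (s ↑ˡ k)) * det (λ i j → partial 0 (n ↑ʳ i) (n ↑ʳ j))
        ≈⟨ *-cong (det-cong (λ r s → reflexive (partial-left 0 (r ↑ˡ k) s)))
                  (det-cong (λ i j → reflexive (partial-≥ 0 (n ↑ʳ i) j λ ()))) ⟩
      _ ∎

-- The ring of series and the closed ideal at q = 1

module Quotient {c ℓ} (K : CommutativeRing c ℓ) (q qinv : CommutativeRing.Carrier K) (n k : ℕ) where
  open Setup K q qinv n k
  open CommutativeRing K hiding (zero)
  open import Algebra.Properties.Ring ring using (-‿distribˡ-*; -‿distribʳ-*; -‿+-comm; -1*x≈-x)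
  open import Algebra.Solver.Ring.NaturalCoefficients.Default commutativeSemiring
    using (solve) renaming (_:=_ to infix 4 _⊜_; _:+_ to _⊕_; _:*_ to _⊗_)
  open import Relation.Binary.Reasoning.Setoid setoid

  ∂ : Letter → Series → Series
  ∂ x f w = f (x ∷ w)

  *S-[] : ∀ f g → (f *S g) [] ≈ f [] * g []
  *S-[] f g = +-identityʳ _

  -- A cut of `x ∷ w` falls before `x` or inside `w`. With `∂ x f` as the new left factor the Cauchy
  -- product becomes recursive in the word, and later proofs follow this recursion instead of
  -- `splits`.
  *S-∷ : ∀ f g x w → (f *S g) (x ∷ w) ≈ f [] * g (x ∷ w) + (∂ x f *S g) w
  *S-∷ f g x w = +-congˡ (reflexive (≡.cong sumK (≡.sym (ListP.map-∘ (splits w)))))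

  -- A coefficient of a product sees only factors of words no longer than itself; this makes
  -- multiplication well defined modulo long words.
  *S-congᵈ : ∀ {f f′ g g′} w → (∀ u → length u ℕ.≤ length w → f u ≈ f′ u) →
    (∀ u → length u ℕ.≤ length w → g u ≈ g′ u) → (f *S g) w ≈ (f′ *S g′) w
  *S-congᵈ {f} {f′} {g} {g′} [] ef eg =
    trans (*S-[] f g) (trans (*-cong (ef [] ℕ.z≤n) (eg [] ℕ.z≤n)) (sym (*S-[] f′ g′)))
  *S-congᵈ {f} {f′} {g} {g′} (x ∷ w) ef eg = begin
    (f *S g) (x ∷ w)                     ≈⟨ *S-∷ f g x w ⟩
    f [] * g (x ∷ w) + (∂ x f *S g) w    ≈⟨ +-cong (*-cong (ef [] ℕ.z≤n) (eg (x ∷ w) ℕP.≤-refl))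
                                              (*S-congᵈ w (λ u u≤ → ef (x ∷ u) (ℕ.s≤s u≤))
                                                (λ u u≤ → eg u (ℕP.m≤n⇒m≤1+n u≤))) ⟩
    f′ [] * g′ (x ∷ w) + (∂ x f′ *S g′) w ≈⟨ *S-∷ f′ g′ x w ⟨
    (f′ *S g′) (x ∷ w)                   ∎

  *S-cong : ∀ {f f′ g g′} → f ≐ f′ → g ≐ g′ → (f *S g) ≐ (f′ *S g′)
  *S-cong {f} {f′} {g} {g′} ef eg w = *S-congᵈ {f} {f′} {g} {g′} w (λ u _ → ef u) (λ u _ → eg u)

  ·S-*S : ∀ a f g → ((a ·S f) *S g) ≐ (a ·S (f *S g))
  ·S-*S a f g []      = trans (*S-[] (a ·S f) g) (trans (*-assoc _ _ _) (*-congˡ (sym (*S-[] f g))))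
  ·S-*S a f g (x ∷ w) = begin
    ((a ·S f) *S g) (x ∷ w)
      ≈⟨ *S-∷ (a ·S f) g x w ⟩
    (a * f []) * g (x ∷ w) + ((a ·S ∂ x f) *S g) w
      ≈⟨ +-cong (*-assoc _ _ _) (·S-*S a (∂ x f) g w) ⟩
    a * (f [] * g (x ∷ w)) + a * (∂ x f *S g) w
      ≈⟨ distribˡ _ _ _ ⟨
    a * (f [] * g (x ∷ w) + (∂ x f *S g) w)
      ≈⟨ *-congˡ (*S-∷ f g x w) ⟨
    a * (f *S g) (x ∷ w) ∎

  *S-·S : ∀ a f g → (f *S (a ·S g)) ≐ (a ·S (f *S g))
  *S-·S a f g []      = trans (*S-[] f (a ·S g))
    (trans (solve 3 (λ x y z → x ⊗ (y ⊗ z) ⊜ y ⊗ (x ⊗ z)) refl (f []) a (g [])) (*-congˡ (sym (*S-[] f g))))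
  *S-·S a f g (x ∷ w) = begin
    (f *S (a ·S g)) (x ∷ w)
      ≈⟨ *S-∷ f (a ·S g) x w ⟩
    f [] * (a * g (x ∷ w)) + (∂ x f *S (a ·S g)) w
      ≈⟨ +-cong (solve 3 (λ x y z → x ⊗ (y ⊗ z) ⊜ y ⊗ (x ⊗ z)) refl (f []) a (g (x ∷ w))) (*S-·S a (∂ x f) g w) ⟩
    a * (f [] * g (x ∷ w)) + a * (∂ x f *S g) w
      ≈⟨ distribˡ _ _ _ ⟨
    a * (f [] * g (x ∷ w) + (∂ x f *S g) w)
      ≈⟨ *-congˡ (*S-∷ f g x w) ⟨
    a * (f *S g) (x ∷ w) ∎

  *S-distribʳ : ∀ h f g → ((f +S g) *S h) ≐ ((f *S h) +S (g *S h))
  *S-distribʳ h f g [] = trans (*S-[] (f +S g) h) (trans (distribʳ _ _ _)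
    (sym (+-cong (*S-[] f h) (*S-[] g h))))
  *S-distribʳ h f g (x ∷ w) = begin
    ((f +S g) *S h) (x ∷ w)
      ≈⟨ *S-∷ (f +S g) h x w ⟩
    (f [] + g []) * h (x ∷ w) + ((∂ x f +S ∂ x g) *S h) w
      ≈⟨ +-congˡ (*S-distribʳ h (∂ x f) (∂ x g) w) ⟩
    (f [] + g []) * h (x ∷ w) + ((∂ x f *S h) w + (∂ x g *S h) w)
      ≈⟨ solve 5 (λ a b c d e → (a ⊕ b) ⊗ c ⊕ (d ⊕ e) ⊜ (a ⊗ c ⊕ d) ⊕ (b ⊗ c ⊕ e)) refl _ _ _ _ _ ⟩
    (f [] * h (x ∷ w) + (∂ x f *S h) w) + (g [] * h (x ∷ w) + (∂ x g *S h) w)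
      ≈⟨ +-cong (*S-∷ f h x w) (*S-∷ g h x w) ⟨
    (f *S h) (x ∷ w) + (g *S h) (x ∷ w) ∎

  *S-distribˡ : ∀ h f g → (h *S (f +S g)) ≐ ((h *S f) +S (h *S g))
  *S-distribˡ h f g [] = trans (*S-[] h (f +S g)) (trans (distribˡ _ _ _)
    (sym (+-cong (*S-[] h f) (*S-[] h g))))
  *S-distribˡ h f g (x ∷ w) = begin
    (h *S (f +S g)) (x ∷ w)
      ≈⟨ *S-∷ h (f +S g) x w ⟩
    h [] * (f (x ∷ w) + g (x ∷ w)) + (∂ x h *S (f +S g)) w
      ≈⟨ +-congˡ (*S-distribˡ (∂ x h) f g w) ⟩
    h [] * (f (x ∷ w) + g (x ∷ w)) + ((∂ x h *S f) w + (∂ x h *S g) w)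
      ≈⟨ solve 5 (λ a b c d e → c ⊗ (a ⊕ b) ⊕ (d ⊕ e) ⊜ (c ⊗ a ⊕ d) ⊕ (c ⊗ b ⊕ e)) refl _ _ _ _ _ ⟩
    (h [] * f (x ∷ w) + (∂ x h *S f) w) + (h [] * g (x ∷ w) + (∂ x h *S g) w)
      ≈⟨ +-cong (*S-∷ h f x w) (*S-∷ h g x w) ⟨
    (h *S f) (x ∷ w) + (h *S g) (x ∷ w) ∎

  *S-zeroˡ : ∀ f → (zeroS *S f) ≐ zeroS
  *S-zeroˡ f []      = trans (*S-[] zeroS f) (zeroˡ _)
  *S-zeroˡ f (x ∷ w) = trans (*S-∷ zeroS f x w) (trans (+-cong (zeroˡ _) (*S-zeroˡ f w)) (+-identityˡ _))

  *S-identityˡ : ∀ f → (oneS *S f) ≐ f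
  *S-identityˡ f []      = trans (*S-[] oneS f) (*-identityˡ _)
  *S-identityˡ f (x ∷ w) = trans (*S-∷ oneS f x w) (trans (+-cong (*-identityˡ _) (*S-zeroˡ f w)) (+-identityʳ _))

  *S-identityʳ : ∀ f → (f *S oneS) ≐ f
  *S-identityʳ f []      = trans (*S-[] f oneS) (*-identityʳ _)
  *S-identityʳ f (x ∷ w) = trans (*S-∷ f oneS x w) (trans (+-cong (zeroʳ _) (*S-identityʳ (∂ x f) w)) (+-identityˡ _))

  *S-assoc : ∀ f g h → ((f *S g) *S h) ≐ (f *S (g *S h))
  *S-assoc f g h [] = begin
    ((f *S g) *S h) []     ≈⟨ *S-[] (f *S g) h ⟩
    (f *S g) [] * h []     ≈⟨ *-congʳ (*S-[] f g) ⟩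
    f [] * g [] * h []     ≈⟨ *-assoc _ _ _ ⟩
    f [] * (g [] * h [])   ≈⟨ *-congˡ (*S-[] g h) ⟨
    f [] * (g *S h) []     ≈⟨ *S-[] f (g *S h) ⟨
    (f *S (g *S h)) []     ∎
  *S-assoc f g h (x ∷ w) = begin
    ((f *S g) *S h) (x ∷ w)
      ≈⟨ *S-∷ (f *S g) h x w ⟩
    (f *S g) [] * h (x ∷ w) + (∂ x (f *S g) *S h) w
      ≈⟨ +-cong (*-congʳ (*S-[] f g)) (*S-cong {g = h} (λ u → *S-∷ f g x u) (λ _ → refl) w) ⟩
    f [] * g [] * h (x ∷ w) + (((f [] ·S ∂ x g) +S (∂ x f *S g)) *S h) w
      ≈⟨ +-congˡ (*S-distribʳ h (f [] ·S ∂ x g) (∂ x f *S g) w) ⟩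
    f [] * g [] * h (x ∷ w) + (((f [] ·S ∂ x g) *S h) w + ((∂ x f *S g) *S h) w)
      ≈⟨ +-congˡ (+-cong (·S-*S (f []) (∂ x g) h w) (*S-assoc (∂ x f) g h w)) ⟩
    f [] * g [] * h (x ∷ w) + (f [] * (∂ x g *S h) w + (∂ x f *S (g *S h)) w)
      ≈⟨ solve 5 (λ a b c d e → a ⊗ b ⊗ c ⊕ (a ⊗ d ⊕ e) ⊜ a ⊗ (b ⊗ c ⊕ d) ⊕ e) refl _ _ _ _ _ ⟩
    f [] * (g [] * h (x ∷ w) + (∂ x g *S h) w) + (∂ x f *S (g *S h)) w
      ≈⟨ +-congʳ (*-congˡ (*S-∷ g h x w)) ⟨
    f [] * (g *S h) (x ∷ w) + (∂ x f *S (g *S h)) w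
      ≈⟨ *S-∷ f (g *S h) x w ⟨
    (f *S (g *S h)) (x ∷ w) ∎

  seriesRing : Ring c ℓ
  seriesRing = record
    { Carrier = Series ; _≈_ = _≐_ ; _+_ = _+S_ ; _*_ = _*S_ ; -_ = -S_ ; 0# = zeroS ; 1# = oneS
    ; isRing = record
      { +-isAbelianGroup = record
        { isGroup = record
          { isMonoid = record
            { isSemigroup = record
              { isMagma = record
                { isEquivalence = record
                  { refl = λ _ → refl ; sym = λ e w → sym (e w) ; trans = λ e e′ w → trans (e w) (e′ w) }
                ; ∙-cong = λ e e′ w → +-cong (e w) (e′ w) }
              ; assoc = λ f g h w → +-assoc _ _ _ }
            ; identity = (λ f w → +-identityˡ _) , (λ f w → +-identityʳ _) }
          ; inverse = (λ f w → -‿inverseˡ _) , (λ f w → -‿inverseʳ _)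
          ; ⁻¹-cong = λ e w → -‿cong (e w) }
        ; comm = λ f g w → +-comm _ _ }
      ; *-cong = λ {f} {f′} {g} {g′} → *S-cong {f} {f′} {g} {g′}
      ; *-assoc = *S-assoc
      ; *-identity = *S-identityˡ , *S-identityʳ
      ; distrib = *S-distribˡ , *S-distribʳ } }

  private module S = Ring seriesRing

  infixr 6 _◂_
  -- Left multiplication by a letter (`letter-*S`), in a form that computes by matching on the word.
  _◂_ : Letter → Series → Series
  (x ◂ f) []      = 0#
  (x ◂ f) (y ∷ w) = if does (y ≟L x) then f w else 0#

  ◂-congᵈ : ∀ {f g} x w → (∀ u → suc (length u) ℕ.≤ length w → f u ≈ g u) → (x ◂ f) w ≈ (x ◂ g) w
  ◂-congᵈ x []      e = refl
  ◂-congᵈ x (y ∷ w) e with does (y ≟L x)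
  ... | true  = e w ℕP.≤-refl
  ... | false = refl

  ◂-*S : ∀ x f g → ((x ◂ f) *S g) ≐ (x ◂ (f *S g))
  ◂-*S x f g []      = trans (*S-[] (x ◂ f) g) (zeroˡ _)
  ◂-*S x f g (y ∷ w) = trans (*S-∷ (x ◂ f) g y w) (trans (+-congʳ (zeroˡ _)) (trans (+-identityˡ _) step′))
    where
    step′ : (∂ y (x ◂ f) *S g) w ≈ (x ◂ (f *S g)) (y ∷ w)
    step′ with does (y ≟L x)
    ... | true  = refl
    ... | false = *S-zeroˡ g w

  letter-◂ : ∀ x → letter x ≐ (x ◂ oneS)
  letter-◂ x []          = refl
  letter-◂ x (y ∷ [])    with does (y ≟L x)
  ... | true  = refl
  ... | false = refl
  letter-◂ x (y ∷ z ∷ w) with does (y ≟L x)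
  ... | true  = refl
  ... | false = refl

  letter-*S : ∀ x f → (letter x *S f) ≐ (x ◂ f)
  letter-*S x f w = begin
    (letter x *S f) w       ≈⟨ *S-cong {g = f} (letter-◂ x) (λ _ → refl) w ⟩
    ((x ◂ oneS) *S f) w     ≈⟨ ◂-*S x oneS f w ⟩
    (x ◂ (oneS *S f)) w     ≈⟨ ◂-congᵈ x w (λ u _ → *S-identityˡ f u) ⟩
    (x ◂ f) w               ∎

  ◂-does : ∀ i j i′ j′ (f : Series) w → ((i , j) ◂ f) ((i′ , j′) ∷ w) ≡
    (if does (i′ FinP.≟ i) then (if does (j′ FinP.≟ j) then f w else 0#) else 0#)
  ◂-does i j i′ j′ f w with i′ FinP.≟ i
  ... | no _ = ≡.refl
  ... | yes ≡.refl with does (j′ FinP.≟ j)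
  ... | true = ≡.refl
  ... | false = ≡.refl

  open import Algebra.Properties.Semiring.Sum S.semiring using (sum)
  open import Algebra.Properties.Semiring.Sum semiring
    using () renaming (sum to sumF; sum-cong-≋ to sumF-cong)

  sum-eval : ∀ {N} (F : Fin N → Series) w → sum F w ≈ sumF (λ i → F i w)
  sum-eval {zero}  F w = refl
  sum-eval {suc N} F w = +-congˡ (sum-eval (F ∘ suc) w)

  sumF-0 : ∀ {N} {F : Fin N → Carrier} → (∀ i → F i ≈ 0#) → sumF F ≈ 0#
  sumF-0 {zero}  e = refl
  sumF-0 {suc N} e = trans (+-cong (e zero) (sumF-0 (e ∘ suc))) (+-identityˡ _)

  sumF-δ : ∀ {N} (j : Fin N) (F : Fin N → Carrier) →
    sumF (λ i → if does (j FinP.≟ i) then F i else 0#) ≈ F j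
  sumF-δ {suc N} zero F = trans (+-congˡ (sumF-0 {N} (λ _ → refl))) (+-identityʳ _)
  sumF-δ (suc j) F = trans (+-identityˡ _) (sumF-δ j (F ∘ suc))

  -- Sorting `h` by first letter, `h = h [] + Σ x · ∂ x h`, reduces multiplication by an arbitrary
  -- series to scalars and prefixed letters, the two operations under which `In` is closed by
  -- construction.
  decompose : ∀ h f → (h *S f) ≐
    ((h [] ·S f) +S sum (λ i → sum (λ j → (i , j) ◂ (∂ (i , j) h *S f))))
  decompose h f [] = trans (*S-[] h f) (sym (trans (+-congˡ (trans (sum-eval (λ i → sum (λ j → (i , j) ◂ (∂ (i , j) h *S f))) [])
    (sumF-0 (λ i → trans (sum-eval (λ j → (i , j) ◂ (∂ (i , j) h *S f)) []) (sumF-0 {m} (λ j → refl)))))) (+-identityʳ _)))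
  decompose h f ((i′ , j′) ∷ w) = trans (*S-∷ h f (i′ , j′) w) (+-congˡ (sym (begin
    sum (λ i → sum (λ j → T i j)) ((i′ , j′) ∷ w)
      ≈⟨ trans (sum-eval (λ i → sum (λ j → T i j)) _) (sumF-cong (λ i → sum-eval (T i) _)) ⟩
    sumF (λ i → sumF (λ j → T i j ((i′ , j′) ∷ w)))
      ≈⟨ sumF-cong inner ⟩
    sumF (λ i → if does (i′ FinP.≟ i) then (∂ (i , j′) h *S f) w else 0#)
      ≈⟨ sumF-δ i′ (λ i → (∂ (i , j′) h *S f) w) ⟩
    (∂ (i′ , j′) h *S f) w ∎)))
    where
    T : Fin m → Fin m → Series
    T i j = (i , j) ◂ (∂ (i , j) h *S f)
    inner : ∀ i → sumF (λ j → T i j ((i′ , j′) ∷ w)) ≈ (if does (i′ FinP.≟ i) then (∂ (i , j′) h *S f) w else 0#)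
    inner i = trans (sumF-cong (λ j → reflexive (◂-does i j i′ j′ (∂ (i , j) h *S f) w))) lem
      where
      lem : sumF (λ j → if does (i′ FinP.≟ i) then (if does (j′ FinP.≟ j) then (∂ (i , j) h *S f) w else 0#) else 0#)
            ≈ (if does (i′ FinP.≟ i) then (∂ (i , j′) h *S f) w else 0#)
      lem with does (i′ FinP.≟ i)
      ... | true  = sumF-δ j′ (λ j → (∂ (i , j) h *S f) w)
      ... | false = sumF-0 {m} (λ _ → refl)

  commutator : Letter → Letter → Series → Series
  commutator x y G = (x ◂ y ◂ G) -S (y ◂ x ◂ G)

  -- The ideal of the q = 1 relations, modulo words of length ≥ d.
  data In : ℕ → Series → Set (c ⊔ ℓ) where
    In-0    : ∀ {d} → In d zeroS
    In-resp : ∀ {d f g} → In d f → (∀ w → length w ℕ.< d → f w ≈ g w) → In d g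
    In-+    : ∀ {d f g} → In d f → In d g → In d (f +S g)
    In-·    : ∀ {d f} a → In d f → In d (a ·S f)
    In-gen  : ∀ {d} x y G → proj₁ y Fin.< proj₁ x → In d (commutator x y G)
    In-◂    : ∀ {d f} x → In d f → In (suc d) (x ◂ f)

  In-zero : ∀ {f} → In 0 f
  In-zero = In-resp In-0 (λ _ ())

  In-≐ : ∀ {d f g} → In d f → f ≐ g → In d g
  In-≐ p e = In-resp p (λ w _ → e w)

  In-pred : ∀ {d f} → In (suc d) f → In d f
  In-pred In-0              = In-0
  In-pred (In-resp p e)     = In-resp (In-pred p) (λ w w<d → e w (ℕP.m<n⇒m<1+n w<d))
  In-pred (In-+ p p′)       = In-+ (In-pred p) (In-pred p′)
  In-pred (In-· a p)        = In-· a (In-pred p)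
  In-pred (In-gen x y G lt) = In-gen x y G lt
  In-pred {zero}  (In-◂ x p) = In-zero
  In-pred {suc d} (In-◂ x p) = In-◂ x (In-pred p)

  In-*ʳ : ∀ {d f} h → In d f → In d (f *S h)
  In-*ʳ h In-0 = In-≐ In-0 (λ w → sym (*S-zeroˡ h w))
  In-*ʳ h (In-resp {f = f} {g} p e) = In-resp (In-*ʳ h p)
    (λ w w<d → *S-congᵈ {f} {g} {h} w (λ u u≤w → e u (ℕP.≤-<-trans u≤w w<d)) (λ _ _ → refl))
  In-*ʳ h (In-+ {f = f} {g} p p′) = In-≐ (In-+ (In-*ʳ h p) (In-*ʳ h p′)) (λ w → sym (*S-distribʳ h f g w))
  In-*ʳ h (In-· {f = f} a p) = In-≐ (In-· a (In-*ʳ h p)) (λ w → sym (·S-*S a f h w))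
  In-*ʳ h (In-gen x y G lt) = In-≐ (In-gen x y (G *S h) lt) (λ w → sym (begin
      (commutator x y G *S h) w
        ≈⟨ S.trans (*S-distribʳ h (x ◂ y ◂ G) (-S (y ◂ x ◂ G)))
             (S.+-cong (◂₂ x y) (S.trans (S.sym (SP.-‿distribˡ-* (y ◂ x ◂ G) h)) (S.-‿cong (◂₂ y x)))) w ⟩
      commutator x y (G *S h) w ∎))
    where
    module SP where open import Algebra.Properties.Ring seriesRing public
    ◂₂ : ∀ x y → ((x ◂ y ◂ G) *S h) ≐ (x ◂ y ◂ (G *S h))
    ◂₂ x y w = trans (◂-*S x (y ◂ G) h w) (◂-congᵈ x w (λ u _ → ◂-*S y G h u))
  In-*ʳ h (In-◂ {f = f} x p) = In-≐ (In-◂ x (In-*ʳ h p)) (λ w → sym (◂-*S x f h w))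

  In-sum : ∀ {d N} {F : Fin N → Series} → (∀ i → In d (F i)) → In d (sum F)
  In-sum {N = zero}  p = In-0
  In-sum {N = suc N} p = In-+ (p zero) (In-sum (p ∘ suc))

  -- Prefixing a letter gains one degree, so the factor `∂ x h *S f` is needed only in degree `d`,
  -- one less than the goal. This makes induction on the degree work although `h` is infinite.
  In-*ˡ : ∀ {d f} h → In d f → In d (h *S f)
  In-*ˡ {zero}  h p = In-zero
  In-*ˡ {suc d} {f} h p = In-≐
    (In-+ (In-· (h []) p) (In-sum λ i → In-sum λ j → In-◂ (i , j) (In-*ˡ (∂ (i , j) h) (In-pred p))))
    (λ w → sym (decompose h f w))

  infix 4 _≋_
  -- Each `d` may have its own derivation, which amounts to passing to the closure of the ideal, as
  -- in `_∼_`.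
  _≋_ : Series → Series → Set (c ⊔ ℓ)
  f ≋ g = ∀ d → In d (f -S g)

  ≐⇒≋ : ∀ {f g} → f ≐ g → f ≋ g
  ≐⇒≋ {f} {g} e d = In-≐ In-0 (λ w → sym (trans (+-congʳ (e w)) (-‿inverseʳ (g w))))

  ≋-sym : ∀ {f g} → f ≋ g → g ≋ f
  ≋-sym {f} {g} p d = In-≐ (In-· (- 1#) (p d)) (S.trans (λ w → -1*x≈-x _) (⁻¹-anti-homo‿- f g))
    where open import Algebra.Properties.AbelianGroup S.+-abelianGroup

  telescope : ∀ f g h → ((f -S g) +S (g -S h)) ≐ (f -S h)
  telescope f g h w = begin
    (f w - g w) + (g w - h w)     ≈⟨ solve 4 (λ a b c d → (a ⊕ b) ⊕ (c ⊕ d) ⊜ (a ⊕ d) ⊕ (b ⊕ c)) refl _ _ _ _ ⟩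
    (f w - h w) + (- g w + g w)   ≈⟨ +-congˡ (-‿inverseˡ _) ⟩
    (f w - h w) + 0#              ≈⟨ +-identityʳ _ ⟩
    f w - h w                     ∎

  ≋-trans : ∀ {f g h} → f ≋ g → g ≋ h → f ≋ h
  ≋-trans {f} {g} {h} p p′ d = In-≐ (In-+ (p d) (p′ d)) (telescope f g h)

  ≋-+ : ∀ {f f′ g g′} → f ≋ f′ → g ≋ g′ → (f +S g) ≋ (f′ +S g′)
  ≋-+ {f} {f′} {g} {g′} p p′ d = In-≐ (In-+ (p d) (p′ d)) (λ w → trans
    (solve 4 (λ a b c d → (a ⊕ b) ⊕ (c ⊕ d) ⊜ (a ⊕ c) ⊕ (b ⊕ d)) refl (f w) (- f′ w) (g w) (- g′ w))
    (+-congˡ (-‿+-comm _ _)))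

  ≋-· : ∀ {f g} a → f ≋ g → (a ·S f) ≋ (a ·S g)
  ≋-· {f} {g} a p d = In-≐ (In-· a (p d)) (λ w → trans (distribˡ a (f w) (- g w)) (+-congˡ (sym (-‿distribʳ-* a (g w)))))

  ≋-neg : ∀ {f g} → f ≋ g → (-S f) ≋ (-S g)
  ≋-neg {f} {g} p = ≋-trans (≐⇒≋ (λ w → sym (-1*x≈-x (f w)))) (≋-trans (≋-· (- 1#) p) (≐⇒≋ (λ w → -1*x≈-x (g w))))

  ≋-* : ∀ {f f′ g g′} → f ≋ f′ → g ≋ g′ → (f *S g) ≋ (f′ *S g′)
  ≋-* {f} {f′} {g} {g′} p p′ d = In-≐ (In-+ (In-*ʳ g (p d)) (In-*ˡ f′ (p′ d)))
    (S.trans (S.+-cong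
      (S.trans (*S-distribʳ g f (-S f′)) (S.+-congˡ {f *S g} (S.sym (SP.-‿distribˡ-* f′ g))))
      (S.trans (*S-distribˡ f′ g (-S g′)) (S.+-congˡ {f′ *S g} (S.sym (SP.-‿distribʳ-* f′ g′)))))
      (telescope (f *S g) (f′ *S g) (f′ *S g′)))
    where module SP where open import Algebra.Properties.Ring seriesRing public

  -- Same carrier and operations as `seriesRing` with a coarser equality: here entries in different
  -- rows commute, so the elimination lemmas can be instantiated.
  quotientRing : Ring c (c ⊔ ℓ)
  quotientRing = record
    { Carrier = Series ; _≈_ = _≋_ ; _+_ = _+S_ ; _*_ = _*S_ ; -_ = -S_ ; 0# = zeroS ; 1# = oneS
    ; isRing = record
      { +-isAbelianGroup = record
        { isGroup = record
          { isMonoid = record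
            { isSemigroup = record
              { isMagma = record
                { isEquivalence = record
                  { refl = λ {f} → ≐⇒≋ {f} (λ _ → refl)
                  ; sym = λ {f} {g} → ≋-sym {f} {g}
                  ; trans = λ {f} {g} {h} → ≋-trans {f} {g} {h} }
                ; ∙-cong = λ {f} {f′} {g} {g′} → ≋-+ {f} {f′} {g} {g′} }
              ; assoc = λ f g h → ≐⇒≋ (S.+-assoc f g h) }
            ; identity = (λ f → ≐⇒≋ (S.+-identityˡ f)) , (λ f → ≐⇒≋ (S.+-identityʳ f)) }
          ; inverse = (λ f → ≐⇒≋ (S.-‿inverseˡ f)) , (λ f → ≐⇒≋ (S.-‿inverseʳ f))
          ; ⁻¹-cong = λ {f} {g} → ≋-neg {f} {g} }
        ; comm = λ f g → ≐⇒≋ (S.+-comm f g) }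
      ; *-cong = λ {f} {f′} {g} {g′} → ≋-* {f} {f′} {g} {g′}
      ; *-assoc = λ f g h → ≐⇒≋ (S.*-assoc f g h)
      ; *-identity = (λ f → ≐⇒≋ (S.*-identityˡ f)) , (λ f → ≐⇒≋ (S.*-identityʳ f))
      ; distrib = (λ f g h → ≐⇒≋ (S.distribˡ f g h)) , (λ f g h → ≐⇒≋ (S.distribʳ f g h)) } }

  private module Q = Ring quotientRing

  Commute : Series → Series → Set (c ⊔ ℓ)
  Commute f g = (f *S g) ≋ (g *S f)

  letters-commute-> : ∀ {i i′} j j′ → i′ Fin.< i → Commute (a i j) (a i′ j′)
  letters-commute-> {i} {i′} j j′ i′<i d = In-≐ (In-gen (i , j) (i′ , j′) oneS i′<i) (λ w → sym (+-cong
    (word (i , j) (i′ , j′) w) (-‿cong (word (i′ , j′) (i , j) w))))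
    where
    word : ∀ x y → (letter x *S letter y) ≐ (x ◂ y ◂ oneS)
    word x y w = trans (letter-*S x (letter y) w) (◂-congᵈ x w (λ u _ → letter-◂ y u))

  letters-commute : ∀ {i i′} j j′ → i ≢ i′ → Commute (a i j) (a i′ j′)
  letters-commute {i} {i′} j j′ i≢i′ with FinP.<-cmp i i′
  ... | tri< i<i′ _ _ = ≋-sym {a i′ j′ *S a i j} {a i j *S a i′ j′} (letters-commute-> j′ j i<i′)
  ... | tri≈ _ e _    = contradiction e i≢i′
  ... | tri> _ _ i>i′ = letters-commute-> j j′ i>i′

  affine : Carrier → Carrier → Series → Series
  affine c e L = (c ·S oneS) +S (e ·S L)

  commute-affine : ∀ {f L} c e → Commute f L → Commute f (affine c e L)
  commute-affine {f} {L} c e p = Q.trans {f *S affine c e L} {(c ·S f) +S (e ·S (f *S L))} {affine c e L *S f}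
    (≐⇒≋ (S.trans (*S-distribˡ f (c ·S oneS) (e ·S L)) (λ w → +-cong
      (trans (*S-·S c f oneS w) (*-congˡ (*S-identityʳ f w))) (*S-·S e f L w))))
    (Q.trans {(c ·S f) +S (e ·S (f *S L))} {(c ·S f) +S (e ·S (L *S f))} {affine c e L *S f}
      (≋-+ {c ·S f} {c ·S f} {e ·S (f *S L)} {e ·S (L *S f)} (≐⇒≋ (λ _ → refl)) (≋-· e p))
      (≐⇒≋ (S.sym (S.trans (*S-distribʳ f (c ·S oneS) (e ·S L)) (λ w → +-cong
        (trans (·S-*S c oneS f w) (*-congˡ (*S-identityˡ f w))) (·S-*S e L f w))))))

-- Inversions as sums over lists

total : ∀ {A : Set} → (A → ℕ) → List A → ℕ
total g []       = 0
total g (x ∷ xs) = g x ℕ.+ total g xs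

total-cong : ∀ {A : Set} {g h : A → ℕ} → (∀ x → g x ≡ h x) → ∀ xs → total g xs ≡ total h xs
total-cong e []       = ≡.refl
total-cong e (x ∷ xs) = ≡.cong₂ ℕ._+_ (e x) (total-cong e xs)

interchange : ∀ a b c d → (a ℕ.+ b) ℕ.+ (c ℕ.+ d) ≡ (a ℕ.+ c) ℕ.+ (b ℕ.+ d)
interchange = solve 4 (λ a b c d → (a :+ b) :+ (c :+ d) := (a :+ c) :+ (b :+ d)) ≡.refl
  where open +-*-Solver

total-+ : ∀ {A : Set} (g h : A → ℕ) xs → total (λ x → g x ℕ.+ h x) xs ≡ total g xs ℕ.+ total h xs
total-+ g h []       = ≡.refl
total-+ g h (x ∷ xs) = ≡.trans (≡.cong (g x ℕ.+ h x ℕ.+_) (total-+ g h xs)) (interchange (g x) _ _ _)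

total-++ : ∀ {A : Set} (g : A → ℕ) xs ys → total g (xs ++ ys) ≡ total g xs ℕ.+ total g ys
total-++ g []       ys = ≡.refl
total-++ g (x ∷ xs) ys = ≡.trans (≡.cong (g x ℕ.+_) (total-++ g xs ys)) (≡.sym (ℕP.+-assoc (g x) _ _))

total-0 : ∀ {A : Set} (xs : List A) → total (λ _ → 0) xs ≡ 0
total-0 []       = ≡.refl
total-0 (x ∷ xs) = total-0 xs

below : ∀ {N} → Fin N → Fin N → ℕ
below x y = if does (y Fin.<? x) then 1 else 0

below-1 : ∀ {N} {x y : Fin N} → y Fin.< x → below x y ≡ 1
below-1 {x = x} {y} lt rewrite dec-true (y Fin.<? x) lt = ≡.refl

below-0 : ∀ {N} {x y : Fin N} → ¬ (y Fin.< x) → below x y ≡ 0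
below-0 {x = x} {y} nlt rewrite dec-false (y Fin.<? x) nlt = ≡.refl

-- These are the inversions between a block `xs` and a block `ys` behind it. As a double `total` the
-- number depends only on the two multisets of labels.
crossings : ∀ {N} → List (Fin N) → List (Fin N) → ℕ
crossings xs ys = total (λ x → total (below x) ys) xs

inv-∷ : ∀ {N} (x : Fin N) xs → inv (x ∷ xs) ≡ total (below x) xs ℕ.+ inv xs
inv-∷ x xs = ≡.cong (ℕ._+ inv xs) (count xs)
  where
  count : ∀ ys → length (filter (λ y → y Fin.<? x) ys) ≡ total (below x) ys
  count [] = ≡.refl
  count (y ∷ ys) with does (y Fin.<? x)
  ... | true  = ≡.cong suc (count ys)
  ... | false = count ys

inv-++ : ∀ {N} (xs ys : List (Fin N)) → inv (xs ++ ys) ≡ (inv xs ℕ.+ inv ys) ℕ.+ crossings xs ys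
inv-++ []       ys = ≡.sym (ℕP.+-identityʳ _)
inv-++ (x ∷ xs) ys = begin
  inv (x ∷ xs ++ ys)                                     ≡⟨ inv-∷ x (xs ++ ys) ⟩
  total (below x) (xs ++ ys) ℕ.+ inv (xs ++ ys)          ≡⟨ ≡.cong₂ ℕ._+_ (total-++ (below x) xs ys) (inv-++ xs ys) ⟩
  (bx ℕ.+ by) ℕ.+ ((inv xs ℕ.+ inv ys) ℕ.+ crossings xs ys)
    ≡⟨ solve 5 (λ p q r s t → (p :+ q) :+ ((r :+ s) :+ t) := ((p :+ r) :+ s) :+ (q :+ t)) ≡.refl bx by (inv xs) (inv ys) _ ⟩
  ((bx ℕ.+ inv xs) ℕ.+ inv ys) ℕ.+ crossings (x ∷ xs) ys ≡⟨ ≡.cong (λ t → t ℕ.+ inv ys ℕ.+ crossings (x ∷ xs) ys) (inv-∷ x xs) ⟨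
  (inv (x ∷ xs) ℕ.+ inv ys) ℕ.+ crossings (x ∷ xs) ys    ∎
  where
  open ≡.≡-Reasoning
  open +-*-Solver
  bx = total (below x) xs
  by = total (below x) ys

-- Transport of the ideal from q = 1 to the q-relations

module Twist {c ℓ} (K : CommutativeRing c ℓ) (q qinv : CommutativeRing.Carrier K)
  (q-inv : CommutativeRing._≈_ K (CommutativeRing._*_ K q qinv) (CommutativeRing.1# K)) (n k : ℕ) where
  open Setup K q qinv n k
  open Quotient K q qinv n k
  open CommutativeRing K hiding (zero)
  open import Algebra.Properties.Ring ring using (-‿distribʳ-*)
  open import Algebra.Solver.Ring.NaturalCoefficients.Default commutativeSemiring
    using (solve) renaming (_:=_ to infix 4 _⊜_; _:*_ to _⊗_)
  open import Relation.Binary.Reasoning.Setoid setoid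
  private module S = Ring seriesRing

  powK-+ : ∀ x a b → powK x (a ℕ.+ b) ≈ powK x a * powK x b
  powK-+ x zero    b = sym (*-identityˡ _)
  powK-+ x (suc a) b = trans (*-congˡ (powK-+ x a b)) (sym (*-assoc _ _ _))

  -- This is q to the power `a - b`. Keeping the exponent as a pair of naturals matches column and
  -- row inversions; `q^-≡` shows that only the difference matters.
  q^ : ℕ → ℕ → Carrier
  q^ a b = powK q a * powK qinv b

  q^-+ : ∀ a b a′ b′ → q^ (a ℕ.+ a′) (b ℕ.+ b′) ≈ q^ a b * q^ a′ b′
  q^-+ a b a′ b′ = trans (*-cong (powK-+ q a a′) (powK-+ qinv b b′))
    (solve 4 (λ a a′ b b′ → (a ⊗ a′) ⊗ (b ⊗ b′) ⊜ (a ⊗ b) ⊗ (a′ ⊗ b′)) refl _ _ _ _)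

  q^-refl : ∀ a → q^ a a ≈ 1#
  q^-refl zero    = *-identityˡ _
  q^-refl (suc a) = begin
    (q * powK q a) * (qinv * powK qinv a)
      ≈⟨ solve 4 (λ a a′ b b′ → (a ⊗ a′) ⊗ (b ⊗ b′) ⊜ (a ⊗ b) ⊗ (a′ ⊗ b′)) refl _ _ _ _ ⟩
    (q * qinv) * q^ a a   ≈⟨ *-cong q-inv (q^-refl a) ⟩
    1# * 1#               ≈⟨ *-identityˡ _ ⟩
    1#                    ∎

  q^-inverse : ∀ a b → q^ a b * q^ b a ≈ 1#
  q^-inverse a b = trans (sym (q^-+ a b b a)) (trans (reflexive (≡.cong (q^ (a ℕ.+ b)) (ℕP.+-comm b a))) (q^-refl (a ℕ.+ b)))

  q^-≡ : ∀ a b a′ b′ → a ℕ.+ b′ ≡ a′ ℕ.+ b → q^ a b ≈ q^ a′ b′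
  q^-≡ a b a′ b′ e = begin
    q^ a b                            ≈⟨ *-identityʳ _ ⟨
    q^ a b * 1#                       ≈⟨ *-congˡ (q^-inverse b′ a′) ⟨
    q^ a b * (q^ b′ a′ * q^ a′ b′)    ≈⟨ *-assoc _ _ _ ⟨
    (q^ a b * q^ b′ a′) * q^ a′ b′    ≈⟨ *-congʳ (q^-+ a b b′ a′) ⟨
    q^ (a ℕ.+ b′) (b ℕ.+ a′) * q^ a′ b′
      ≈⟨ *-congʳ (trans (reflexive (≡.cong (λ t → q^ t (b ℕ.+ a′)) (≡.trans e (ℕP.+-comm a′ b)))) (q^-refl (b ℕ.+ a′))) ⟩
    1# * q^ a′ b′                     ≈⟨ *-identityˡ _ ⟩
    q^ a′ b′                          ∎

  rows cols : Word → List (Fin m)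
  rows = map proj₁
  cols = map proj₂

  -- α and β account for the crossings with letters already split off in front of w.
  weight : (α β : Fin m → ℕ) → Word → Carrier
  weight α β w = q^ (inv (cols w) ℕ.+ total α (cols w)) (inv (rows w) ℕ.+ total β (rows w))

  weight-cong : ∀ {α α′ β β′} → (∀ x → α x ≡ α′ x) → (∀ x → β x ≡ β′ x) → ∀ w → weight α β w ≈ weight α′ β′ w
  weight-cong eα eβ w = reflexive (≡.cong₂ (λ s t → q^ (inv (cols w) ℕ.+ s) (inv (rows w) ℕ.+ t))
    (total-cong eα (cols w)) (total-cong eβ (rows w)))

  -- Once `x` is split off, its inversions with each later label `z` are still owed; they are booked
  -- by adding `below _ z` to the counters.
  weight-∷ : ∀ α β x w → weight α β (x ∷ w) ≈ q^ (α (proj₂ x)) (β (proj₁ x)) *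
    weight (λ y → below (proj₂ x) y ℕ.+ α y) (λ y → below (proj₁ x) y ℕ.+ β y) w
  weight-∷ α β x w = trans (reflexive (≡.cong₂ q^ (exponent α (proj₂ x) (cols w)) (exponent β (proj₁ x) (rows w))))
    (q^-+ (α (proj₂ x)) (β (proj₁ x)) _ _)
    where
    exponent : ∀ (γ : Fin m → ℕ) y ys → inv (y ∷ ys) ℕ.+ total γ (y ∷ ys) ≡
      γ y ℕ.+ (inv ys ℕ.+ total (λ z → below y z ℕ.+ γ z) ys)
    exponent γ y ys rewrite inv-∷ y ys | total-+ (below y) γ ys =
      NS.solve 4 (λ b i g t → (b NS.:+ i) NS.:+ (g NS.:+ t) NS.:= g NS.:+ (i NS.:+ (b NS.:+ t))) ≡.refl
        (total (below y) ys) (inv ys) (γ y) (total γ ys)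
      where module NS = +-*-Solver

  twist : (α β : Fin m → ℕ) → Series → Series
  twist α β f w = weight α β w * f w

  twist-◂ : ∀ α β x f → twist α β (x ◂ f) ≐ (q^ (α (proj₂ x)) (β (proj₁ x)) ·S
    (x ◂ twist (λ y → below (proj₂ x) y ℕ.+ α y) (λ y → below (proj₁ x) y ℕ.+ β y) f))
  twist-◂ α β x f [] = trans (zeroʳ _) (sym (zeroʳ _))
  twist-◂ α β x f (y ∷ w) with y ≟L x
  ... | yes ≡.refl = trans (*-congʳ (weight-∷ α β x w)) (*-assoc _ _ _)
  ... | no  _ = trans (zeroʳ _) (sym (zeroʳ _))

  product : Series × Gen × Series → Series
  product t = (proj₁ t *S genS (proj₁ (proj₂ t))) *S proj₂ (proj₂ t)

  -- By unfolding, `f ∼ g` is `∀ d → Inq d (f -S g)`.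
  Inq : ℕ → Series → Set (c ⊔ ℓ)
  Inq d f = Σ (List (Series × Gen × Series)) λ hs → ∀ w → length w ℕ.< d → f w ≈ sumS (map product hs) w

  Inq-resp : ∀ {d f g} → Inq d f → (∀ w → length w ℕ.< d → f w ≈ g w) → Inq d g
  Inq-resp (hs , p) e = hs , λ w w<d → trans (sym (e w w<d)) (p w w<d)

  Inq-≐ : ∀ {d f g} → Inq d f → f ≐ g → Inq d g
  Inq-≐ p e = Inq-resp p (λ w _ → e w)

  Inq-+ : ∀ {d f g} → Inq d f → Inq d g → Inq d (f +S g)
  Inq-+ (hs , p) (hs′ , p′) = hs ++ hs′ , λ w w<d → trans (+-cong (p w w<d) (p′ w w<d)) (append hs w)
    where
    append : ∀ hs w → sumS (map product hs) w + sumS (map product hs′) w ≈ sumS (map product (hs ++ hs′)) w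
    append []       w = +-identityˡ _
    append (h ∷ hs) w = trans (+-assoc _ _ _) (+-congˡ (append hs w))

  -- The finite sum `f′` is kept apart from `f`: for a letter `h`, the products `h *S f` and
  -- `h *S f′` agree in one degree more than the factors do, which `Inq-◂` exploits.
  Inq-*ˡ : ∀ {d f} h → Inq d f → Σ (List (Series × Gen × Series)) λ hs → Σ Series λ f′ →
    (∀ w → length w ℕ.< d → f w ≈ f′ w) × ((h *S f′) ≐ sumS (map product hs))
  Inq-*ˡ h (hs , p) = map (λ t → (h *S proj₁ t) , proj₂ t) hs , sumS (map product hs) , p , distribute hs
    where
    distribute : ∀ hs → (h *S sumS (map product hs)) ≐ sumS (map product (map (λ t → (h *S proj₁ t) , proj₂ t) hs))
    distribute []       = S.zeroʳ h
    distribute ((F , g , G) ∷ hs) = S.trans (S.distribˡ h (product (F , g , G)) (sumS (map product hs)))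
      (S.+-cong (S.trans (S.sym (S.*-assoc h (F *S genS g) G)) (S.*-congʳ {G} (S.sym (S.*-assoc h F (genS g)))))
                (distribute hs))

  Inq-· : ∀ {d f} e → Inq d f → Inq d (e ·S f)
  Inq-· {f = f} e p with Inq-*ˡ (e ·S oneS) p
  ... | hs , f′ , f≈f′ , eq = hs , λ w w<d → trans (*-congˡ (f≈f′ w w<d))
    (trans (sym (trans (·S-*S e oneS f′ w) (*-congˡ (*S-identityˡ f′ w)))) (eq w))

  Inq-◂ : ∀ {d f} x → Inq d f → Inq (suc d) (x ◂ f)
  Inq-◂ x p with Inq-*ˡ (letter x) p
  ... | hs , f′ , f≈f′ , eq = hs , λ { w (ℕ.s≤s w≤d) →
    trans (◂-congᵈ x w (λ u u<w → f≈f′ u (ℕP.≤-trans u<w w≤d))) (trans (sym (letter-*S x f′ w)) (eq w)) }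

  Inq-gen : ∀ {d} g x y ρ G → (genS g ≐ ((letter x *S letter y) -S (ρ ·S (letter y *S letter x)))) →
    Inq d ((x ◂ y ◂ G) -S (ρ ·S (y ◂ x ◂ G)))
  Inq-gen g x y ρ G e = ((oneS , g , G) ∷ []) , λ w _ → sym (begin
    (product (oneS , g , G) +S zeroS) w   ≈⟨ +-identityʳ _ ⟩
    ((oneS *S genS g) *S G) w             ≈⟨ *S-cong {g = G} (*S-identityˡ (genS g)) (λ _ → refl) w ⟩
    (genS g *S G) w                       ≈⟨ *S-cong {g = G} e (λ _ → refl) w ⟩
    (((letter x *S letter y) -S (ρ ·S (letter y *S letter x))) *S G) w
      ≈⟨ S.trans (*S-distribʳ G (letter x *S letter y) (-S (ρ ·S (letter y *S letter x))))
           (S.+-cong (letters x y) (S.trans (S.sym (SP.-‿distribˡ-* (ρ ·S (letter y *S letter x)) G))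
             (S.-‿cong (S.trans (·S-*S ρ (letter y *S letter x) G) (λ u → *-congˡ (letters y x u)))))) w ⟩
    ((x ◂ y ◂ G) -S (ρ ·S (y ◂ x ◂ G))) w ∎)
    where
    module SP where open import Algebra.Properties.Ring seriesRing public
    letters : ∀ x y → ((letter x *S letter y) *S G) ≐ (x ◂ y ◂ G)
    letters x y w = trans (*S-assoc (letter x) (letter y) G w) (trans (letter-*S x (letter y *S G) w)
      (◂-congᵈ x w (λ u _ → letter-*S y G u)))

  ◂-· : ∀ x e f → (x ◂ (e ·S f)) ≐ (e ·S (x ◂ f))
  ◂-· x e f []      = sym (zeroʳ e)
  ◂-· x e f (y ∷ w) with does (y ≟L x)
  ... | true  = refl
  ... | false = sym (zeroʳ e)

  module _ (α β : Fin m → ℕ) where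

    α₂ : Letter → Letter → Fin m → ℕ
    α₂ x y z = below (proj₂ y) z ℕ.+ (below (proj₂ x) z ℕ.+ α z)
    β₂ : Letter → Letter → Fin m → ℕ
    β₂ x y z = below (proj₁ y) z ℕ.+ (below (proj₁ x) z ℕ.+ β z)

    colExp rowExp : Letter → Letter → ℕ
    colExp x y = α (proj₂ x) ℕ.+ (below (proj₂ x) (proj₂ y) ℕ.+ α (proj₂ y))
    rowExp x y = β (proj₁ x) ℕ.+ (below (proj₁ x) (proj₁ y) ℕ.+ β (proj₁ y))

    twist-◂◂ : ∀ x y G → twist α β (x ◂ y ◂ G) ≐ (q^ (colExp x y) (rowExp x y) ·S (x ◂ y ◂ twist (α₂ x y) (β₂ x y) G))
    twist-◂◂ x y G w = begin
      twist α β (x ◂ y ◂ G) w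
        ≈⟨ twist-◂ α β x (y ◂ G) w ⟩
      e₁ * (x ◂ twist α′ β′ (y ◂ G)) w
        ≈⟨ *-congˡ (trans (◂-congᵈ x w (λ u _ → twist-◂ α′ β′ y G u)) (◂-· x e₂ _ w)) ⟩
      e₁ * (e₂ * (x ◂ y ◂ twist (α₂ x y) (β₂ x y) G) w)
        ≈⟨ *-assoc _ _ _ ⟨
      (e₁ * e₂) * (x ◂ y ◂ twist (α₂ x y) (β₂ x y) G) w
        ≈⟨ *-congʳ (q^-+ (α (proj₂ x)) (β (proj₁ x)) (α′ (proj₂ y)) (β′ (proj₁ y))) ⟨
      _ ∎
      where
      α′ β′ : Fin m → ℕ
      α′ z = below (proj₂ x) z ℕ.+ α z
      β′ z = below (proj₁ x) z ℕ.+ β z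
      e₁ = q^ (α (proj₂ x)) (β (proj₁ x))
      e₂ = q^ (α′ (proj₂ y)) (β′ (proj₁ y))

    -- Both orders of `x` and `y` leave the same counters for `G`, so the twists of the two words
    -- differ by a scalar only. The equation between exponents says that this scalar is `q^ r 0`,
    -- the coefficient of the relation `g`.
    Inq-commutator : ∀ {d} g x y r G →
      (genS g ≐ ((letter x *S letter y) -S (q^ r 0 ·S (letter y *S letter x)))) →
      colExp y x ℕ.+ rowExp x y ≡ (colExp x y ℕ.+ r) ℕ.+ rowExp y x →
      Inq d (twist α β (commutator x y G))
    Inq-commutator g x y r G e exps = Inq-≐ (Inq-· e₁ (Inq-gen g x y (q^ r 0) G₁ e)) (λ w → begin
      e₁ * ((x ◂ y ◂ G₁) w - q^ r 0 * (y ◂ x ◂ G₁) w)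
        ≈⟨ trans (distribˡ _ _ _) (+-congˡ (trans (sym (-‿distribʳ-* _ _)) (-‿cong (sym (*-assoc _ _ _))))) ⟩
      e₁ * (x ◂ y ◂ G₁) w - (e₁ * q^ r 0) * (y ◂ x ◂ G₁) w
        ≈⟨ +-cong (sym (twist-◂◂ x y G w)) (-‿cong (trans (*-cong scalars (◂-congᵈ y w λ u _ → ◂-congᵈ x u λ v _ →
             *-congʳ (weight-cong (λ z → swap (below (proj₂ y) z) (below (proj₂ x) z) (α z))
                                  (λ z → swap (below (proj₁ y) z) (below (proj₁ x) z) (β z)) v)))
             (sym (twist-◂◂ y x G w)))) ⟩
      twist α β (x ◂ y ◂ G) w - twist α β (y ◂ x ◂ G) w
        ≈⟨ trans (distribˡ _ _ _) (+-congˡ (sym (-‿distribʳ-* _ _))) ⟨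
      twist α β (commutator x y G) w ∎)
      where
      G₁ = twist (α₂ x y) (β₂ x y) G
      e₁ = q^ (colExp x y) (rowExp x y)
      swap : ∀ a b c → a ℕ.+ (b ℕ.+ c) ≡ b ℕ.+ (a ℕ.+ c)
      swap a b c = ≡.trans (≡.sym (ℕP.+-assoc a b c)) (≡.trans (≡.cong (ℕ._+ c) (ℕP.+-comm a b)) (ℕP.+-assoc b a c))
      scalars : e₁ * q^ r 0 ≈ q^ (colExp y x) (rowExp y x)
      scalars = trans (sym (q^-+ (colExp x y) (rowExp x y) r 0))
        (q^-≡ (colExp x y ℕ.+ r) (rowExp x y ℕ.+ 0) (colExp y x) (rowExp y x) (≡.sym (≡.trans
        (≡.cong (colExp y x ℕ.+_) (ℕP.+-identityʳ (rowExp x y))) exps)))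

  -- By induction on the derivation, for all counters at once because prefixing a letter changes
  -- them. At a commutator the larger row comes first; the order of the two columns decides which of
  -- the three relations results.
  In⇒Inq : ∀ {d f} → In d f → ∀ α β → Inq d (twist α β f)
  In⇒Inq In-0 α β = [] , λ w _ → zeroʳ _
  In⇒Inq (In-resp p e) α β = Inq-resp (In⇒Inq p α β) (λ w w<d → *-congˡ (e w w<d))
  In⇒Inq (In-+ p p′) α β = Inq-≐ (Inq-+ (In⇒Inq p α β) (In⇒Inq p′ α β)) (λ w → sym (distribˡ _ _ _))
  In⇒Inq (In-· e p) α β = Inq-≐ (Inq-· e (In⇒Inq p α β))
    (λ w → solve 3 (λ x y z → x ⊗ (y ⊗ z) ⊜ y ⊗ (x ⊗ z)) refl _ _ _)
  In⇒Inq (In-◂ x p) α β = Inq-≐ (Inq-· (q^ (α (proj₂ x)) (β (proj₁ x))) (Inq-◂ x (In⇒Inq p _ _))) (S.sym (twist-◂ α β x _))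
  In⇒Inq (In-gen (j , l) (i , l′) G i<j) α β with FinP.<-cmp l′ l
  -- The first order has a row and a column inversion, the second neither: the ratio of weights is
  -- 1.
  ... | tri< l′<l _ l≮l′ = Inq-commutator α β (gen₁ i j l′ l i<j l′<l) (j , l) (i , l′) 0 G
        (λ w → +-congˡ (-‿cong (sym (trans (*-congʳ (*-identityˡ _)) (*-identityˡ _)))))
        exps
    where
    exps : colExp α β (i , l′) (j , l) ℕ.+ rowExp α β (j , l) (i , l′) ≡
      (colExp α β (j , l) (i , l′) ℕ.+ 0) ℕ.+ rowExp α β (i , l′) (j , l)
    exps rewrite below-1 l′<l | below-0 l≮l′ | below-1 i<j | below-0 (ℕP.<-asym i<j) =
      NS.solve 4 (λ a a′ b b′ → (a′ NS.:+ a) NS.:+ (b NS.:+ (NS.con 1 NS.:+ b′)) NS.:=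
        ((a NS.:+ (NS.con 1 NS.:+ a′)) NS.:+ NS.con 0) NS.:+ (b′ NS.:+ b)) ≡.refl (α l) (α l′) (β j) (β i)
      where module NS = +-*-Solver
  -- The first order has only a row inversion, the second only a column inversion: passing from
  -- weight 1/q to weight q costs two factors of q.
  ... | tri> l′≮l _ l<l′ = Inq-commutator α β (gen₂ i j l′ l i<j l<l′) (j , l) (i , l′) 2 G
        (λ w → +-congˡ (-‿cong (sym (*-congʳ (trans (*-identityʳ _) (*-congˡ (*-identityʳ _)))))))
        exps
    where
    exps : colExp α β (i , l′) (j , l) ℕ.+ rowExp α β (j , l) (i , l′) ≡
      (colExp α β (j , l) (i , l′) ℕ.+ 2) ℕ.+ rowExp α β (i , l′) (j , l)
    exps rewrite below-1 l<l′ | below-0 l′≮l | below-1 i<j | below-0 (ℕP.<-asym i<j) =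
      NS.solve 4 (λ a a′ b b′ → (a′ NS.:+ (NS.con 1 NS.:+ a)) NS.:+ (b NS.:+ (NS.con 1 NS.:+ b′)) NS.:=
        ((a NS.:+ a′) NS.:+ NS.con 2) NS.:+ (b′ NS.:+ b)) ≡.refl (α l) (α l′) (β j) (β i)
      where module NS = +-*-Solver
  -- Equal columns leave only the row inversion of the first order: one factor of q.
  ... | tri≈ l≮l ≡.refl _ = Inq-commutator α β (gen₃ i j l i<j) (j , l) (i , l) 1 G
        (λ w → +-congˡ (-‿cong (sym (*-congʳ (trans (*-identityʳ _) (*-identityʳ _))))))
        exps
    where
    exps : colExp α β (i , l) (j , l) ℕ.+ rowExp α β (j , l) (i , l) ≡
      (colExp α β (j , l) (i , l) ℕ.+ 1) ℕ.+ rowExp α β (i , l) (j , l)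
    exps rewrite below-0 l≮l | below-1 i<j | below-0 (ℕP.<-asym i<j) =
      NS.solve 3 (λ a b b′ → (a NS.:+ a) NS.:+ (b NS.:+ (NS.con 1 NS.:+ b′)) NS.:=
        ((a NS.:+ a) NS.:+ NS.con 1) NS.:+ (b′ NS.:+ b)) ≡.refl (α l) (β j) (β i)
      where module NS = +-*-Solver

  wt : Word → Carrier
  wt w = q^ (inv (cols w)) (inv (rows w))

  Φ : Series → Series
  Φ f w = wt w * f w

  Φ-≋ : ∀ {f g} → f ≋ g → Φ f ∼ Φ g
  Φ-≋ {f} {g} p d = Inq-≐ (In⇒Inq (p d) (λ _ → 0) (λ _ → 0)) (λ w → trans (*-congʳ (weight-0 w))
    (trans (distribˡ _ _ _) (+-congˡ (sym (-‿distribʳ-* _ _)))))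
    where
    weight-0 : ∀ w → weight (λ _ → 0) (λ _ → 0) w ≈ wt w
    weight-0 w = reflexive (≡.cong₂ q^
      (≡.trans (≡.cong (inv (cols w) ℕ.+_) (total-0 (cols w))) (ℕP.+-identityʳ _))
      (≡.trans (≡.cong (inv (rows w) ℕ.+_) (total-0 (rows w))) (ℕP.+-identityʳ _)))

  -- The last factor is exactly what keeps `Φ` from being multiplicative.
  wt-++ : ∀ u v → wt (u ++ v) ≈ (wt u * wt v) * q^ (crossings (cols u) (cols v)) (crossings (rows u) (rows v))
  wt-++ u v = trans (reflexive (≡.cong₂ q^ (exponent proj₂) (exponent proj₁)))
    (trans (q^-+ (inv (cols u) ℕ.+ inv (cols v)) (inv (rows u) ℕ.+ inv (rows v)) _ _)
      (*-congʳ (q^-+ (inv (cols u)) (inv (rows u)) _ _)))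
    where
    exponent : ∀ (f : Letter → Fin m) → inv (map f (u ++ v)) ≡ (inv (map f u) ℕ.+ inv (map f v)) ℕ.+ crossings (map f u) (map f v)
    exponent f = ≡.trans (≡.cong inv (ListP.map-++ f u v)) (inv-++ (map f u) (map f v))

-- Permutation vectors and the Leibniz formula

avoids : ∀ {N} → Fin N → List (Fin N) → Bool
avoids x []       = true
avoids x (y ∷ ys) = not (does (x FinP.≟ y)) ∧ avoids x ys

distinct : ∀ {N} → List (Fin N) → Bool
distinct []       = true
distinct (x ∷ xs) = avoids x xs ∧ distinct xs

-- The filter that defines `perms` is traded for a Boolean conjunction, which splits along the head
-- of a vector.
distinct-unique? : ∀ {N} (xs : List (Fin N)) → does (UniqueDec.unique? FinP._≟_ xs) ≡ distinct xs
distinct-unique? []       = ≡.refl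
distinct-unique? (x ∷ xs) = ≡.cong₂ _∧_ (avoids-all? xs) (distinct-unique? xs)
  where
  open import Relation.Nullary.Decidable using (¬?)
  avoids-all? : ∀ ys → does (All.all? (λ y → ¬? (x FinP.≟ y)) ys) ≡ avoids x ys
  avoids-all? []       = ≡.refl
  avoids-all? (y ∷ ys) = ≡.cong (not (does (x FinP.≟ y)) ∧_) (avoids-all? ys)

≟-punchIn : ∀ {N} (x : Fin (suc N)) y z → does (punchIn x y FinP.≟ punchIn x z) ≡ does (y FinP.≟ z)
≟-punchIn x y z with y FinP.≟ z
... | yes e = dec-true (punchIn x y FinP.≟ punchIn x z) (≡.cong (punchIn x) e)
... | no ≢z = dec-false (punchIn x y FinP.≟ punchIn x z) (≢z ∘ FinP.punchIn-injective x y z)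

avoids-punchIn : ∀ {N} (x : Fin (suc N)) y zs → avoids (punchIn x y) (map (punchIn x) zs) ≡ avoids y zs
avoids-punchIn x y []       = ≡.refl
avoids-punchIn x y (z ∷ zs) = ≡.cong₂ _∧_ (≡.cong not (≟-punchIn x y z)) (avoids-punchIn x y zs)

distinct-punchIn : ∀ {N} (x : Fin (suc N)) ys → distinct (map (punchIn x) ys) ≡ distinct ys
distinct-punchIn x []       = ≡.refl
distinct-punchIn x (y ∷ ys) = ≡.cong₂ _∧_ (avoids-punchIn x y ys) (distinct-punchIn x ys)

below-punchIn : ∀ {N} (x : Fin (suc N)) y z → below (punchIn x y) (punchIn x z) ≡ below y z
below-punchIn zero    y       z       = ≡.refl
below-punchIn (suc x) zero    zero    = ≡.refl
below-punchIn (suc x) zero    (suc z) = ≡.refl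
below-punchIn (suc x) (suc y) zero    = ≡.refl
below-punchIn (suc x) (suc y) (suc z) = below-punchIn x y z

total-map : ∀ {A B : Set} (g : B → ℕ) (f : A → B) xs → total g (map f xs) ≡ total (g ∘ f) xs
total-map g f []       = ≡.refl
total-map g f (x ∷ xs) = ≡.cong (g (f x) ℕ.+_) (total-map g f xs)

inv-punchIn : ∀ {N} (x : Fin (suc N)) ys → inv (map (punchIn x) ys) ≡ inv ys
inv-punchIn x []       = ≡.refl
inv-punchIn x (y ∷ ys) = begin
  inv (map (punchIn x) (y ∷ ys))
    ≡⟨ inv-∷ (punchIn x y) (map (punchIn x) ys) ⟩
  total (below (punchIn x y)) (map (punchIn x) ys) ℕ.+ inv (map (punchIn x) ys)
    ≡⟨ ≡.cong₂ ℕ._+_ (≡.trans (total-map _ (punchIn x) ys) (total-cong (below-punchIn x y) ys)) (inv-punchIn x ys) ⟩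
  total (below y) ys ℕ.+ inv ys
    ≡⟨ inv-∷ y ys ⟨
  inv (y ∷ ys) ∎
  where open ≡.≡-Reasoning

avoids⇒punchIn : ∀ {N l} (x : Fin (suc N)) (v : Vec (Fin (suc N)) l) → avoids x (toList v) ≡ true →
  ∃[ u ] toList v ≡ map (punchIn x) (toList {n = l} u)
avoids⇒punchIn x Vec.[]      _ = Vec.[] , ≡.refl
avoids⇒punchIn x (y Vec.∷ v) e with x FinP.≟ y
avoids⇒punchIn x (y Vec.∷ v) () | yes _
... | no x≢y with avoids⇒punchIn x v e
... | u , eq = (punchOut x≢y Vec.∷ u) , ≡.cong₂ _∷_ (≡.sym (FinP.punchIn-punchOut x≢y)) eq

∧-true : ∀ {a b} → a ∧ b ≡ true → a ≡ true × b ≡ true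
∧-true {true} {true} _ = ≡.refl , ≡.refl

-- Removing the head and undoing `punchIn` leaves a permutation of the smaller range. The lemma
-- serves both the inversions made by a head and the row contents of a determinant term.
total-permutation : ∀ {N} (g : Fin N → ℕ) (v : Vec (Fin N) N) → distinct (toList v) ≡ true →
  total g (toList v) ≡ sumℕ g
total-permutation {zero}  g Vec.[]      _ = ≡.refl
total-permutation {suc N} g (x Vec.∷ v) d with ∧-true d
... | av , dv with avoids⇒punchIn x v av
... | u , eq = begin
  g x ℕ.+ total g (toList v)                  ≡⟨ ≡.cong (λ t → g x ℕ.+ total g t) eq ⟩
  g x ℕ.+ total g (map (punchIn x) (toList u)) ≡⟨ ≡.cong (g x ℕ.+_) (total-map g (punchIn x) (toList u)) ⟩
  g x ℕ.+ total (g ∘ punchIn x) (toList u)    ≡⟨ ≡.cong (g x ℕ.+_) (total-permutation (g ∘ punchIn x) u du) ⟩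
  g x ℕ.+ sumℕ (g ∘ punchIn x)                ≡⟨ sumℕ-remove {i = x} g ⟨
  sumℕ g                                      ∎
  where
  open ≡.≡-Reasoning
  du : distinct (toList u) ≡ true
  du = ≡.trans (≡.sym (distinct-punchIn x (toList u))) (≡.subst (λ t → distinct t ≡ true) eq dv)

sumℕ-0 : ∀ {N} {f : Fin N → ℕ} → (∀ i → f i ≡ 0) → sumℕ f ≡ 0
sumℕ-0 {zero}  e = ≡.refl
sumℕ-0 {suc N} e = ≡.cong₂ ℕ._+_ (e zero) (sumℕ-0 (e ∘ suc))

sumℕ-below : ∀ {N} (x : Fin (suc N)) → sumℕ (below x ∘ punchIn x) ≡ toℕ x
sumℕ-below {N} zero        = sumℕ-0 {N} (λ _ → ≡.refl)
sumℕ-below {suc N} (suc x) = ≡.cong suc (sumℕ-below x)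

-- Among the remaining entries of a permutation exactly `toℕ x` are smaller than its head `x`. This
-- is the origin of the Laplace sign.
inv-extend : ∀ {N} (x : Fin (suc N)) (v : Vec (Fin N) N) → distinct (toList v) ≡ true →
  inv (x ∷ map (punchIn x) (toList v)) ≡ toℕ x ℕ.+ inv (toList v)
inv-extend x v d = ≡.trans (inv-∷ x (map (punchIn x) (toList v))) (≡.cong₂ ℕ._+_ (≡.trans (total-map (below x) (punchIn x) (toList v))
  (≡.trans (total-permutation (below x ∘ punchIn x) v d) (sumℕ-below x))) (inv-punchIn x (toList v)))

toList-map : ∀ {A B : Set} {l} (f : A → B) (v : Vec A l) → toList (Vec.map f v) ≡ map f (toList v)
toList-map f Vec.[]      = ≡.refl
toList-map f (x Vec.∷ v) = ≡.cong (f x ∷_) (toList-map f v)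

module PermutationSum {c ℓ} (R : Ring c ℓ) where
  open Ring R hiding (zero)
  open import Algebra.Properties.Ring R using (-0#≈0#; -‿+-comm; -‿distribʳ-*)
  open import Algebra.Properties.Semiring.Sum semiring using (sum; sum-cong-≋; sum-remove)
  open import Relation.Binary.Reasoning.Setoid setoid
  open Determinant R

  lsum : ∀ {a} {A : Set a} → List A → (A → Carrier) → Carrier
  lsum xs f = List.foldr _+_ 0# (map f xs)

  lsum-cong : ∀ {a} {A : Set a} (xs : List A) {f g : A → Carrier} → (∀ x → f x ≈ g x) → lsum xs f ≈ lsum xs g
  lsum-cong []       e = refl
  lsum-cong (x ∷ xs) e = +-cong (e x) (lsum-cong xs e)

  lsum-++ : ∀ {a} {A : Set a} (xs ys : List A) (f : A → Carrier) → lsum (xs ++ ys) f ≈ lsum xs f + lsum ys f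
  lsum-++ []       ys f = sym (+-identityˡ _)
  lsum-++ (x ∷ xs) ys f = trans (+-congˡ (lsum-++ xs ys f)) (sym (+-assoc _ _ _))

  lsum-concatMap : ∀ {a b} {A : Set a} {B : Set b} (g : A → List B) xs (f : B → Carrier) →
    lsum (concatMap g xs) f ≈ lsum xs (λ x → lsum (g x) f)
  lsum-concatMap g []       f = refl
  lsum-concatMap g (x ∷ xs) f = trans (lsum-++ (g x) _ f) (+-congˡ (lsum-concatMap g xs f))

  lsum-map : ∀ {a b} {A : Set a} {B : Set b} (g : A → B) xs (f : B → Carrier) → lsum (map g xs) f ≡ lsum xs (f ∘ g)
  lsum-map g xs f = ≡.cong (List.foldr _+_ 0#) (≡.sym (ListP.map-∘ xs))

  lsum-filter : ∀ {a p} {A : Set a} {P : A → Set p} (P? : Decidable P) xs (f : A → Carrier) →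
    lsum (filter P? xs) f ≈ lsum xs (λ x → if does (P? x) then f x else 0#)
  lsum-filter P? []       f = refl
  lsum-filter P? (x ∷ xs) f with does (P? x)
  ... | true  = +-congˡ (lsum-filter P? xs f)
  ... | false = trans (lsum-filter P? xs f) (sym (+-identityˡ _))

  lsum-0 : ∀ {a} {A : Set a} (xs : List A) → lsum xs (λ _ → 0#) ≈ 0#
  lsum-0 []       = refl
  lsum-0 (x ∷ xs) = trans (+-identityˡ _) (lsum-0 xs)

  lsum-*ˡ : ∀ {a} {A : Set a} y (xs : List A) f → y * lsum xs f ≈ lsum xs (λ x → y * f x)
  lsum-*ˡ y []       f = zeroʳ y
  lsum-*ˡ y (x ∷ xs) f = trans (distribˡ _ _ _) (+-congˡ (lsum-*ˡ y xs f))

  lsum-neg : ∀ {a} {A : Set a} (xs : List A) f → lsum xs (λ x → - f x) ≈ - lsum xs f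
  lsum-neg []       f = sym -0#≈0#
  lsum-neg (x ∷ xs) f = trans (+-congˡ (lsum-neg xs f)) (-‿+-comm _ _)

  lsum-tabulate : ∀ {a} {A : Set a} {N} (g : Fin N → A) (f : A → Carrier) → lsum (List.tabulate g) f ≈ sum (f ∘ g)
  lsum-tabulate {N = zero}  g f = refl
  lsum-tabulate {N = suc N} g f = +-congˡ (lsum-tabulate (g ∘ suc) f)

  vectors : (N l : ℕ) → List (Vec (Fin N) l)
  vectors N l = allVecsOf (allFin N) l

  lsum-vectors : ∀ N l (f : Vec (Fin N) (suc l) → Carrier) →
    lsum (vectors N (suc l)) f ≈ sum (λ x → lsum (vectors N l) (λ v → f (x Vec.∷ v)))
  lsum-vectors N l f = begin
    lsum (vectors N (suc l)) f
      ≈⟨ lsum-concatMap (λ x → map (x Vec.∷_) (vectors N l)) (allFin N) f ⟩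
    lsum (allFin N) (λ x → lsum (map (x Vec.∷_) (vectors N l)) f)
      ≈⟨ lsum-tabulate id (λ x → lsum (map (x Vec.∷_) (vectors N l)) f) ⟩
    sum (λ x → lsum (map (x Vec.∷_) (vectors N l)) f)
      ≈⟨ sum-cong-≋ (λ x → reflexive (lsum-map (x Vec.∷_) (vectors N l) f)) ⟩
    sum (λ x → lsum (vectors N l) (λ v → f (x Vec.∷ v))) ∎

  when : Bool → Carrier → Carrier
  when b x = if b then x else 0#

  when-cong : ∀ b {x y} → (b ≡ true → x ≈ y) → when b x ≈ when b y
  when-cong true  e = e ≡.refl
  when-cong false e = refl

  when-∧ : ∀ a b x → when (a ∧ b) x ≡ when a (when b x)
  when-∧ true  b x = ≡.refl
  when-∧ false b x = ≡.refl

  sum-avoiding : ∀ {N} (x : Fin (suc N)) (f : Fin (suc N) → Carrier) →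
    sum (λ y → when (not (does (x FinP.≟ y))) (f y)) ≈ sum (f ∘ punchIn x)
  sum-avoiding {N} x f = begin
    sum g
      ≈⟨ sum-remove {i = x} g ⟩
    g x + sum (g ∘ punchIn x)
      ≈⟨ +-cong (reflexive (≡.cong (λ b → when (not b) (f x)) (dec-true (x FinP.≟ x) ≡.refl)))
           (sum-cong-≋ (λ z → reflexive (≡.cong (λ b → when (not b) (f (punchIn x z)))
             (dec-false (x FinP.≟ punchIn x z) (FinP.punchInᵢ≢i x z ∘ ≡.sym))))) ⟩
    0# + sum (f ∘ punchIn x)
      ≈⟨ +-identityˡ _ ⟩
    sum (f ∘ punchIn x) ∎
    where
    g : Fin (suc N) → Carrier
    g y = when (not (does (x FinP.≟ y))) (f y)

  -- Vectors that avoid `x` are the `punchIn x` images of vectors over the smaller range; the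
  -- entries are reindexed one at a time.
  lsum-avoiding : ∀ {N} l (x : Fin (suc N)) (f : Vec (Fin (suc N)) l → Carrier) →
    lsum (vectors (suc N) l) (λ v → when (avoids x (toList v)) (f v)) ≈
    lsum (vectors N l) (λ v → f (Vec.map (punchIn x) v))
  lsum-avoiding zero x f = refl
  lsum-avoiding {N} (suc l) x f = begin
    lsum (vectors (suc N) (suc l)) (λ v → when (avoids x (toList v)) (f v))
      ≈⟨ lsum-vectors (suc N) l _ ⟩
    sum (λ y → lsum (vectors (suc N) l) (λ v → when (not (does (x FinP.≟ y)) ∧ avoids x (toList v)) (f (y Vec.∷ v))))
      ≈⟨ sum-cong-≋ (λ y → pull (not (does (x FinP.≟ y))) (λ v → f (y Vec.∷ v))) ⟩
    sum (λ y → when (not (does (x FinP.≟ y))) (lsum (vectors N l) (λ v → f (y Vec.∷ Vec.map (punchIn x) v))))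
      ≈⟨ sum-avoiding x (λ y → lsum (vectors N l) (λ v → f (y Vec.∷ Vec.map (punchIn x) v))) ⟩
    sum (λ z → lsum (vectors N l) (λ v → f (punchIn x z Vec.∷ Vec.map (punchIn x) v)))
      ≈⟨ lsum-vectors N l _ ⟨
    lsum (vectors N (suc l)) (λ v → f (Vec.map (punchIn x) v)) ∎
    where
    pull : ∀ b (h : Vec (Fin (suc N)) l → Carrier) →
      lsum (vectors (suc N) l) (λ v → when (b ∧ avoids x (toList v)) (h v)) ≈
      when b (lsum (vectors N l) (λ v → h (Vec.map (punchIn x) v)))
    pull true  h = lsum-avoiding l x h
    pull false h = lsum-0 (vectors (suc N) l)

  -- Iterated negation passes through noncommutative products directly, where a power of -1 would
  -- have to be moved past factors.
  sgn : ℕ → Carrier → Carrier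
  sgn zero    x = x
  sgn (suc e) x = - sgn e x

  sgn-cong : ∀ e {x y} → x ≈ y → sgn e x ≈ sgn e y
  sgn-cong zero    p = p
  sgn-cong (suc e) p = -‿cong (sgn-cong e p)

  sgn-0 : ∀ e → sgn e 0# ≈ 0#
  sgn-0 zero    = refl
  sgn-0 (suc e) = trans (-‿cong (sgn-0 e)) -0#≈0#

  sgn-+ : ∀ e e′ x → sgn (e ℕ.+ e′) x ≡ sgn e (sgn e′ x)
  sgn-+ zero    e′ x = ≡.refl
  sgn-+ (suc e) e′ x = ≡.cong -_ (sgn-+ e e′ x)

  sgn-*ˡ : ∀ e x y → x * sgn e y ≈ sgn e (x * y)
  sgn-*ˡ zero    x y = refl
  sgn-*ˡ (suc e) x y = trans (sym (-‿distribʳ-* _ _)) (-‿cong (sgn-*ˡ e x y))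

  sgn-lsum : ∀ {a} {A : Set a} e (xs : List A) f → sgn e (lsum xs f) ≈ lsum xs (λ x → sgn e (f x))
  sgn-lsum zero    xs f = refl
  sgn-lsum (suc e) xs f = trans (-‿cong (sgn-lsum e xs f)) (sym (lsum-neg xs _))

  sum-neg : ∀ {N} (f : Fin N → Carrier) → sum (λ i → - f i) ≈ - sum f
  sum-neg {zero}  f = sym -0#≈0#
  sum-neg {suc N} f = trans (+-congˡ (sum-neg (f ∘ suc))) (-‿+-comm _ _)

  alt-sgn : ∀ {N} (f : Fin N → Carrier) → sum (λ r → sgn (toℕ r) (f r)) ≈ alt f
  alt-sgn {zero}  f = refl
  alt-sgn {suc N} f = +-congˡ (trans (sum-neg (λ r → sgn (toℕ r) (f (suc r)))) (-‿cong (alt-sgn (f ∘ suc))))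

  prodF : ∀ {N} → (Fin N → Carrier) → Carrier
  prodF {zero}  F = 1#
  prodF {suc N} F = F zero * prodF (F ∘ suc)

  prodF-cong : ∀ {N} {F G : Fin N → Carrier} → (∀ i → F i ≈ G i) → prodF F ≈ prodF G
  prodF-cong {zero}  e = refl
  prodF-cong {suc N} e = *-cong (e zero) (prodF-cong (e ∘ suc))

  -- Grouping by the first entry gives the expansion along column 0: the first entry is the deleted
  -- row, the rest is a permutation of the rows of the minor, and `inv-extend` supplies the sign.
  lsum-distinct-det : ∀ {N} (M : Matrix N) →
    lsum (vectors N N) (λ v → when (distinct (toList v)) (sgn (inv (toList v)) (prodF (λ s → M (lookup v s) s)))) ≈ det M
  lsum-distinct-det {zero}  M = +-identityʳ _
  lsum-distinct-det {suc N} M = begin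
    lsum (vectors (suc N) (suc N)) _
      ≈⟨ lsum-vectors (suc N) N _ ⟩
    sum (λ x → lsum (vectors (suc N) N) (λ v → when (avoids x (toList v) ∧ distinct (toList v)) (t x v)))
      ≈⟨ sum-cong-≋ row ⟩
    sum (λ x → sgn (toℕ x) (M x zero * det (minor M x)))
      ≈⟨ alt-sgn (λ x → M x zero * det (minor M x)) ⟩
    det M ∎
    where
    t : Fin (suc N) → Vec (Fin (suc N)) N → Carrier
    t x v = sgn (inv (x ∷ toList v)) (M x zero * prodF (λ s → M (lookup v s) (suc s)))
    u : Fin (suc N) → Vec (Fin N) N → Carrier
    u x v = sgn (inv (toList v)) (prodF (λ s → minor M x (lookup v s) s))
    entry : ∀ x v → when (distinct (toList (Vec.map (punchIn x) v))) (t x (Vec.map (punchIn x) v)) ≈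
      sgn (toℕ x) (M x zero * when (distinct (toList v)) (u x v))
    entry x v = begin
      when (distinct (toList (Vec.map (punchIn x) v))) (t x (Vec.map (punchIn x) v))
        ≈⟨ reflexive (≡.cong₂ when (≡.trans (≡.cong distinct (toList-map (punchIn x) v)) (distinct-punchIn x (toList v)))
             (≡.cong (λ z → sgn (inv (x ∷ z)) p) (toList-map (punchIn x) v))) ⟩
      when (distinct (toList v)) (sgn (inv (x ∷ map (punchIn x) (toList v)))
        (M x zero * prodF (λ s → M (lookup (Vec.map (punchIn x) v) s) (suc s))))
        ≈⟨ when-cong (distinct (toList v)) (λ d → trans (reflexive (≡.trans
             (≡.cong (λ z → sgn z p) (inv-extend x v d)) (sgn-+ (toℕ x) (inv (toList v)) p)))
             (sgn-cong (toℕ x) (trans (sgn-cong (inv (toList v)) (*-congˡ {M x zero} (prodF-cong (λ s →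
                 reflexive (≡.cong (λ z → M z (suc s)) (VecP.lookup-map s (punchIn x) v))))))
               (sym (sgn-*ˡ (inv (toList v)) (M x zero) _))))) ⟩
      when (distinct (toList v)) (sgn (toℕ x) (M x zero * u x v))
        ≈⟨ inside (distinct (toList v)) ⟩
      sgn (toℕ x) (M x zero * when (distinct (toList v)) (u x v)) ∎
      where
      import Data.Vec.Properties as VecP
      p = M x zero * prodF (λ s → M (lookup (Vec.map (punchIn x) v) s) (suc s))
      inside : ∀ b → when b (sgn (toℕ x) (M x zero * u x v)) ≈ sgn (toℕ x) (M x zero * when b (u x v))
      inside true  = refl
      inside false = sym (trans (sgn-cong (toℕ x) (zeroʳ _)) (sgn-0 (toℕ x)))
    row : ∀ x → lsum (vectors (suc N) N) (λ v → when (avoids x (toList v) ∧ distinct (toList v)) (t x v)) ≈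
      sgn (toℕ x) (M x zero * det (minor M x))
    row x = begin
      lsum (vectors (suc N) N) (λ v → when (avoids x (toList v) ∧ distinct (toList v)) (t x v))
        ≈⟨ lsum-cong (vectors (suc N) N) (λ v → reflexive (when-∧ (avoids x (toList v)) (distinct (toList v)) (t x v))) ⟩
      lsum (vectors (suc N) N) (λ v → when (avoids x (toList v)) (when (distinct (toList v)) (t x v)))
        ≈⟨ lsum-avoiding N x (λ v → when (distinct (toList v)) (t x v)) ⟩
      lsum (vectors N N) (λ v → when (distinct (toList (Vec.map (punchIn x) v))) (t x (Vec.map (punchIn x) v)))
        ≈⟨ lsum-cong (vectors N N) (entry x) ⟩
      lsum (vectors N N) (λ v → sgn (toℕ x) (M x zero * when (distinct (toList v)) (u x v)))
        ≈⟨ sgn-lsum (toℕ x) (vectors N N) (λ v → M x zero * when (distinct (toList v)) (u x v)) ⟨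
      sgn (toℕ x) (lsum (vectors N N) (λ v → M x zero * when (distinct (toList v)) (u x v)))
        ≈⟨ sgn-cong (toℕ x) (lsum-*ˡ (M x zero) (vectors N N) (λ v → when (distinct (toList v)) (u x v))) ⟨
      sgn (toℕ x) (M x zero * lsum (vectors N N) (λ v → when (distinct (toList v)) (u x v)))
        ≈⟨ sgn-cong (toℕ x) (*-congˡ (lsum-distinct-det (minor M x))) ⟩
      sgn (toℕ x) (M x zero * det (minor M x)) ∎

  leibniz : ∀ {N} → Matrix N → Carrier
  leibniz {N} M = lsum (perms N) (λ σ → sgn (inv (toList σ)) (prodF (λ s → M (lookup σ s) s)))

  leibniz-det : ∀ {N} (M : Matrix N) → leibniz M ≈ det M
  leibniz-det {N} M = begin
    leibniz M
      ≈⟨ lsum-filter (λ σ → UniqueDec.unique? FinP._≟_ (toList σ)) (vectors N N) f ⟩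
    lsum (vectors N N) (λ v → when (does (UniqueDec.unique? FinP._≟_ (toList v))) (f v))
      ≈⟨ lsum-cong (vectors N N) (λ v → reflexive (≡.cong (λ b → when b (f v)) (distinct-unique? (toList v)))) ⟩
    lsum (vectors N N) (λ v → when (distinct (toList v)) (f v))
      ≈⟨ lsum-distinct-det M ⟩
    det M ∎
    where
    f : Vec (Fin N) N → Carrier
    f σ = sgn (inv (toList σ)) (prodF (λ s → M (lookup σ s) s))

perms-distinct : ∀ N → All (λ σ → distinct (toList σ) ≡ true) (perms N)
perms-distinct N = All.map (λ {σ} u → ≡.trans (≡.sym (distinct-unique? (toList σ))) (dec-true (UniqueDec.unique? FinP._≟_ (toList σ)) u))
  (AllP.all-filter (λ σ → UniqueDec.unique? FinP._≟_ (toList σ)) (allVecsOf (allFin N) N))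

map-filter-map : ∀ {A B : Set} {c p} {C : Set c} {P : B → Set p} (P? : Decidable P) (f : B → C) (g : A → B) xs →
  map f (filter P? (map g xs)) ≡ map (f ∘ g) (filter (P? ∘ g) xs)
map-filter-map P? f g []       = ≡.refl
map-filter-map P? f g (x ∷ xs) with does (P? (g x))
... | true  = ≡.cong (f (g x) ∷_) (map-filter-map P? f g xs)
... | false = map-filter-map P? f g xs

pick : ∀ {N} → Bool → Vec Bool N → List (Fin N)
pick {N} b T = filter (λ s → lookup T s Bool.≟ b) (allFin N)

map-pick-∷ : ∀ {N a} {A : Set a} b b′ (T : Vec Bool N) (f : Fin (suc N) → A) →
  map f (pick b (b′ Vec.∷ T)) ≡
  (if does (b′ Bool.≟ b) then f zero ∷ map (f ∘ suc) (pick b T) else map (f ∘ suc) (pick b T))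
map-pick-∷ {N} b b′ T f with does (b′ Bool.≟ b)
... | true  = ≡.cong (f zero ∷_) tail
  where
  tail = ≡.trans (≡.cong (map f ∘ filter (λ s → lookup (b′ Vec.∷ T) s Bool.≟ b)) (≡.sym (ListP.map-tabulate id suc)))
    (map-filter-map (λ s → lookup (b′ Vec.∷ T) s Bool.≟ b) f suc (allFin N))
... | false = ≡.trans (≡.cong (map f ∘ filter (λ s → lookup (b′ Vec.∷ T) s Bool.≟ b)) (≡.sym (ListP.map-tabulate id suc)))
    (map-filter-map (λ s → lookup (b′ Vec.∷ T) s Bool.≟ b) f suc (allFin N))

-- Equality of multisets, tested on the functions `below x` and on their sums, is all that a
-- crossing number sees.
crossings-resp : ∀ {N} {us vs u₁ u₂ v₁ v₂ : List (Fin N)} →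
  (∀ g → total g us ≡ total g u₁ ℕ.+ total g u₂) → (∀ g → total g vs ≡ total g v₁ ℕ.+ total g v₂) →
  crossings us vs ≡ (crossings u₁ v₁ ℕ.+ crossings u₁ v₂) ℕ.+ (crossings u₂ v₁ ℕ.+ crossings u₂ v₂)
crossings-resp {us = us} {vs} {u₁} {u₂} {v₁} {v₂} eu ev =
  ≡.trans (eu _) (≡.cong₂ ℕ._+_ (split-right u₁) (split-right u₂))
  where
  split-right : ∀ xs → crossings xs vs ≡ crossings xs v₁ ℕ.+ crossings xs v₂
  split-right xs = ≡.trans (total-cong (λ x → ev (below x)) xs) (total-+ _ _ xs)

balance-cancel : ∀ ν γ α β α′ {C R} → C ≡ ν ℕ.+ γ → C ℕ.+ α ≡ R ℕ.+ β → α ℕ.+ γ ≡ β ℕ.+ α′ → R ≡ ν ℕ.+ α′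
balance-cancel ν γ α β α′ {C} {R} e₁ e₂ e₃ = ℕP.+-cancelʳ-≡ β _ _ (begin
  R ℕ.+ β             ≡⟨ e₂ ⟨
  C ℕ.+ α             ≡⟨ ≡.cong (ℕ._+ α) e₁ ⟩
  (ν ℕ.+ γ) ℕ.+ α     ≡⟨ solve 3 (λ x y z → (x :+ y) :+ z := x :+ (z :+ y)) ≡.refl ν γ α ⟩
  ν ℕ.+ (α ℕ.+ γ)     ≡⟨ ≡.cong (ν ℕ.+_) e₃ ⟩
  ν ℕ.+ (β ℕ.+ α′)    ≡⟨ solve 3 (λ x y z → x :+ (y :+ z) := (x :+ z) :+ y) ≡.refl ν β α′ ⟩
  (ν ℕ.+ α′) ℕ.+ β    ∎)
  where
  open ≡.≡-Reasoning
  open +-*-Solver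

-- Supports, label contents, and where the weight map is multiplicative

module Grading {c ℓ} (K : CommutativeRing c ℓ) (q qinv : CommutativeRing.Carrier K)
  (q-inv : CommutativeRing._≈_ K (CommutativeRing._*_ K q qinv) (CommutativeRing.1# K)) (n k : ℕ) where
  open Setup K q qinv n k
  open Quotient K q qinv n k
  open Twist K q qinv q-inv n k
  open CommutativeRing K hiding (zero)
  open import Algebra.Properties.Ring ring using (-0#≈0#; -1*x≈-x)
  open import Algebra.Solver.Ring.NaturalCoefficients.Default commutativeSemiring
    using (solve) renaming (_:=_ to infix 4 _⊜_; _:*_ to _⊗_)
  open import Relation.Binary.Reasoning.Setoid setoid
  private module S = Ring seriesRing
  open PermutationSum seriesRing

  -- A disjunction at every word takes the place of "nonzero implies `P`", as equality in `K` is not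
  -- assumed decidable.
  Supp : (Word → Set) → Series → Set ℓ
  Supp P f = ∀ u → f u ≈ 0# ⊎ P u

  supp-map : ∀ {P Q f} → (∀ u → P u → Q u) → Supp P f → Supp Q f
  supp-map i s u with s u
  ... | inj₁ z = inj₁ z
  ... | inj₂ p = inj₂ (i u p)

  supp-≐ : ∀ {P f g} → f ≐ g → Supp P f → Supp P g
  supp-≐ e s u with s u
  ... | inj₁ z = inj₁ (trans (sym (e u)) z)
  ... | inj₂ p = inj₂ p

  supp-+ : ∀ {P f g} → Supp P f → Supp P g → Supp P (f +S g)
  supp-+ s s′ u with s u | s′ u
  ... | inj₁ z | inj₁ z′ = inj₁ (trans (+-cong z z′) (+-identityˡ _))
  ... | inj₂ p | _       = inj₂ p
  ... | inj₁ _ | inj₂ p  = inj₂ p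

  supp-scale : ∀ {P f} (ω : Word → Carrier) → Supp P f → Supp P (λ w → ω w * f w)
  supp-scale ω s u with s u
  ... | inj₁ z = inj₁ (trans (*-congˡ z) (zeroʳ _))
  ... | inj₂ p = inj₂ p

  supp-neg : ∀ {P f} → Supp P f → Supp P (-S f)
  supp-neg s u with s u
  ... | inj₁ z = inj₁ (trans (-‿cong z) -0#≈0#)
  ... | inj₂ p = inj₂ p

  supp-sgn : ∀ {P f} e → Supp P f → Supp P (sgn e f)
  supp-sgn zero    s = s
  supp-sgn (suc e) s = supp-neg (supp-sgn e s)

  supp-lsum : ∀ {P} {A : Set} {xs : List A} {f : A → Series} → All (λ x → Supp P (f x)) xs → Supp P (lsum xs f)
  supp-lsum []       u = inj₁ refl
  supp-lsum (s ∷ ss) u = supp-+ s (supp-lsum ss) u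

  supp-one : ∀ {P} → P [] → Supp P oneS
  supp-one p []      = inj₂ p
  supp-one p (x ∷ w) = inj₁ refl

  supp-letter : ∀ {P} x → P [ x ] → Supp P (letter x)
  supp-letter {P} x p w with w ≟W [ x ]
  ... | yes e = inj₂ (≡.subst P (≡.sym e) p)
  ... | no _  = inj₁ refl

  supp-affine : ∀ {P} a e x → (a ≈ 0# ⊎ P []) → P [ x ] → Supp P (affine a e (letter x))
  supp-affine a e x (inj₁ z) p = supp-+ (λ w → inj₁ (trans (*-congʳ z) (zeroˡ _))) (supp-scale (λ _ → e) (supp-letter x p))
  supp-affine a e x (inj₂ p) p′ = supp-+ (supp-scale (λ _ → a) (supp-one p)) (supp-scale (λ _ → e) (supp-letter x p′))

  -- Inside `supp-leftInverse` the support of the inverse is known only at suffixes of the current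
  -- word; these are exactly the words at which a product evaluates its right factor.
  Suffixes : (Word → Set ℓ) → Word → Set ℓ
  Suffixes P []      = P []
  Suffixes P (x ∷ w) = P (x ∷ w) × Suffixes P w

  suffixes : ∀ {P : Word → Set ℓ} → (∀ w → P w) → ∀ w → Suffixes P w
  suffixes p []      = p []
  suffixes p (x ∷ w) = p (x ∷ w) , suffixes p w

  suffixes-self : ∀ {P : Word → Set ℓ} w → Suffixes P w → P w
  suffixes-self []      p = p
  suffixes-self (x ∷ w) p = proj₁ p

  supp-term : ∀ {P Q : Set} {x y} → x ≈ 0# ⊎ P → y ≈ 0# ⊎ Q → x * y ≈ 0# ⊎ (P × Q)
  supp-term (inj₁ z) _        = inj₁ (trans (*-congʳ z) (zeroˡ _))
  supp-term (inj₂ _) (inj₁ z) = inj₁ (trans (*-congˡ z) (zeroʳ _))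
  supp-term (inj₂ p) (inj₂ r) = inj₂ (p , r)

  supp-convolution : ∀ {P Q C : Word → Set} f g w → Supp P f → Suffixes (λ v → g v ≈ 0# ⊎ Q v) w →
    (∀ u v → P u → Q v → C (u ++ v)) → (f *S g) w ≈ 0# ⊎ C w
  supp-convolution f g [] s t comb with supp-term (s []) t
  ... | inj₁ z       = inj₁ (trans (*S-[] f g) z)
  ... | inj₂ (p , r) = inj₂ (comb [] [] p r)
  supp-convolution f g (x ∷ w) s (t , ts) comb with supp-term (s []) t
     | supp-convolution (∂ x f) g w (λ u → s (x ∷ u)) ts (λ u v → comb (x ∷ u) v)
  ... | inj₁ z       | inj₁ z′ = inj₁ (trans (*S-∷ f g x w) (trans (+-cong z z′) (+-identityˡ _)))
  ... | inj₂ (p , r) | _       = inj₂ (comb [] (x ∷ w) p r)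
  ... | inj₁ _       | inj₂ h  = inj₂ h

  supp-* : ∀ {P Q C} {f g} → (∀ u v → P u → Q v → C (u ++ v)) → Supp P f → Supp Q g → Supp C (f *S g)
  supp-* {f = f} {g} comb s t w = supp-convolution f g w s (suffixes t w) comb

  -- At a nonempty word the coefficient of `f *S g` is 0. Since `g []` inverts `f []`, this
  -- expresses `g (x ∷ w)` through values of `g` at suffixes of `w`, and the support condition
  -- propagates by recursion.
  supp-leftInverse : ∀ {P : Word → Set} {f g} → P [] → (∀ u v → P u → P v → P (u ++ v)) →
    (f *S g) ≐ oneS → (g *S f) ≐ oneS → Supp P f → Supp P g
  supp-leftInverse {P} {f} {g} p[] comb fg gf s w = suffixes-self w (go w)
    where
    go : ∀ w → Suffixes (λ v → g v ≈ 0# ⊎ P v) w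
    go []      = inj₂ p[]
    go (x ∷ w) = head , go w
      where
      isolate : g (x ∷ w) ≈ g [] * - (∂ x f *S g) w
      isolate = begin
        g (x ∷ w)                          ≈⟨ *-identityˡ _ ⟨
        1# * g (x ∷ w)                     ≈⟨ *-congʳ (trans (sym (*S-[] g f)) (gf [])) ⟨
        (g [] * f []) * g (x ∷ w)          ≈⟨ *-assoc _ _ _ ⟩
        g [] * (f [] * g (x ∷ w))          ≈⟨ *-congˡ (GP.inverseˡ-unique _ _ (trans (sym (*S-∷ f g x w)) (fg (x ∷ w)))) ⟩
        g [] * - (∂ x f *S g) w            ∎
        where module GP where open import Algebra.Properties.Group +-group public
      head : g (x ∷ w) ≈ 0# ⊎ P (x ∷ w)
      head with supp-convolution (∂ x f) g w (λ u → s (x ∷ u)) (go w) (λ u v → comb (x ∷ u) v)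
      ... | inj₂ p = inj₂ p
      ... | inj₁ z = inj₁ (trans isolate (trans (*-congˡ (trans (-‿cong z) -0#≈0#)) (zeroʳ _)))

  Functional : Set
  Functional = (Fin m → ℕ) → ℕ

  -- The columns of u are ν together with γ, and cols u + α = rows u + β as multisets.
  -- Multisets of labels are represented by their sums of arbitrary functions.
  record Balance (P : Fin m → Set) (α β γ : Functional) (u : Word) : Set where
    constructor balance
    field
      core     : List (Fin m)
      core-all : All P core
      contents : ∀ g → total g (cols u) ≡ total g core ℕ.+ γ g ×
        total g (cols u) ℕ.+ α g ≡ total g (rows u) ℕ.+ β g

  balance-[] : ∀ {P α β γ} → (∀ g → α g ≡ β g) → (∀ g → γ g ≡ 0) → Balance P α β γ []
  balance-[] e z = balance [] [] λ g → ≡.sym (z g) , e g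

  balance-++ : ∀ {P α β γ α′ β′ γ′} u v → Balance P α β γ u → Balance P α′ β′ γ′ v →
    Balance P (λ g → α g ℕ.+ α′ g) (λ g → β g ℕ.+ β′ g) (λ g → γ g ℕ.+ γ′ g) (u ++ v)
  balance-++ {α = α} {β} {γ} {α′} {β′} {γ′} u v (balance ν p e) (balance ν′ p′ e′) = balance (ν ++ ν′) (AllP.++⁺ p p′) λ g →
    ≡.trans (sides proj₂ g) (≡.trans (≡.cong₂ ℕ._+_ (proj₁ (e g)) (proj₁ (e′ g)))
      (≡.trans (interchange (total g ν) (γ g) (total g ν′) (γ′ g)) (≡.cong (ℕ._+ (γ g ℕ.+ γ′ g)) (≡.sym (total-++ g ν ν′))))) ,
    ≡.trans (≡.cong (ℕ._+ (α g ℕ.+ α′ g)) (sides proj₂ g))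
      (≡.trans (interchange (total g (cols u)) (total g (cols v)) (α g) (α′ g))
      (≡.trans (≡.cong₂ ℕ._+_ (proj₂ (e g)) (proj₂ (e′ g)))
      (≡.trans (interchange (total g (rows u)) (β g) (total g (rows v)) (β′ g))
      (≡.cong (ℕ._+ (β g ℕ.+ β′ g)) (≡.sym (sides proj₁ g))))))
    where
    sides : ∀ (f : Letter → Fin m) g → total g (map f (u ++ v)) ≡ total g (map f u) ℕ.+ total g (map f v)
    sides f g = ≡.trans (≡.cong (total g) (ListP.map-++ f u v)) (total-++ g (map f u) (map f v))

  balance-prodF : ∀ {P N} {α β γ : Fin N → Functional} {F : Fin N → Series} →
    (∀ s → Supp (Balance P (α s) (β s) (γ s)) (F s)) →
    Supp (Balance P (λ g → sumℕ (λ s → α s g)) (λ g → sumℕ (λ s → β s g)) (λ g → sumℕ (λ s → γ s g))) (prodF F)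
  balance-prodF {N = zero}  h = supp-one (balance-[] (λ _ → ≡.refl) (λ _ → ≡.refl))
  balance-prodF {N = suc N} h = supp-* balance-++ (h zero) (balance-prodF (h ∘ suc))

  -- The grading: rows and columns of `u` share a core with labels in `P` and differ only by the end
  -- labels `α` and `β`. For a path from i to j the core consists of the intermediate labels.
  -- Multisets are encoded as in `Balance`.
  record Shape (P : Fin m → Set) (α β : List (Fin m)) (u : Word) : Set where
    constructor shape
    field
      core     : List (Fin m)
      core-all : All P core
      contents : ∀ g → total g (cols u) ≡ total g core ℕ.+ total g β ×
        total g (rows u) ≡ total g core ℕ.+ total g α

  shape-[] : ∀ {P} → Shape P [] [] []
  shape-[] = shape [] [] λ g → ≡.refl , ≡.refl

  shape-letter : ∀ {P} x → Shape P [ proj₁ x ] [ proj₂ x ] [ x ]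
  shape-letter x = shape [] [] λ g → ≡.refl , ≡.refl

  shape-++ : ∀ {P α β α′ β′} u v → Shape P α β u → Shape P α′ β′ v → Shape P (α ++ α′) (β ++ β′) (u ++ v)
  shape-++ {α = α} {β} {α′} {β′} u v (shape ν p e) (shape ν′ p′ e′) = shape (ν ++ ν′) (AllP.++⁺ p p′) λ g →
    side proj₂ g β β′ (proj₁ (e g)) (proj₁ (e′ g)) , side proj₁ g α α′ (proj₂ (e g)) (proj₂ (e′ g))
    where
    side : ∀ (f : Letter → Fin m) g (γ γ′ : List (Fin m)) → total g (map f u) ≡ total g ν ℕ.+ total g γ →
      total g (map f v) ≡ total g ν′ ℕ.+ total g γ′ →
      total g (map f (u ++ v)) ≡ total g (ν ++ ν′) ℕ.+ total g (γ ++ γ′)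
    side f g γ γ′ e e′ = ≡.trans (≡.cong (total g) (ListP.map-++ f u v)) (≡.trans (total-++ g (map f u) (map f v))
      (≡.trans (≡.cong₂ ℕ._+_ e e′) (≡.trans (interchange (total g ν) (total g γ) (total g ν′) (total g γ′))
      (≡.sym (≡.cong₂ ℕ._+_ (total-++ g ν ν′) (total-++ g γ γ′))))))

  -- A single matrix entry has no fixed shape, as its row depends on the permutation. `Balance`
  -- records the labels of its position; over a whole determinant term they add up to the same total
  -- for every permutation and can be replaced by fixed end labels.
  balance⇒shape : ∀ {P α β γ} (α′ γ′ : List (Fin m)) → (∀ g → γ g ≡ total g γ′) →
    (∀ g → α g ℕ.+ total g γ′ ≡ β g ℕ.+ total g α′) → ∀ u → Balance P α β γ u → Shape P α′ γ′ u
  balance⇒shape {α = α} {β} {γ} α′ γ′ eγ e u (balance ν p b) = shape ν p λ g → columns g ,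
    balance-cancel (total g ν) (total g γ′) (α g) (β g) (total g α′) (columns g) (proj₂ (b g)) (e g)
    where
    columns : ∀ g → total g (cols u) ≡ total g ν ℕ.+ total g γ′
    columns g = ≡.trans (proj₁ (b g)) (≡.cong (total g ν ℕ.+_) (eγ g))

  -- Crossings of core with core occur equally among rows and columns, and those of a core with end
  -- labels agree by hypothesis, so only end labels against end labels survive in the quotient.
  crossings-shape : ∀ {P P′ α β α′ β′ u v} (s : Shape P α β u) (s′ : Shape P′ α′ β′ v) →
    crossings (Shape.core s) β′ ≡ crossings (Shape.core s) α′ → crossings β (Shape.core s′) ≡ crossings α (Shape.core s′) →
    q^ (crossings (cols u) (cols v)) (crossings (rows u) (rows v)) ≈ q^ (crossings β β′) (crossings α α′)
  crossings-shape {α = α} {β} {α′} {β′} {u} {v} (shape ν p e) (shape ν′ p′ e′) h h′ = q^-≡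
    (crossings (cols u) (cols v)) (crossings (rows u) (rows v)) (crossings β β′) (crossings α α′) (≡.trans
    (≡.cong (ℕ._+ crossings α α′) (crossings-resp {us = cols u} {cols v} {ν} {β} {ν′} {β′} (proj₁ ∘ e) (proj₁ ∘ e′)))
    (≡.trans (≡.cong₂ (λ x y → ((crossings ν ν′ ℕ.+ x) ℕ.+ (y ℕ.+ crossings β β′)) ℕ.+ crossings α α′) h h′)
    (≡.trans (NS.solve 5 (λ a b c d e → ((a NS.:+ b) NS.:+ (c NS.:+ d)) NS.:+ e NS.:= d NS.:+ ((a NS.:+ b) NS.:+ (c NS.:+ e)))
      ≡.refl (crossings ν ν′) (crossings ν α′) (crossings α ν′) (crossings β β′) (crossings α α′))
    (≡.cong (crossings β β′ ℕ.+_) (≡.sym (crossings-resp {us = rows u} {rows v} {ν} {α} {ν′} {α′} (proj₂ ∘ e) (proj₂ ∘ e′)))))))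
    where module NS = +-*-Solver

  -- Three independent weights allow the induction: after peeling off `x`, the weights of the
  -- product and of the left factor are shifted by `x` while the third is unchanged.
  convolution-scale : ∀ (ω ω₁ ω₂ : Word → Carrier) f g →
    (∀ u v → ω (u ++ v) * (f u * g v) ≈ (ω₁ u * f u) * (ω₂ v * g v)) →
    ∀ w → ω w * (f *S g) w ≈ ((λ u → ω₁ u * f u) *S (λ v → ω₂ v * g v)) w
  convolution-scale ω ω₁ ω₂ f g h [] = trans (*-congˡ (*S-[] f g)) (trans (h [] [])
    (sym (*S-[] (λ u → ω₁ u * f u) (λ v → ω₂ v * g v))))
  convolution-scale ω ω₁ ω₂ f g h (x ∷ w) = begin
    ω (x ∷ w) * (f *S g) (x ∷ w)
      ≈⟨ trans (*-congˡ (*S-∷ f g x w)) (distribˡ _ _ _) ⟩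
    ω (x ∷ w) * (f [] * g (x ∷ w)) + ω (x ∷ w) * (∂ x f *S g) w
      ≈⟨ +-cong (h [] (x ∷ w)) (convolution-scale (ω ∘ (x ∷_)) (ω₁ ∘ (x ∷_)) ω₂ (∂ x f) g (λ u v → h (x ∷ u) v) w) ⟩
    (ω₁ [] * f []) * (ω₂ (x ∷ w) * g (x ∷ w)) + ((λ u → ω₁ (x ∷ u) * f (x ∷ u)) *S (λ v → ω₂ v * g v)) w
      ≈⟨ *S-∷ (λ u → ω₁ u * f u) (λ v → ω₂ v * g v) x w ⟨
    ((λ u → ω₁ u * f u) *S (λ v → ω₂ v * g v)) (x ∷ w) ∎

  Φ-* : ∀ e f g {P Q : Word → Set} → Supp P f → Supp Q g →
    (∀ u v → P u → Q v → q^ (crossings (cols u) (cols v)) (crossings (rows u) (rows v)) ≈ e) →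
    Φ (f *S g) ≐ (e ·S (Φ f *S Φ g))
  Φ-* e f g s t h w = trans (convolution-scale wt (λ u → e * wt u) wt f g pointwise w)
    (trans (*S-cong {g = Φ g} (λ u → *-assoc e (wt u) (f u)) (λ _ → refl) w) (·S-*S e (Φ f) (Φ g) w))
    where
    pointwise : ∀ u v → wt (u ++ v) * (f u * g v) ≈ ((e * wt u) * f u) * (wt v * g v)
    pointwise u v with supp-term (s u) (t v)
    ... | inj₁ z = trans (trans (*-congˡ z) (zeroʳ _)) (sym (trans
          (solve 5 (λ e a x b y → ((e ⊗ a) ⊗ x) ⊗ (b ⊗ y) ⊜ ((e ⊗ a) ⊗ b) ⊗ (x ⊗ y)) refl e (wt u) (f u) (wt v) (g v))
          (trans (*-congˡ z) (zeroʳ _))))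
    ... | inj₂ (p , r) = trans (*-congʳ (trans (wt-++ u v) (*-congˡ (h u v p r))))
          (solve 5 (λ e a x b y → ((a ⊗ b) ⊗ e) ⊗ (x ⊗ y) ⊜ ((e ⊗ a) ⊗ x) ⊗ (b ⊗ y)) refl e (wt u) (f u) (wt v) (g v))

  -- Labels in `P` cannot distinguish labels in `Λ` by order, so replacing a row end label by a
  -- column end label does not change its crossings with a core.
  Indifferent : (Fin m → Set) → (Fin m → Set) → Set
  Indifferent P Λ = ∀ {p} → P p → ∀ {l l′} → Λ l → Λ l′ → below p l ≡ below p l′ × below l p ≡ below l′ p

  module _ {P Λ : Fin m → Set} (ind : Indifferent P Λ) {N} (r c : Fin N → Fin m)
    (Λr : ∀ s → Λ (r s)) (Λc : ∀ s → Λ (c s)) (F : Fin N → Series)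
    (F-shape : ∀ s → Supp (Shape P [ r s ] [ c s ]) (F s)) where

    shape-prodS : ∀ ss → Supp (Shape P (map r ss) (map c ss)) (prodS (map F ss))
    shape-prodS []       = supp-one shape-[]
    shape-prodS (s ∷ ss) = supp-* shape-++ (F-shape s) (shape-prodS ss)

    private
      indifferentˡ : ∀ ν → All P ν → ∀ ss → crossings ν (map c ss) ≡ crossings ν (map r ss)
      indifferentˡ []      []       ss = ≡.refl
      indifferentˡ (x ∷ ν) (p ∷ ps) ss = ≡.cong₂ ℕ._+_ (inner ss) (indifferentˡ ν ps ss)
        where
        inner : ∀ ss → total (below x) (map c ss) ≡ total (below x) (map r ss)
        inner []       = ≡.refl
        inner (s ∷ ss) = ≡.cong₂ ℕ._+_ (proj₁ (ind p (Λc s) (Λr s))) (inner ss)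

      indifferentʳ : ∀ s ν → All P ν → crossings [ c s ] ν ≡ crossings [ r s ] ν
      indifferentʳ s ν ps = ≡.cong (ℕ._+ 0) (inner ν ps)
        where
        inner : ∀ ν → All P ν → total (below (c s)) ν ≡ total (below (r s)) ν
        inner []      []       = ≡.refl
        inner (x ∷ ν) (p ∷ ps) = ≡.cong₂ ℕ._+_ (proj₂ (ind p (Λc s) (Λr s))) (inner ν ps)

    -- The scalar is the weight that `qdet` gives to the product when its factors are treated as
    -- letters; all other inversions are either inside one factor or cancel.
    Φ-prodS : ∀ ss → Φ (prodS (map F ss)) ≐ (q^ (inv (map c ss)) (inv (map r ss)) ·S prodS (map (Φ ∘ F) ss))
    Φ-prodS [] []      = refl
    Φ-prodS [] (x ∷ w) = trans (zeroʳ _) (sym (zeroʳ _))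
    Φ-prodS (s ∷ ss) w = begin
      Φ (F s *S prodS (map F ss)) w
        ≈⟨ Φ-* (q^ (crossings [ c s ] (map c ss)) (crossings [ r s ] (map r ss))) (F s) (prodS (map F ss))
             (F-shape s) (shape-prodS ss)
             (λ u v t t′ → crossings-shape {u = u} {v} t t′ (indifferentˡ (Shape.core t) (Shape.core-all t) ss)
               (indifferentʳ s (Shape.core t′) (Shape.core-all t′))) w ⟩
      e₁ * (Φ (F s) *S Φ (prodS (map F ss))) w
        ≈⟨ *-congˡ (trans (*S-cong {f = Φ (F s)} (λ _ → refl) (Φ-prodS ss) w) (*S-·S e₂ (Φ (F s)) (prodS (map (Φ ∘ F) ss)) w)) ⟩
      e₁ * (e₂ * prodS (map (Φ ∘ F) (s ∷ ss)) w)
        ≈⟨ *-assoc _ _ _ ⟨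
      (e₁ * e₂) * prodS (map (Φ ∘ F) (s ∷ ss)) w
        ≈⟨ *-congʳ (trans (sym (q^-+ (crossings [ c s ] (map c ss)) (crossings [ r s ] (map r ss)) (inv (map c ss)) (inv (map r ss))))
             (reflexive (≡.cong₂ q^ (exponent c) (exponent r)))) ⟩
      q^ (inv (map c (s ∷ ss))) (inv (map r (s ∷ ss))) * prodS (map (Φ ∘ F) (s ∷ ss)) w ∎
      where
      e₁ = q^ (crossings [ c s ] (map c ss)) (crossings [ r s ] (map r ss))
      e₂ = q^ (inv (map c ss)) (inv (map r ss))
      exponent : ∀ (f : Fin N → Fin m) → crossings [ f s ] (map f ss) ℕ.+ inv (map f ss) ≡ inv (map f (s ∷ ss))
      exponent f = ≡.trans (≡.cong (ℕ._+ inv (map f ss)) (ℕP.+-identityʳ _)) (≡.sym (inv-∷ (f s) (map f ss)))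

  qpow-q^ : ∀ a b → qpow ((+ a) ℤ.- (+ b)) ≈ q^ a b
  qpow-q^ a b = trans (reflexive (≡.cong qpow (ℤP.m-n≡m⊖n a b))) (go a b)
    where
    go : ∀ a b → qpow (a ℤ.⊖ b) ≈ q^ a b
    go a       zero    = trans (reflexive (≡.cong qpow (ℤP.⊖-≥ {a} {0} ℕ.z≤n))) (sym (*-identityʳ _))
    go zero    (suc b) = sym (*-identityˡ _)
    go (suc a) (suc b) = trans (reflexive (≡.cong qpow (ℤP.[1+m]⊖[1+n]≡m⊖n a b))) (trans (go a b)
      (q^-≡ a b (suc a) (suc b) (ℕP.+-suc a b)))

  -- Distributing a product of binomials: `T` marks the factors that contribute their letter rather
  -- than their constant.
  expand-subsets : ∀ {N} (a e : Fin N → Carrier) (F : Fin N → Series) →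
    lsum (subsets N) (λ T → (prodK (map a (pick false T)) * prodK (map e (pick true T))) ·S prodS (map F (pick true T)))
    ≐ prodF (λ s → affine (a s) (e s) (F s))
  expand-subsets {zero}  a e F w = trans (+-identityʳ _) (trans (*-congʳ (*-identityˡ _)) (*-identityˡ _))
  expand-subsets {suc N} a e F = S.trans
    (S.trans (lsum-++ (map (true Vec.∷_) (subsets N)) (map (false Vec.∷_) (subsets N) ++ []) t)
      (S.+-cong
        (S.trans (S.reflexive (lsum-map (true Vec.∷_) (subsets N) t)) (S.trans (lsum-cong (subsets N) with-letter)
          (S.sym (lsum-*ˡ (e zero ·S F zero) (subsets N) t′))))
        (S.trans (lsum-++ (map (false Vec.∷_) (subsets N)) [] t) (S.trans (S.+-identityʳ (lsum (map (false Vec.∷_) (subsets N)) t))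
          (S.trans (S.reflexive (lsum-map (false Vec.∷_) (subsets N) t)) (S.trans (lsum-cong (subsets N) without-letter)
            (S.sym (lsum-*ˡ (a zero ·S oneS) (subsets N) t′))))))))
    (S.trans (S.+-comm ((e zero ·S F zero) *S lsum (subsets N) t′) ((a zero ·S oneS) *S lsum (subsets N) t′))
      (S.trans (S.sym (*S-distribʳ (lsum (subsets N) t′) (a zero ·S oneS) (e zero ·S F zero)))
        (S.*-congˡ {affine (a zero) (e zero) (F zero)} (expand-subsets (a ∘ suc) (e ∘ suc) (F ∘ suc)))))
    where
    t : Vec Bool (suc N) → Series
    t T = (prodK (map a (pick false T)) * prodK (map e (pick true T))) ·S prodS (map F (pick true T))
    t′ : Vec Bool N → Series
    t′ T = (prodK (map (a ∘ suc) (pick false T)) * prodK (map (e ∘ suc) (pick true T))) ·S prodS (map (F ∘ suc) (pick true T))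
    with-letter : ∀ T → t (true Vec.∷ T) ≐ ((e zero ·S F zero) *S t′ T)
    with-letter T w = begin
      t (true Vec.∷ T) w
        ≈⟨ reflexive (≡.cong₂ _*_ (≡.cong₂ (λ x y → prodK x * prodK y) (map-pick-∷ false true T a) (map-pick-∷ true true T e))
             (≡.cong (λ z → prodS z w) (map-pick-∷ true true T F))) ⟩
      (A * (e zero * E)) * (F zero *S G) w
        ≈⟨ solve 4 (λ x y z v → (x ⊗ (y ⊗ z)) ⊗ v ⊜ (x ⊗ z) ⊗ (y ⊗ v)) refl A (e zero) E _ ⟩
      (A * E) * (e zero * (F zero *S G) w)
        ≈⟨ *-congˡ (·S-*S (e zero) (F zero) G w) ⟨
      (A * E) * ((e zero ·S F zero) *S G) w
        ≈⟨ *S-·S (A * E) (e zero ·S F zero) G w ⟨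
      ((e zero ·S F zero) *S t′ T) w ∎
      where
      A = prodK (map (a ∘ suc) (pick false T))
      E = prodK (map (e ∘ suc) (pick true T))
      G = prodS (map (F ∘ suc) (pick true T))
    without-letter : ∀ T → t (false Vec.∷ T) ≐ ((a zero ·S oneS) *S t′ T)
    without-letter T w = begin
      t (false Vec.∷ T) w
        ≈⟨ reflexive (≡.cong₂ _*_ (≡.cong₂ (λ x y → prodK x * prodK y) (map-pick-∷ false false T a) (map-pick-∷ true false T e))
             (≡.cong (λ z → prodS z w) (map-pick-∷ true false T F))) ⟩
      ((a zero * A) * E) * G w
        ≈⟨ solve 4 (λ x y z v → ((x ⊗ y) ⊗ z) ⊗ v ⊜ x ⊗ ((y ⊗ z) ⊗ v)) refl (a zero) A E (G w) ⟩
      a zero * t′ T w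
        ≈⟨ *-congˡ (*S-identityˡ (t′ T) w) ⟨
      a zero * (oneS *S t′ T) w
        ≈⟨ ·S-*S (a zero) oneS (t′ T) w ⟨
      ((a zero ·S oneS) *S t′ T) w ∎
      where
      A = prodK (map (a ∘ suc) (pick false T))
      E = prodK (map (e ∘ suc) (pick true T))
      G = prodS (map (F ∘ suc) (pick true T))

  powK-sgn : ∀ e f → (powK (- 1#) e ·S f) ≐ sgn e f
  powK-sgn zero    f w = *-identityˡ _
  powK-sgn (suc e) f w = trans (*-assoc _ _ _) (trans (-1*x≈-x _) (-‿cong (powK-sgn e f w)))

  Φ-lsum : ∀ {a} {A : Set a} (xs : List A) (f : A → Series) → Φ (lsum xs f) ≐ lsum xs (Φ ∘ f)
  Φ-lsum []       f w = zeroʳ _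
  Φ-lsum (x ∷ xs) f w = trans (distribˡ _ _ _) (+-congˡ (Φ-lsum xs f w))

  Φ-cong : ∀ {f g} → f ≐ g → Φ f ≐ Φ g
  Φ-cong e w = *-congˡ (e w)

  sumS-concatMap : ∀ {A : Set} (g : A → List Series) xs → sumS (concatMap g xs) ≐ lsum xs (sumS ∘ g)
  sumS-concatMap g []       w = refl
  sumS-concatMap g (x ∷ xs) w = trans (append (g x) w) (+-congˡ (sumS-concatMap g xs w))
    where
    append : ∀ ys → sumS (ys ++ concatMap g xs) ≐ (sumS ys +S sumS (concatMap g xs))
    append []       w = sym (+-identityˡ _)
    append (y ∷ ys) w = trans (+-congˡ (append ys w)) (sym (+-assoc _ _ _))

  -- The generality covers two cases: honest letters, with empty cores and arbitrary end labels, and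
  -- the entries `cq d i j`, whose words have inner cores and outer end labels.
  qdet-Φ : ∀ {P Λ} → Indifferent P Λ → ∀ N (ρ κ : Fin N → Fin m) (cst coef : Fin N → Fin N → Carrier)
    (L L¹ : Fin N → Fin N → Series) → (∀ r → Λ (ρ r)) → (∀ s → Λ (κ s)) →
    (∀ r s → Supp (Shape P [ ρ r ] [ κ s ]) (L¹ r s)) → (∀ r s → Φ (L¹ r s) ≐ L r s) →
    qdet N ρ κ cst coef L ≐ Φ (leibniz (λ r s → affine (cst r s) (coef r s) (L¹ r s)))
  qdet-Φ ind N ρ κ cst coef L L¹ Λρ Λκ L¹-shape ΦL = S.trans
    (sumS-concatMap _ (perms N))
    (S.trans (lsum-cong (perms N) (λ σ → S.trans (lsum-cong (subsets N) (term σ))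
        (S.trans (S.sym (Φ-lsum (subsets N) (λ T → sgn (inv (toList σ)) (mono σ T))))
          (Φ-cong (S.trans (S.sym (sgn-lsum (inv (toList σ)) (subsets N) (mono σ)))
            (sgn-cong (inv (toList σ)) (expand-subsets (cst′ σ) (coef′ σ) (F σ))))))))
      (S.sym (Φ-lsum (perms N) (λ σ → sgn (inv (toList σ)) (prodF (λ s → affine (cst′ σ s) (coef′ σ s) (F σ s)))))))
    where
    cst′ coef′ : Vec (Fin N) N → Fin N → Carrier
    cst′ σ s = cst (lookup σ s) s
    coef′ σ s = coef (lookup σ s) s
    F : Vec (Fin N) N → Fin N → Series
    F σ s = L¹ (lookup σ s) s
    mono : Vec (Fin N) N → Vec Bool N → Series
    mono σ T = (prodK (map (cst′ σ) (pick false T)) * prodK (map (coef′ σ) (pick true T))) ·S prodS (map (F σ) (pick true T))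
    prodS-ΦL : ∀ σ ss → prodS (map (Φ ∘ F σ) ss) ≐ prodS (map (λ s → L (lookup σ s) s) ss)
    prodS-ΦL σ []       w = refl
    prodS-ΦL σ (s ∷ ss) w = *S-cong (ΦL (lookup σ s) s) (prodS-ΦL σ ss) w
    term : ∀ σ T w →
      (powK (- 1#) (inv (toList σ)) * prodK (map (cst′ σ) (pick false T)) * prodK (map (coef′ σ) (pick true T))
        * qpow ((+ inv (map κ (pick true T))) ℤ.- (+ inv (map (λ s → ρ (lookup σ s)) (pick true T)))))
        * prodS (map (λ s → L (lookup σ s) s) (pick true T)) w
      ≈ Φ (sgn (inv (toList σ)) (mono σ T)) w
    term σ T w = begin
      (((p * A) * E) * qpow ((+ inv (map κ ss)) ℤ.- (+ inv (map (λ s → ρ (lookup σ s)) ss)))) * prodS (map (λ s → L (lookup σ s) s) ss) w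
        ≈⟨ *-cong (*-congˡ (qpow-q^ (inv (map κ ss)) (inv (map (λ s → ρ (lookup σ s)) ss)))) (sym (prodS-ΦL σ ss w)) ⟩
      (((p * A) * E) * Q) * prodS (map (Φ ∘ F σ) ss) w
        ≈⟨ *-assoc _ _ _ ⟩
      ((p * A) * E) * (Q * prodS (map (Φ ∘ F σ) ss) w)
        ≈⟨ *-congˡ (Φ-prodS ind (λ s → ρ (lookup σ s)) κ (λ s → Λρ (lookup σ s)) Λκ (F σ) (λ s → L¹-shape (lookup σ s) s) ss w) ⟨
      ((p * A) * E) * (wt w * prodS (map (F σ) ss) w)
        ≈⟨ solve 5 (λ p a e x y → ((p ⊗ a) ⊗ e) ⊗ (x ⊗ y) ⊜ x ⊗ (p ⊗ ((a ⊗ e) ⊗ y))) refl p A E (wt w) _ ⟩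
      wt w * (p * mono σ T w)
        ≈⟨ *-congˡ (powK-sgn (inv (toList σ)) (mono σ T) w) ⟩
      Φ (sgn (inv (toList σ)) (mono σ T)) w ∎
      where
      ss = pick true T
      p = powK (- 1#) (inv (toList σ))
      A = prodK (map (cst′ σ) (pick false T))
      E = prodK (map (coef′ σ) (pick true T))
      Q = q^ (inv (map κ ss)) (inv (map (λ s → ρ (lookup σ s)) ss))

-- Paths through inner labels and the Sylvester identity

sumℕ-lookup : ∀ {N l} (g : Fin N → ℕ) (v : Vec (Fin N) l) → sumℕ (λ s → g (lookup v s)) ≡ total g (toList v)
sumℕ-lookup g Vec.[]      = ≡.refl
sumℕ-lookup g (x Vec.∷ v) = ≡.cong (g x ℕ.+_) (sumℕ-lookup g v)

sumℕ-last : ∀ n (f : Fin (n ℕ.+ 1) → ℕ) → sumℕ f ≡ sumℕ (λ r → f (r ↑ˡ 1)) ℕ.+ f (n ↑ʳ zero)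
sumℕ-last zero    f = ℕP.+-identityʳ (f zero)
sumℕ-last (suc n) f = ≡.trans (≡.cong (f zero ℕ.+_) (sumℕ-last n (f ∘ suc))) (≡.sym (ℕP.+-assoc (f zero) _ _))

does-↑ˡ : ∀ {n} k (r s : Fin n) → does (r ↑ˡ k FinP.≟ s ↑ˡ k) ≡ does (r FinP.≟ s)
does-↑ˡ k r s with r FinP.≟ s
... | yes e = dec-true (r ↑ˡ k FinP.≟ s ↑ˡ k) (≡.cong (_↑ˡ k) e)
... | no ≢s = dec-false (r ↑ˡ k FinP.≟ s ↑ˡ k) (≢s ∘ FinP.↑ˡ-injective k r s)

does-↑ʳ : ∀ n {k} (i j : Fin k) → does (n ↑ʳ i FinP.≟ n ↑ʳ j) ≡ does (i FinP.≟ j)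
does-↑ʳ n i j with i FinP.≟ j
... | yes e = dec-true (n ↑ʳ i FinP.≟ n ↑ʳ j) (≡.cong (n ↑ʳ_) e)
... | no ≢j = dec-false (n ↑ʳ i FinP.≟ n ↑ʳ j) (≢j ∘ FinP.↑ʳ-injective n i j)

does-↑ˡ↑ʳ : ∀ {n k} (s : Fin n) (i : Fin k) → does (s ↑ˡ k FinP.≟ n ↑ʳ i) ≡ false
does-↑ˡ↑ʳ {n} {k} s i = dec-false (s ↑ˡ k FinP.≟ n ↑ʳ i) (↑ˡ≢↑ʳ s i)

does-↑ʳ↑ˡ : ∀ {n k} (s : Fin n) (i : Fin k) → does (n ↑ʳ i FinP.≟ s ↑ˡ k) ≡ false
does-↑ʳ↑ˡ {n} {k} s i = dec-false (n ↑ʳ i FinP.≟ s ↑ˡ k) (↑ˡ≢↑ʳ s i ∘ ≡.sym)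

module Sylvester {c ℓ} (K : CommutativeRing c ℓ) (q qinv : CommutativeRing.Carrier K)
  (q-inv : CommutativeRing._≈_ K (CommutativeRing._*_ K q qinv) (CommutativeRing.1# K)) (n k : ℕ) where
  open Setup K q qinv n k
  open Quotient K q qinv n k
  open Twist K q qinv q-inv n k
  open Grading K q qinv q-inv n k
  open CommutativeRing K hiding (zero)
  open import Algebra.Properties.Ring ring using (-0#≈0#; -‿distribʳ-*; -1*x≈-x; -‿+-comm)
  open import Algebra.Solver.Ring.NaturalCoefficients.Default commutativeSemiring
    using (solve) renaming (_:=_ to infix 4 _⊜_; _:+_ to _⊕_)
  open import Relation.Binary.Reasoning.Setoid setoid
  private
    module S = Ring seriesRing
    module Q = Ring quotientRing
    module DS = Determinant seriesRing
    module DQ = Determinant quotientRing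
  open PermutationSum seriesRing using (leibniz; leibniz-det)
  open import Algebra.Properties.Semiring.Sum S.semiring using (sum; sum-cong-≋; ∑-distrib-+)
  open import Algebra.Properties.Semiring.Sum semiring
    using () renaming (sum to sumF; sum-cong-≋ to sumF-cong)

  -- path x j sums the words x → s₁ → ⋯ → s_p → j with all intermediate labels s_i ≤ n.
  path   : Fin m → Fin k → Series
  extend : Fin n ⊎ Fin k → Fin k → Series
  path x j []            = 0#
  path x j ((r , t) ∷ w) = if does (r FinP.≟ x) then extend (splitAt n t) j w else 0#
  extend (inj₁ s) j w = path (inl s) j w
  extend (inj₂ i) j w = if does (i FinP.≟ j) then oneS w else 0#

  -- A word determines its path. The column of its first letter decides whether the path must stop
  -- there or continues from an inner label, and `splitAt` separates these cases.
  path-step : ∀ x j → path x j ≐ (a x (inr j) +S sum (λ s → a x (inl s) *S path (inl s) j))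
  path-step x j w = trans (via-◂ w) (sym (+-cong (letter-◂ (x , inr j) w)
    (trans (sum-eval (λ s → a x (inl s) *S path (inl s) j) w) (sumF-cong (λ s → letter-*S (x , inl s) (path (inl s) j) w)))))
    where
    via-◂ : ∀ w → path x j w ≈ ((x , inr j) ◂ oneS) w + sumF (λ s → ((x , inl s) ◂ path (inl s) j) w)
    via-◂ [] = sym (trans (+-identityˡ _) (sumF-0 {n} (λ _ → refl)))
    via-◂ ((r , t) ∷ w) = trans after (sym (+-cong (reflexive (◂-does x (inr j) r t oneS w))
      (sumF-cong (λ s → reflexive (◂-does x (inl s) r t (path (inl s) j) w)))))
      where
      cases : ∀ {t} → Split n k t → extend (splitAt n t) j w ≈
        (if does (t FinP.≟ inr j) then oneS w else 0#) +
        sumF (λ s → if does (t FinP.≟ inl s) then path (inl s) j w else 0#)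
      cases (left s₀) = sym (begin
        (if does (inl s₀ FinP.≟ inr j) then oneS w else 0#) +
        sumF (λ s → if does (inl s₀ FinP.≟ inl s) then path (inl s) j w else 0#)
          ≈⟨ +-cong (reflexive (≡.cong (λ b → if b then oneS w else 0#) (does-↑ˡ↑ʳ s₀ j)))
               (sumF-cong (λ s → reflexive (≡.cong (λ b → if b then path (inl s) j w else 0#) (does-↑ˡ k s₀ s)))) ⟩
        0# + sumF (λ s → if does (s₀ FinP.≟ s) then path (inl s) j w else 0#)
          ≈⟨ trans (+-identityˡ _) (sumF-δ s₀ (λ s → path (inl s) j w)) ⟩
        path (inl s₀) j w
          ≈⟨ reflexive (≡.cong (λ z → extend z j w) (FinP.splitAt-↑ˡ n s₀ k)) ⟨
        extend (splitAt n (inl s₀)) j w ∎)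
      cases (right i) = sym (begin
        (if does (inr i FinP.≟ inr j) then oneS w else 0#) +
        sumF (λ s → if does (inr i FinP.≟ inl s) then path (inl s) j w else 0#)
          ≈⟨ +-cong (reflexive (≡.cong (λ b → if b then oneS w else 0#) (does-↑ʳ n i j)))
               (sumF-0 (λ s → reflexive (≡.cong (λ b → if b then path (inl s) j w else 0#) (does-↑ʳ↑ˡ s i)))) ⟩
        (if does (i FinP.≟ j) then oneS w else 0#) + 0#
          ≈⟨ +-identityʳ _ ⟩
        (if does (i FinP.≟ j) then oneS w else 0#)
          ≈⟨ reflexive (≡.cong (λ z → extend z j w) (FinP.splitAt-↑ʳ n k i)) ⟨
        extend (splitAt n (inr i)) j w ∎)
      after : (if does (r FinP.≟ x) then extend (splitAt n t) j w else 0#) ≈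
        (if does (r FinP.≟ x) then (if does (t FinP.≟ inr j) then oneS w else 0#) else 0#) +
        sumF (λ s → if does (r FinP.≟ x) then (if does (t FinP.≟ inl s) then path (inl s) j w else 0#) else 0#)
      after with does (r FinP.≟ x)
      ... | true  = cases (split n k t)
      ... | false = sym (trans (+-identityˡ _) (sumF-0 {n} (λ _ → refl)))

  affine-*S : ∀ c e L f → (affine c e L *S f) ≐ ((c ·S f) +S (e ·S (L *S f)))
  affine-*S c e L f = S.trans (*S-distribʳ f (c ·S oneS) (e ·S L))
    (λ w → +-cong (trans (·S-*S c oneS f w) (*-congˡ (*S-identityˡ f w))) (·S-*S e L f w))

  sum-neg : ∀ {N} (F : Fin N → Series) → sum (λ s → (- 1#) ·S F s) ≐ (-S sum F)
  sum-neg {zero}  F w = sym -0#≈0#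
  sum-neg {suc N} F w = trans (+-cong (-1*x≈-x _) (sum-neg (F ∘ suc) w)) (-‿+-comm _ _)

  -- A row of (1 - A) multiplied by the column with entries path s j (s ≤ n) and 1 at j.
  row-times-paths : ∀ x j c (δs : Fin n → Carrier) →
    (affine c (- 1#) (a x (inr j)) +S sum (λ s → affine (δs s) (- 1#) (a x (inl s)) *S path (inl s) j)) ≐
    (((c ·S oneS) +S sum (λ s → δs s ·S path (inl s) j)) -S path x j)
  row-times-paths x j c δs w = begin
    (c * oneS w + - 1# * a x (inr j) w) + sum (λ s → affine (δs s) (- 1#) (a x (inl s)) *S path (inl s) j) w
      ≈⟨ +-cong (+-congˡ (-1*x≈-x _)) (S.trans (sum-cong-≋ (λ s → affine-*S (δs s) (- 1#) (a x (inl s)) (path (inl s) j)))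
           (S.trans (∑-distrib-+ (λ s → δs s ·S path (inl s) j) (λ s → (- 1#) ·S (a x (inl s) *S path (inl s) j)))
             (S.+-congˡ {sum (λ s → δs s ·S path (inl s) j)} (sum-neg (λ s → a x (inl s) *S path (inl s) j)))) w) ⟩
    (c * oneS w + - a x (inr j) w) + (U + - V)
      ≈⟨ solve 4 (λ p x u v → (p ⊕ x) ⊕ (u ⊕ v) ⊜ (p ⊕ u) ⊕ (x ⊕ v)) refl _ _ _ _ ⟩
    (c * oneS w + U) + (- a x (inr j) w + - V)
      ≈⟨ +-congˡ (trans (-‿+-comm _ _) (-‿cong (sym (path-step x j w)))) ⟩
    (c * oneS w + U) - path x j w ∎
    where
    U = sum (λ s → δs s ·S path (inl s) j) w
    V = sum (λ s → a x (inl s) *S path (inl s) j) w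

  -- The identity part of row `r` picks out `path (inl r) j`, which the remainder subtracts again.
  -- The constants are given up to `_≈_` so that both `δ` and `cstB` can be inserted.
  top-row : ∀ r j c (δs : Fin n → Carrier) → c ≈ 0# → (∀ s → δs s ≈ δ r s) →
    (affine c (- 1#) (a (inl r) (inr j)) +S sum (λ s → affine (δs s) (- 1#) (a (inl r) (inl s)) *S path (inl s) j)) ≐ zeroS
  top-row r j c δs c≈0 δs≈δ w = trans (row-times-paths (inl r) j c δs w) (trans
    (+-congʳ (trans (+-cong (trans (*-congʳ c≈0) (zeroˡ _))
      (trans (sum-eval (λ s → δs s ·S path (inl s) j) w)
        (trans (sumF-cong entry) (sumF-δ r (λ s → path (inl s) j w))))) (+-identityˡ _)))
    (-‿inverseʳ _))
    where
    entry : ∀ s → δs s * path (inl s) j w ≈ (if does (r FinP.≟ s) then path (inl s) j w else 0#)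
    entry s = trans (*-congʳ (δs≈δ s)) scale
      where
      scale : δ r s * path (inl s) j w ≈ (if does (r FinP.≟ s) then path (inl s) j w else 0#)
      scale with does (r FinP.≟ s)
      ... | true  = *-identityˡ _
      ... | false = zeroˡ _

  bottom-row : ∀ x j c (δs : Fin n → Carrier) → (∀ s → δs s ≈ 0#) →
    (affine c (- 1#) (a x (inr j)) +S sum (λ s → affine (δs s) (- 1#) (a x (inl s)) *S path (inl s) j)) ≐
    affine c (- 1#) (path x j)
  bottom-row x j c δs z w = trans (row-times-paths x j c δs w) (+-cong
    (trans (+-congˡ (trans (sum-eval (λ s → δs s ·S path (inl s) j) w) (sumF-0 (λ s → trans (*-congʳ (z s)) (zeroˡ _))))) (+-identityʳ _))
    (sym (-1*x≈-x _)))

  matrixA : DQ.Matrix m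
  matrixA r s = affine (δ r s) (- 1#) (a r s)

  matrixA₀ : DQ.Matrix n
  matrixA₀ r s = affine (δ r s) (- 1#) (a (inl r) (inl s))

  matrixB : Fin k → Fin k → DQ.Matrix (n ℕ.+ 1)
  matrixB i j x y = affine (cstB x y) (- 1#) (a (border i x) (border j y))

  matrixPaths : DQ.Matrix k
  matrixPaths i j = affine (δ i j) (- 1#) (path (inr i) j)

  affine-commute : ∀ {x x′} y y′ c e c′ e′ → x ≢ x′ → Commute (affine c e (a x y)) (affine c′ e′ (a x′ y′))
  affine-commute {x} {x′} y y′ c e c′ e′ x≢x′ =
    commute-affine {affine c e (a x y)} {a x′ y′} c′ e′
      (Q.sym {a x′ y′ *S affine c e (a x y)} {affine c e (a x y) *S a x′ y′}
        (commute-affine {a x′ y′} {a x y} c e (letters-commute y′ y (x≢x′ ∘ ≡.sym))))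

  if-cong : ∀ {b b′} → b ≡ b′ → (if b then 1# else 0#) ≈ (if b′ then 1# else 0#)
  if-cong e = reflexive (≡.cong (λ b → if b then 1# else 0#) e)

  affine-cong : ∀ {c c′ L L′} e → c ≈ c′ → L ≐ L′ → affine c e L ≐ affine c′ e L′
  affine-cong e ec eL w = +-cong (*-congʳ ec) (*-congˡ (eL w))

  det-A : DQ.det matrixA ≋ (DQ.det matrixA₀ *S DQ.det matrixPaths)
  det-A = Q.trans {DQ.det matrixA} (E.det-schur) (Q.*-cong
      (DQ.det-cong {M = λ r s → matrixA (inl r) (inl s)} {matrixA₀} (λ r s → ≐⇒≋
        (affine-cong (- 1#) (if-cong (does-↑ˡ k r s)) (λ _ → refl))))
      (DQ.det-cong {M = λ i j → matrixA (inr i) (inr j) +S sum (λ s → matrixA (inr i) (inl s) *S path (inl s) j)} {matrixPaths}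
        (λ i j → ≐⇒≋ (S.trans (bottom-row (inr i) j (δ (inr i) (inr j)) (λ s → δ (inr i) (inl s)) (λ s → if-cong (does-↑ʳ↑ˡ s i)))
          (affine-cong (- 1#) (if-cong (does-↑ʳ n i j)) (λ _ → refl))))))
    where
    module E = DQ.Elimination n k matrixA
      (λ r≢r′ s s′ → affine-commute s s′ _ _ _ _ r≢r′)
      (λ s j → path (inl s) j)
      (λ r j → ≐⇒≋ (top-row r j (δ (inl r) (inr j)) (λ s → δ (inl r) (inl s))
        (if-cong (does-↑ˡ↑ʳ r j)) (λ s → if-cong (does-↑ˡ k r s))))

  border-left : ∀ i r → border i (r ↑ˡ 1) ≡ inl r
  border-left i r rewrite FinP.splitAt-↑ˡ n r 1 = ≡.refl

  border-right : ∀ i z → border i (n ↑ʳ z) ≡ inr i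
  border-right i z rewrite FinP.splitAt-↑ʳ n 1 z = ≡.refl

  cstB-left : ∀ r s → cstB (r ↑ˡ 1) (s ↑ˡ 1) ≡ δ r s
  cstB-left r s rewrite FinP.splitAt-↑ˡ n r 1 | FinP.splitAt-↑ˡ n s 1 = ≡.refl

  cstB-row : ∀ z y → cstB (n ↑ʳ z) y ≡ 0#
  cstB-row z y rewrite FinP.splitAt-↑ʳ n 1 z = ≡.refl

  cstB-col : ∀ x z → cstB x (n ↑ʳ z) ≡ 0#
  cstB-col x z with splitAt n x
  ... | inj₂ _ = ≡.refl
  ... | inj₁ _ rewrite FinP.splitAt-↑ʳ n 1 z = ≡.refl

  border-injective : ∀ i {x x′} → border i x ≡ border i x′ → x ≡ x′
  border-injective i {x} {x′} e with split n 1 x | split n 1 x′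
  ... | left r  | left r′ = ≡.cong (_↑ˡ 1) (FinP.↑ˡ-injective k r r′
        (≡.trans (≡.sym (border-left i r)) (≡.trans e (border-left i r′))))
  ... | left r  | right z = contradiction (≡.trans (≡.sym (border-left i r)) (≡.trans e (border-right i z))) (↑ˡ≢↑ʳ r i)
  ... | right z | left r  = contradiction (≡.sym (≡.trans (≡.sym (border-right i z)) (≡.trans e (border-left i r)))) (↑ˡ≢↑ʳ r i)
  ... | right zero | right zero = ≡.refl

  -- The same elimination with an outer block of size one; `border i` is injective, so distinct rows
  -- of the bordered matrix carry distinct labels and their entries commute. The corner has constant
  -- term 0, hence becomes minus the path series.
  det-B : ∀ i j → DQ.det (matrixB i j) ≋ (DQ.det matrixA₀ *S (-S path (inr i) j))
  det-B i j = Q.trans {DQ.det (matrixB i j)} E.det-schur (Q.*-cong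
      (DQ.det-cong {M = λ r s → matrixB i j (r ↑ˡ 1) (s ↑ˡ 1)} {matrixA₀} (λ r s → ≐⇒≋
        (affine-cong (- 1#) (reflexive (cstB-left r s))
          (λ w → reflexive (≡.cong₂ (λ x y → a x y w) (border-left i r) (border-left j s))))))
      (Q.trans {DQ.det last} {last zero zero} (≐⇒≋ (S.trans (S.+-cong (*S-identityʳ (last zero zero)) (λ _ → -0#≈0#)) (S.+-identityʳ (last zero zero))))
        (≐⇒≋ (S.trans (S.+-cong (entry (n ↑ʳ zero) (inr i) (border-right i zero) _)
             (sum-cong-≋ (λ s → *S-cong {g = path (inl s) j} (entry′ (n ↑ʳ zero) (inr i) (border-right i zero) s) (λ _ → refl))))
          (S.trans (bottom-row (inr i) j (cstB (n ↑ʳ zero) (n ↑ʳ zero)) (λ s → cstB (n ↑ʳ zero) (s ↑ˡ 1))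
              (λ s → reflexive (cstB-row zero (s ↑ˡ 1))))
            (λ w → trans (+-cong (trans (*-congʳ (reflexive (cstB-row zero (n ↑ʳ zero)))) (zeroˡ _)) (-1*x≈-x _)) (+-identityˡ _)))))))
    where
    last : DQ.Matrix 1
    last x y = matrixB i j (n ↑ʳ x) (n ↑ʳ y) +S sum (λ s → matrixB i j (n ↑ʳ x) (s ↑ˡ 1) *S path (inl s) j)
    entry : ∀ x l → border i x ≡ l → ∀ z → matrixB i j x (n ↑ʳ z) ≐ affine (cstB x (n ↑ʳ z)) (- 1#) (a l (inr j))
    entry x l e z = affine-cong (- 1#) refl (λ w → reflexive (≡.cong₂ (λ x y → a x y w) e (border-right j z)))
    entry′ : ∀ x l → border i x ≡ l → ∀ s → matrixB i j x (s ↑ˡ 1) ≐ affine (cstB x (s ↑ˡ 1)) (- 1#) (a l (inl s))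
    entry′ x l e s = affine-cong (- 1#) refl (λ w → reflexive (≡.cong₂ (λ x y → a x y w) e (border-left j s)))
    module E = DQ.Elimination n 1 (matrixB i j)
      (λ r≢r′ s s′ → affine-commute (border j s) (border j s′) _ _ _ _ (r≢r′ ∘ border-injective i))
      (λ s _ → path (inl s) j)
      (λ r z → ≐⇒≋ (S.trans (S.+-cong (entry (r ↑ˡ 1) (inl r) (border-left i r) z)
          (sum-cong-≋ (λ s → *S-cong {g = path (inl s) j} (entry′ (r ↑ˡ 1) (inl r) (border-left i r) s) (λ _ → refl))))
        (top-row r j (cstB (r ↑ˡ 1) (n ↑ʳ z)) (λ s → cstB (r ↑ˡ 1) (s ↑ˡ 1))
          (reflexive (cstB-col (r ↑ˡ 1) z)) (λ s → reflexive (cstB-left r s)))))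

  alt-agree : ∀ {N} {f g : Fin N → Series} → (∀ i → f i ≐ g i) → DS.alt f ≐ DQ.alt g
  alt-agree {zero}  e w = refl
  alt-agree {suc N} e w = +-cong (e zero w) (-‿cong (alt-agree (e ∘ suc) w))

  -- The two instances of `det` use the same operations and differ in their equality. The exact one
  -- carries the supports and the Leibniz formula, the other the elimination.
  det-agree : ∀ {N} (M : DQ.Matrix N) → DS.det M ≐ DQ.det M
  det-agree {zero}  M w = refl
  det-agree {suc N} M = alt-agree (λ r → *S-cong {M r zero} (λ _ → refl) (det-agree (λ i j → M (punchIn r i) (suc j))))

  leibniz-≋ : ∀ {N} (M : DQ.Matrix N) → leibniz M ≋ DQ.det M
  leibniz-≋ M = ≐⇒≋ (S.trans (leibniz-det M) (det-agree M))

  -- Choosing a constant instead of a letter omits one row label and one column label; these agree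
  -- wherever the constant is nonzero, so the balance of labels is kept. `γ s` lists the column
  -- label `κ s` if it counts as an end label and is empty if it belongs to the core.
  supp-leibniz : ∀ {P N} (ρ κ : Fin N → Fin m) (cst coef : Fin N → Fin N → Carrier) (γ : Fin N → List (Fin m))
    (α′ γ′ : List (Fin m)) →
    (∀ s → (γ s ≡ [] × P (κ s)) ⊎ γ s ≡ [ κ s ]) →
    (∀ r s → cst r s ≈ 0# ⊎ (ρ r ≡ κ s × γ s ≡ [])) →
    (∀ g → sumℕ (λ s → total g (γ s)) ≡ total g γ′) →
    (∀ g → sumℕ (g ∘ ρ) ℕ.+ total g γ′ ≡ sumℕ (g ∘ κ) ℕ.+ total g α′) →
    Supp (Shape P α′ γ′) (leibniz (λ r s → affine (cst r s) (coef r s) (a (ρ r) (κ s))))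
  supp-leibniz {P} {N} ρ κ cst coef γ α′ γ′ hγ hcst sumγ sumρκ = supp-lsum (All.map (λ {σ} d → supp-sgn (inv (toList σ))
    (supp-map (balance⇒shape α′ γ′ sumγ (λ g → ≡.trans
        (≡.cong (ℕ._+ total g γ′) (≡.trans (sumℕ-lookup (g ∘ ρ) σ) (total-permutation (g ∘ ρ) σ d))) (sumρκ g)))
      (balance-prodF (λ s → factor (lookup σ s) s)))) (perms-distinct N))
    where
    factor : ∀ r s → Supp (Balance P (λ g → g (ρ r)) (λ g → g (κ s)) (λ g → total g (γ s)))
      (affine (cst r s) (coef r s) (a (ρ r) (κ s)))
    factor r s = supp-affine (cst r s) (coef r s) (ρ r , κ s) constant (linear (hγ s))
      where
      constant : cst r s ≈ 0# ⊎ Balance P (λ g → g (ρ r)) (λ g → g (κ s)) (λ g → total g (γ s)) []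
      constant with hcst r s
      ... | inj₁ z       = inj₁ z
      ... | inj₂ (e , z) = inj₂ (balance-[] (λ g → ≡.cong g e) (λ g → ≡.cong (total g) z))
      commuted : ∀ g → total g [ κ s ] ℕ.+ g (ρ r) ≡ total g [ ρ r ] ℕ.+ g (κ s)
      commuted g = ≡.trans (≡.cong (ℕ._+ g (ρ r)) (ℕP.+-identityʳ (g (κ s))))
        (≡.trans (ℕP.+-comm (g (κ s)) (g (ρ r))) (≡.cong (ℕ._+ g (κ s)) (≡.sym (ℕP.+-identityʳ (g (ρ r))))))
      linear : (γ s ≡ [] × P (κ s)) ⊎ γ s ≡ [ κ s ] →
        Balance P (λ g → g (ρ r)) (λ g → g (κ s)) (λ g → total g (γ s)) [ (ρ r , κ s) ]
      linear (inj₁ (e , p)) = balance [ κ s ] (p ∷ []) (λ g →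
        ≡.sym (≡.trans (≡.cong (λ z → total g [ κ s ] ℕ.+ total g z) e) (ℕP.+-identityʳ _)) , commuted g)
      linear (inj₂ e) = balance [] [] (λ g → ≡.sym (≡.cong (total g) e) , commuted g)

  Inner Outer : Fin m → Set
  Inner x = ∃[ s ] x ≡ inl s
  Outer x = ∃[ i ] x ≡ inr i

  -- Every inner label is smaller than every outer one.
  inner-indifferent : Indifferent Inner Outer
  inner-indifferent (s , ≡.refl) (i , ≡.refl) (i′ , ≡.refl) =
    ≡.trans (above i) (≡.sym (above i′)) , ≡.trans (under i) (≡.sym (under i′))
    where
    inl<inr : ∀ i → inl s Fin.< inr i
    inl<inr i = ≡.subst₂ ℕ._<_ (≡.sym (FinP.toℕ-↑ˡ s k)) (≡.sym (FinP.toℕ-↑ʳ n i))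
      (ℕP.<-≤-trans (FinP.toℕ<n s) (ℕP.m≤m+n n _))
    above : ∀ i → below (inl s) (inr i) ≡ 0
    above i = below-0 (ℕP.<-asym (inl<inr i))
    under : ∀ i → below (inr i) (inl s) ≡ 1
    under i = below-1 (inl<inr i)

  empty-indifferent : Indifferent (λ _ → ⊥) (λ _ → ⊤)
  empty-indifferent ()

  Φ-letter : ∀ x → Φ (letter x) ≐ letter x
  Φ-letter x w with w ≟W [ x ]
  ... | yes ≡.refl = trans (*-congʳ (*-identityˡ 1#)) (*-identityˡ _)
  ... | no _ = zeroʳ _

  qdet-letters : ∀ N (ρ κ : Fin N → Fin m) cst coef → qdet N ρ κ cst coef (λ r s → a (ρ r) (κ s)) ≐
    Φ (leibniz (λ r s → affine (cst r s) (coef r s) (a (ρ r) (κ s))))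
  qdet-letters N ρ κ cst coef = qdet-Φ empty-indifferent N ρ κ cst coef _ _ (λ _ → tt) (λ _ → tt)
    (λ r s → supp-letter (ρ r , κ s) (shape-letter (ρ r , κ s))) (λ r s → Φ-letter (ρ r , κ s))

  -- A left factor without end labels has only a core, and this core crosses the rows and the
  -- columns of the right factor equally often, so the cross weight is 1.
  Φ-*-neutral : ∀ {P P′ α β} f g → (∀ ν → All P ν → crossings ν β ≡ crossings ν α) →
    Supp (Shape P [] []) f → Supp (Shape P′ α β) g → Φ (f *S g) ≐ (Φ f *S Φ g)
  Φ-*-neutral f g h s t w = trans (Φ-* 1# f g s t (λ u v p p′ → trans
      (crossings-shape {u = u} {v} p p′ (h (Shape.core p) (Shape.core-all p)) ≡.refl) (*-identityˡ 1#)) w)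
    (*-identityˡ _)

  δ-cases : ∀ {N} (r s : Fin N) → δ r s ≈ 0# ⊎ r ≡ s
  δ-cases r s with r FinP.≟ s
  ... | yes e = inj₂ e
  ... | no _  = inj₁ refl

  shape-A : Supp (Shape (λ _ → ⊤) [] []) (leibniz matrixA)
  shape-A = supp-leibniz id id δ (λ _ _ → - 1#) (λ _ → []) [] [] (λ s → inj₁ (≡.refl , tt)) constant
      (λ g → sumℕ-0 {m} (λ _ → ≡.refl)) (λ g → ≡.refl)
    where
    constant : ∀ r s → δ r s ≈ 0# ⊎ (r ≡ s × [] ≡ [])
    constant r s with δ-cases r s
    ... | inj₁ z = inj₁ z
    ... | inj₂ e = inj₂ (e , ≡.refl)

  shape-A₀ : Supp (Shape Inner [] []) (leibniz matrixA₀)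
  shape-A₀ = supp-leibniz inl inl δ (λ _ _ → - 1#) (λ _ → []) [] [] (λ s → inj₁ (≡.refl , s , ≡.refl)) constant
      (λ g → sumℕ-0 {n} (λ _ → ≡.refl)) (λ g → ≡.refl)
    where
    constant : ∀ r s → δ r s ≈ 0# ⊎ (inl r ≡ inl s × [] ≡ [])
    constant r s with δ-cases r s
    ... | inj₁ z = inj₁ z
    ... | inj₂ e = inj₂ (≡.cong inl e , ≡.refl)

  -- The constants vanish in the last row and the last column, so every word that occurs contains
  -- the end labels `inr i` and `inr j`.
  shape-B : ∀ i j → Supp (Shape Inner [ inr i ] [ inr j ]) (leibniz (matrixB i j))
  shape-B i j = supp-leibniz (border i) (border j) cstB (λ _ _ → - 1#) γ [ inr i ] [ inr j ] hγ hcst sumγ sums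
    where
    γ : Fin (n ℕ.+ 1) → List (Fin m)
    γ s with splitAt n s
    ... | inj₁ _ = []
    ... | inj₂ _ = [ inr j ]
    γ-left : ∀ s → γ (s ↑ˡ 1) ≡ []
    γ-left s rewrite FinP.splitAt-↑ˡ n s 1 = ≡.refl
    γ-right : ∀ z → γ (n ↑ʳ z) ≡ [ inr j ]
    γ-right z rewrite FinP.splitAt-↑ʳ n 1 z = ≡.refl
    hγ : ∀ s → (γ s ≡ [] × Inner (border j s)) ⊎ γ s ≡ [ border j s ]
    hγ s with split n 1 s
    ... | left s′ = inj₁ (γ-left s′ , s′ , border-left j s′)
    ... | right z = inj₂ (≡.trans (γ-right z) (≡.cong [_] (≡.sym (border-right j z))))
    hcst : ∀ r s → cstB r s ≈ 0# ⊎ (border i r ≡ border j s × γ s ≡ [])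
    hcst r s with split n 1 r | split n 1 s
    ... | right z | _        = inj₁ (reflexive (cstB-row z s))
    ... | left r′ | right z  = inj₁ (reflexive (cstB-col (r′ ↑ˡ 1) z))
    ... | left r′ | left s′ with δ-cases r′ s′
    ... | inj₁ z = inj₁ (trans (reflexive (cstB-left r′ s′)) z)
    ... | inj₂ ≡.refl = inj₂ (≡.trans (border-left i r′) (≡.sym (border-left j r′)) , γ-left r′)
    sumγ : ∀ g → sumℕ (λ s → total g (γ s)) ≡ total g [ inr j ]
    sumγ g = ≡.trans (sumℕ-last n (λ s → total g (γ s))) (≡.cong₂ ℕ._+_
      (sumℕ-0 (λ s → ≡.cong (total g) (γ-left s))) (≡.cong (total g) (γ-right zero)))
    sum-border : ∀ i g → sumℕ (g ∘ border i) ≡ sumℕ (g ∘ inl) ℕ.+ g (inr i)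
    sum-border i g = ≡.trans (sumℕ-last n (g ∘ border i)) (≡.cong₂ ℕ._+_
      (sumℕ-cong (λ s → ≡.cong g (border-left i s))) (≡.cong g (border-right i zero)))
    sums : ∀ g → sumℕ (g ∘ border i) ℕ.+ total g [ inr j ] ≡ sumℕ (g ∘ border j) ℕ.+ total g [ inr i ]
    sums g = ≡.trans (≡.cong (ℕ._+ total g [ inr j ]) (sum-border i g))
      (≡.trans (swap (sumℕ (g ∘ inl)) (g (inr i)) (g (inr j)))
      (≡.cong (ℕ._+ total g [ inr i ]) (≡.sym (sum-border j g))))
      where
      swap : ∀ x y z → (x ℕ.+ y) ℕ.+ (z ℕ.+ 0) ≡ (x ℕ.+ z) ℕ.+ (y ℕ.+ 0)
      swap = NS.solve 3 (λ x y z → (x NS.:+ y) NS.:+ (z NS.:+ NS.con 0) NS.:= (x NS.:+ z) NS.:+ (y NS.:+ NS.con 0)) ≡.refl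
        where
        open import Data.Nat.Solver using (module +-*-Solver)
        module NS = +-*-Solver

  module _ (d : Series) (d*D : (d *S detIA₀) ≐ oneS) (D*d : (detIA₀ *S d) ≐ oneS) where

    Φ-A₀ : detIA₀ ≐ Φ (leibniz matrixA₀)
    Φ-A₀ = qdet-letters n inl inl δ (λ _ _ → - 1#)

    Φ-A : detIA ≐ Φ (leibniz matrixA)
    Φ-A = qdet-letters m id id δ (λ _ _ → - 1#)

    Φ-B : ∀ i j → detBordered i j ≐ Φ (leibniz (matrixB i j))
    Φ-B i j = qdet-letters (n ℕ.+ 1) (border i) (border j) cstB (λ _ _ → - 1#)

    Φ⁻¹ : Series → Series
    Φ⁻¹ f w = q^ (inv (rows w)) (inv (cols w)) * f w

    Φ-Φ⁻¹ : ∀ f → Φ (Φ⁻¹ f) ≐ f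
    Φ-Φ⁻¹ f w = trans (sym (*-assoc _ _ _)) (trans (*-congʳ (q^-inverse (inv (cols w)) (inv (rows w)))) (*-identityˡ _))

    Φ-injective : ∀ {f g} → Φ f ≐ Φ g → f ≐ g
    Φ-injective {f} {g} e w = trans (sym (cancel f)) (trans (*-congˡ (e w)) (cancel g))
      where
      cancel : ∀ f → q^ (inv (rows w)) (inv (cols w)) * Φ f w ≈ f w
      cancel f = trans (sym (*-assoc _ _ _)) (trans (*-congʳ (q^-inverse (inv (rows w)) (inv (cols w)))) (*-identityˡ _))

    Φ-one : Φ oneS ≐ oneS
    Φ-one []      = trans (*-congʳ (*-identityˡ 1#)) (*-identityˡ _)
    Φ-one (x ∷ w) = zeroʳ _

    d¹ : Series
    d¹ = Φ⁻¹ d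

    -- Weights do not enlarge supports, so the shape passes from the `q = 1` determinant to
    -- `detIA₀`, by inversion to `d`, and back to `d¹`.
    shape-d¹ : Supp (Shape Inner [] []) d¹
    shape-d¹ = supp-scale _ (supp-leftInverse shape-[] shape-++ D*d d*D
      (supp-≐ (S.sym Φ-A₀) (supp-scale wt shape-A₀)))

    Φ-d¹* : ∀ {P′ α β} g → (∀ ν → All Inner ν → crossings ν β ≡ crossings ν α) →
      Supp (Shape P′ α β) g → Φ (d¹ *S g) ≐ (d *S Φ g)
    Φ-d¹* g h s = S.trans (Φ-*-neutral d¹ g h shape-d¹ s) (*S-cong {g = Φ g} (Φ-Φ⁻¹ d) (λ _ → refl))

    -- Since weights are units, the equation may be checked after applying `Φ`, where it becomes the
    -- given equation for `d`.
    d¹*A₀ : (d¹ *S leibniz matrixA₀) ≐ oneS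
    d¹*A₀ = Φ-injective (S.trans (Φ-d¹* (leibniz matrixA₀) (λ ν _ → ≡.refl) shape-A₀)
      (S.trans (*S-cong {d} (λ _ → refl) (S.sym Φ-A₀)) (S.trans d*D (S.sym Φ-one))))

    c¹ : Fin k → Fin k → Series
    c¹ i j = -S (d¹ *S leibniz (matrixB i j))

    crossings-outer : ∀ i j ν → All Inner ν → crossings ν [ inr j ] ≡ crossings ν [ inr i ]
    crossings-outer i j []      []       = ≡.refl
    crossings-outer i j (x ∷ ν) (p ∷ ps) = ≡.cong₂ ℕ._+_
      (≡.cong (ℕ._+ 0) (proj₁ (inner-indifferent p (j , ≡.refl) (i , ≡.refl)))) (crossings-outer i j ν ps)

    Φ-c¹ : ∀ i j → Φ (c¹ i j) ≐ cq d i j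
    Φ-c¹ i j w = trans (sym (-‿distribʳ-* _ _)) (-‿cong (trans
      (Φ-d¹* (leibniz (matrixB i j)) (crossings-outer i j) (shape-B i j) w)
      (*S-cong {d} (λ _ → refl) (S.sym (Φ-B i j)) w)))

    shape-c¹ : ∀ i j → Supp (Shape Inner [ inr i ] [ inr j ]) (c¹ i j)
    shape-c¹ i j = supp-neg (supp-* shape-++ shape-d¹ (shape-B i j))

    matrixC : DQ.Matrix k
    matrixC i j = affine (δ i j) (- 1#) (c¹ i j)

    -- The q-determinant of C^q sees only outer labels, whereas `Φ` counts every inversion; the
    -- inner labels hidden in the entries are absorbed by `Φ-c¹` within a factor and cancel between
    -- factors.
    Φ-C : detIC d ≐ Φ (leibniz matrixC)
    Φ-C = qdet-Φ inner-indifferent k inr inr δ (λ _ _ → - 1#) (cq d) c¹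
      (λ i → i , ≡.refl) (λ j → j , ≡.refl) shape-c¹ Φ-c¹

    cancel-d¹ : ∀ f → (d¹ *S (DQ.det matrixA₀ *S f)) ≋ f
    cancel-d¹ f = Q.trans {d¹ *S (DQ.det matrixA₀ *S f)} {(d¹ *S DQ.det matrixA₀) *S f} {f}
      (Q.sym (Q.*-assoc d¹ (DQ.det matrixA₀) f))
      (Q.trans {(d¹ *S DQ.det matrixA₀) *S f} {oneS *S f} {f}
        (Q.*-congʳ {f} (Q.trans {d¹ *S DQ.det matrixA₀} {d¹ *S leibniz matrixA₀} {oneS}
          (Q.*-congˡ {d¹} (Q.sym {leibniz matrixA₀} (leibniz-≋ matrixA₀))) (≐⇒≋ d¹*A₀)))
        (Q.*-identityˡ f))

    c¹-path : ∀ i j → c¹ i j ≋ path (inr i) j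
    c¹-path i j = Q.trans {c¹ i j} { -S (-S path (inr i) j)} {path (inr i) j}
      (Q.-‿cong {d¹ *S leibniz (matrixB i j)} { -S path (inr i) j}
        (Q.trans {d¹ *S leibniz (matrixB i j)} {d¹ *S (DQ.det matrixA₀ *S (-S path (inr i) j))} { -S path (inr i) j}
          (Q.*-congˡ {d¹} (Q.trans {leibniz (matrixB i j)} {DQ.det (matrixB i j)} (leibniz-≋ (matrixB i j)) (det-B i j)))
          (cancel-d¹ (-S path (inr i) j))))
      (≐⇒≋ (λ w → -‿involutive (path (inr i) j w)))
      where open import Algebra.Properties.Ring ring using (-‿involutive)

    sylvester-≋ : (d¹ *S leibniz matrixA) ≋ leibniz matrixC
    sylvester-≋ = Q.trans {d¹ *S leibniz matrixA} {DQ.det matrixPaths} {leibniz matrixC}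
      (Q.trans {d¹ *S leibniz matrixA} {d¹ *S (DQ.det matrixA₀ *S DQ.det matrixPaths)} {DQ.det matrixPaths}
        (Q.*-congˡ {d¹} (Q.trans {leibniz matrixA} {DQ.det matrixA} (leibniz-≋ matrixA) det-A))
        (cancel-d¹ (DQ.det matrixPaths)))
      (Q.trans {DQ.det matrixPaths} {DQ.det matrixC} {leibniz matrixC}
        (DQ.det-cong {M = matrixPaths} {matrixC} (λ i j → Q.+-congˡ {δ i j ·S oneS}
          (≋-· (- 1#) (Q.sym {c¹ i j} (c¹-path i j)))))
        (Q.sym {leibniz matrixC} (leibniz-≋ matrixC)))

    -- Both sides are exactly `Φ` of the two sides at `q = 1`, so one application of `Φ-≋` transfers
    -- the congruence.
    sylvester : (d *S detIA) ∼ detIC d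
    sylvester e = Inq-≐ (Φ-≋ sylvester-≋ e) (λ w → +-cong
      (trans (Φ-d¹* (leibniz matrixA) (λ ν _ → ≡.refl) shape-A w) (*S-cong {d} (λ _ → refl) (S.sym Φ-A) w))
      (-‿cong (sym (Φ-C w))))

theorem7p6 : ∀ {c ℓ} (K : CommutativeRing c ℓ) → IsField K →
    (q qinv : CommutativeRing.Carrier K) →
    ¬ (CommutativeRing._≈_ K q (CommutativeRing.0# K)) →
    CommutativeRing._≈_ K (CommutativeRing._*_ K q qinv) (CommutativeRing.1# K) →
    (n k : ℕ) → 1 ≤ n → 1 ≤ k →
    (d : Setup.Series K q qinv n k) →
    Setup._≐_ K q qinv n k (Setup._*S_ K q qinv n k d (Setup.detIA₀ K q qinv n k)) (Setup.oneS K q qinv n k) →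
    Setup._≐_ K q qinv n k (Setup._*S_ K q qinv n k (Setup.detIA₀ K q qinv n k) d) (Setup.oneS K q qinv n k) →
    Setup._∼_ K q qinv n k (Setup._*S_ K q qinv n k d (Setup.detIA K q qinv n k)) (Setup.detIC K q qinv n k d)
theorem7p6 K _ q qinv _ q-inv n k _ _ = Sylvester.sylvester K q qinv q-inv n k
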